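{- Let $k\in\{3,5,7,9\}$ and let $n>k$ be an integer with $nk\equiv 3\pmod 4$. Then there exists a biembedding of the complete graph $K_{2nk+1}$ on an orientable surface such that every face is a $k$-cycle, and there exists a biembedding of the cocktail party graph of order $2nk+2$ on an orientable surface such that every face is a $k$-cycle.
   Context: A biembedding of a graph is a (cellular) embedding of the graph in a surface whose faces can be properly 2-coloured, so that each edge lies on exactly one face of each colour; here all faces are required to be (simple) $k$-cycles. The cocktail party graph of order $2t$ is $K_{2t}-I$, the complete graph on $\mathbb{Z}_{2t}$ minus the 1-factor $I$ with edges $[i,i+t]$, $i=0,\dots,t-1$. -}

module Defs where

open import Data.Nat using (ℕ; zero; suc; _+_; _*_; _<_)
open import Data.Fin using (Fin; toℕ; _≟_)
open import Data.Bool using (Bool; not; _∧_; T)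
open import Data.Product using (Σ; ∃; _×_; _,_; proj₁; proj₂)
open import Relation.Nullary using (¬_)
open import Relation.Nullary.Decidable using (⌊_⌋)
open import Relation.Binary.PropositionalEquality using (_≡_; _≢_)
import Data.Nat as ℕ

-- A simple graph on the vertex set Fin N, given by a (symmetric, irreflexive)
-- Boolean adjacency function.
Graph : ℕ → Set
Graph N = Fin N → Fin N → Bool

iter : {A : Set} → (A → A) → ℕ → A → A
iter f zero    x = x
iter f (suc i) x = f (iter f i x)

completeGraph : (N : ℕ) → Graph N
completeGraph N u v = not ⌊ u ≟ v ⌋

cocktailParty : (t : ℕ) → Graph (t + t)
cocktailParty t u v =
  not ⌊ u ≟ v ⌋ ∧ (not ⌊ toℕ u + t ℕ.≟ toℕ v ⌋ ∧ not ⌊ toℕ v + t ℕ.≟ toℕ u ⌋)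

-- A rotation system (combinatorial description of a cellular embedding in
-- an orientable surface): for each vertex v a map ρ v which, restricted to
-- the neighbourhood of v, is a cyclic permutation of the neighbours of v
-- (maps neighbours to neighbours, and the forward orbit of any neighbour
-- contains every neighbour).  Values on non-neighbours are irrelevant.
IsRotation : {N : ℕ} → Graph N → (Fin N → Fin N → Fin N) → Set
IsRotation {N} G ρ =
  ((v u : Fin N) → T (G v u) → T (G v (ρ v u))) ×
  ((v u w : Fin N) → T (G v u) → T (G v w) → ∃ λ i → iter (ρ v) i u ≡ w)

-- Face-tracing permutation on darts (u , v) (arcs u → v along an edge):
-- the face following the dart (u , v) continues with (v , ρ v u).
faceStep : {N : ℕ} → (Fin N → Fin N → Fin N) → Fin N × Fin N → Fin N × Fin N
faceStep ρ (u , v) = (v , ρ v u)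

AllFacesKCycles : {N : ℕ} → Graph N → (Fin N → Fin N → Fin N) → ℕ → Set
AllFacesKCycles {N} G ρ k =
  (u v : Fin N) → T (G u v) →
    (iter (faceStep ρ) k (u , v) ≡ (u , v)) ×
    ((i j : ℕ) → i < k → j < k →
       proj₁ (iter (faceStep ρ) i (u , v)) ≡ proj₁ (iter (faceStep ρ) j (u , v)) → i ≡ j)

-- Proper 2-colouring of the faces: a colour on darts that is constant along
-- faces, such that the two faces on either side of each edge [u,v]
-- (those containing the darts (u,v) and (v,u)) get different colours.
FacesTwoColourable : {N : ℕ} → Graph N → (Fin N → Fin N → Fin N) → Set
FacesTwoColourable {N} G ρ =
  Σ (Fin N → Fin N → Bool) λ c →
    ((u v : Fin N) → T (G u v) → c (proj₁ (faceStep ρ (u , v))) (proj₂ (faceStep ρ (u , v))) ≡ c u v) ×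
    ((u v : Fin N) → T (G u v) → c u v ≢ c v u)

OrientableKBiembedding : {N : ℕ} → Graph N → ℕ → Set
OrientableKBiembedding {N} G k =
  Σ (Fin N → Fin N → Fin N) λ ρ →
    IsRotation G ρ × AllFacesKCycles G ρ k × FacesTwoColourable G ρ

{-# OPTIONS --safe #-}
module Submission where

-- A bipartite graph with one face, k edges at each vertex and integer currents
-- ±1, …, ±nk, one on each edge, that add up to zero around every vertex without
-- a vanishing proper run of consecutive currents, develops over ℤ/N into a
-- 2-coloured orientable embedding by k-cycles in which u and v are adjacent iff
-- u − v ∈ {±1, …, ±nk}.  For N = 2nk + 1 this is the complete graph; for
-- N = 2nk + 2 only the difference N/2 is missing.
--
-- The graph is a Möbius ladder with n rungs, each rung replaced by k − 2 parallel
-- edges.  With all rotations alike the face tracing gives three faces; they meet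
-- at every vertex, so reversing the rotation at one vertex merges them.  The
-- rails carry the 2n largest currents and zigzag like a graceful labelling of a
-- path, so that the differences, which the rungs must carry, are small numbers.
-- Extra rung edges come in pairs with small sum (k = 5, 9) and in quadruples
-- x, −(x+1), −(x+2), x+3 of sum zero (k = 7, 9).  Integer partial sums bounded by
-- nk are distinct modulo both values of N.

open import Defs
open import Data.Bool using (Bool; true; false; T; not; _∧_; if_then_else_)
open import Data.Bool.Properties using (T?; not-involutive)
open import Data.Empty using (⊥; ⊥-elim)
open import Data.Fin using (Fin; zero; suc; toℕ; fromℕ; fromℕ<; inject₁)
import Data.Fin as Fin
open import Data.Fin.Patterns using (0F; 1F; 2F; 3F; 4F; 5F; 6F)
import Data.Fin.Properties as Finₚ
open import Data.Fin.Relation.Unary.Top using (view; view-fromℕ; view-inject₁; ‵fromℕ; ‵inject₁)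
open import Data.Integer as ℤ using (ℤ; +_; -[1+_]; +≤+; ∣_∣; 0ℤ)
open import Data.Integer.DivMod using (_%ℕ_; _/ℕ_; n%ℕd<d; a≡a%ℕn+[a/ℕn]*n)
import Data.Integer.Properties as ℤₚ
open import Data.Integer.Tactic.RingSolver using (solve-∀)
open import Data.List using (List; []; _∷_; _++_)
open import Data.List.Relation.Unary.All using (All; []; _∷_)
open import Data.List.Relation.Unary.All.Properties using (++⁺)
open import Data.Nat as ℕ using (ℕ; zero; suc; _+_; _*_; _≤_; _<_; _%_; s≤s; z≤n)
open import Data.Nat.DivMod using ([m+kn]%n≡m%n)
import Data.Nat.Properties as ℕₚ
import Data.Nat.Tactic.RingSolver as ℕSolver
open import Data.Product using (∃; ∃₂; _×_; _,_; proj₁; proj₂; uncurry)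
open import Data.Sum using (_⊎_; inj₁; inj₂; [_,_]′)
open import Data.Unit using (tt)
open import Data.Vec as Vec using (Vec; []; _∷_; lookup)
open import Data.Vec.N-ary using (N-ary; _$ⁿ_)
open import Function using (_∘_; id; case_of_)
open import Relation.Binary using (tri<; tri≈; tri>)
open import Relation.Binary.PropositionalEquality
open import Relation.Nullary using (¬_; yes; no; does)
open import Relation.Nullary.Decidable using (dec-true; dec-false; fromWitnessFalse; toWitnessFalse)

-- Linear arithmetic over ℕ and ℤ

infixl 6 _⊕_ _⊖_
infixl 6 _⊞_
infixl 7 _⊠_
infix  4 _≤ᴺ_ _<ᴺ_ _≡ᴺ_ _≤ᶻ_ _≡ᶻ_
infix  3 _⊢_

-- Parity decides which rung totals are possible. A line carries two rail currents of magnitudes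
-- `B + out t` and `B + inn t` with `out t + inn t` = 2n + 1, and its rung edges must add up to
-- `inn (t - 1) - out t`. Over all lines these totals add up to a number of the parity of n(2n + 1),
-- which is odd since n is odd. Totals ±1, ..., ±n add up to a number of the parity of n(n + 1)/2:
-- odd for n ≡ 1 (mod 4), the case k = 3, 7, but even for n ≡ 3, the case k = 5, 9. So only in the
-- former case can single rung edges with magnitudes 1, ..., n carry the totals; in the latter the
-- totals used repeat one value, and the pairs of edges correct this.
--
-- The label of a line is the larger of `out t` and `inn t`, minus n + 1; it runs through 0, ..., n
-- - 1. Where the larger one alternates between `out` and `inn` from line to line, the total is ±
-- the difference of the two labels. As n is odd, this alternation fails once around the cycle, and
-- there the total is ± (sum of the labels + 1).

Form : ℕ → Set
Form zero    = ℤ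
Form (suc k) = ℤ × Form k

value : ∀ {k} → Form k → Vec ℕ k → ℤ
value {zero}  c       []      = c
value {suc k} (a , f) (x ∷ ρ) = a ℤ.* + x ℤ.+ value f ρ

NonNeg : ∀ {k} → Vec ℕ k → Form k → Set
NonNeg ρ f = 0ℤ ℤ.≤ value f ρ

constant : ∀ {k} → ℤ → Form k
constant {zero}  c = c
constant {suc k} c = 0ℤ , constant c

variable′ : ∀ {k} → Fin k → Form k
variable′ zero    = + 1 , constant 0ℤ
variable′ (suc i) = 0ℤ , variable′ i

combine : ∀ {k} → ℤ → Form k → ℤ → Form k → Form k
combine {zero}  a f       b g       = a ℤ.* f ℤ.+ b ℤ.* g
combine {suc k} a (x , f) b (y , g) = a ℤ.* x ℤ.+ b ℤ.* y , combine a f b g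

value-constant : ∀ {k} c (ρ : Vec ℕ k) → value (constant c) ρ ≡ c
value-constant c []      = refl
value-constant c (x ∷ ρ) = trans (ℤₚ.+-identityˡ _) (value-constant c ρ)

value-variable : ∀ {k} i (ρ : Vec ℕ k) → value (variable′ i) ρ ≡ + Vec.lookup ρ i
value-variable zero    (x ∷ ρ) =
  trans (cong₂ ℤ._+_ (ℤₚ.*-identityˡ (+ x)) (value-constant 0ℤ ρ)) (ℤₚ.+-identityʳ _)
value-variable (suc i) (x ∷ ρ) = trans (ℤₚ.+-identityˡ _) (value-variable i ρ)

value-combine : ∀ {k} a (f : Form k) b g ρ →
                value (combine a f b g) ρ ≡ a ℤ.* value f ρ ℤ.+ b ℤ.* value g ρ
value-combine a f b g []      = refl
value-combine a (x , f) b (y , g) (z ∷ ρ) =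
  trans (cong (λ u → (a ℤ.* x ℤ.+ b ℤ.* y) ℤ.* + z ℤ.+ u) (value-combine a f b g ρ))
        (rearrange a x b y (+ z) (value f ρ) (value g ρ))
  where
  rearrange : ∀ a x b y z u v →
    (a ℤ.* x ℤ.+ b ℤ.* y) ℤ.* z ℤ.+ (a ℤ.* u ℤ.+ b ℤ.* v) ≡
    a ℤ.* (x ℤ.* z ℤ.+ u) ℤ.+ b ℤ.* (y ℤ.* z ℤ.+ v)
  rearrange = solve-∀

nonNeg-combine : ∀ {k} (ρ : Vec ℕ k) a f b g → NonNeg ρ f → NonNeg ρ g →
                 NonNeg ρ (combine (+ a) f (+ b) g)
nonNeg-combine ρ a f b g 0≤f 0≤g =
  subst (0ℤ ℤ.≤_) (sym (value-combine (+ a) f (+ b) g ρ))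
        (ℤₚ.+-mono-≤ (scaled a 0≤f) (scaled b 0≤g))
  where
  scaled : ∀ a {i} → 0ℤ ℤ.≤ i → 0ℤ ℤ.≤ + a ℤ.* i
  scaled a {i} 0≤i = subst (ℤ._≤ + a ℤ.* i) (ℤₚ.*-zeroʳ (+ a)) (ℤₚ.*-monoˡ-≤-nonNeg (+ a) 0≤i)

-- Fourier–Motzkin elimination over ℕ: each negative occurrence of the leading
-- variable x is cancelled against every positive one and against x ≥ 0.

cancel : ∀ {k} → ℕ → Form k → List (Form (suc k)) → List (Form k)
cancel b q []                     = []
cancel b q ((+ suc a , p) ∷ hs)   = combine (+ suc b) p (+ suc a) q ∷ cancel b q hs
cancel b q (_ ∷ hs)               = cancel b q hs

eliminate′ : ∀ {k} → List (Form (suc k)) → List (Form (suc k)) → List (Form k)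
eliminate′ all []                   = []
eliminate′ all ((+ 0 , f) ∷ hs)     = f ∷ eliminate′ all hs
eliminate′ all ((+ suc a , f) ∷ hs) = eliminate′ all hs
eliminate′ all ((-[1+ b ] , f) ∷ hs) = f ∷ cancel b f all ++ eliminate′ all hs

refutes : ∀ {k} → List (Form k) → Bool
refutes {zero}  []              = false
refutes {zero}  (+ _ ∷ hs)      = refutes hs
refutes {zero}  (-[1+ _ ] ∷ hs) = true
refutes {suc k} hs              = refutes (eliminate′ hs hs)

module _ {k} (x : ℕ) (ρ : Vec ℕ k) where

  drop-negative : ∀ b f → NonNeg (x ∷ ρ) (-[1+ b ] , f) → NonNeg ρ f
  drop-negative b f h =
    subst (0ℤ ℤ.≤_) (cancels -[1+ b ] (+ x) (value f ρ))
      (ℤₚ.+-mono-≤ h (subst (ℤ._≤ + suc b ℤ.* + x) (ℤₚ.*-zeroʳ (+ suc b))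
                            (ℤₚ.*-monoˡ-≤-nonNeg (+ suc b) {0ℤ} {+ x} (+≤+ ℕ.z≤n))))
    where
    cancels : ∀ b x f → (b ℤ.* x ℤ.+ f) ℤ.+ ℤ.- b ℤ.* x ≡ f
    cancels = solve-∀

  cancel-sound : ∀ b q hs → NonNeg (x ∷ ρ) (-[1+ b ] , q) → All (NonNeg (x ∷ ρ)) hs →
                 All (NonNeg ρ) (cancel b q hs)
  cancel-sound b q [] hq [] = []
  cancel-sound b q ((+ 0 , p) ∷ hs) hq (_ ∷ ps) = cancel-sound b q hs hq ps
  cancel-sound b q ((-[1+ _ ] , p) ∷ hs) hq (_ ∷ ps) = cancel-sound b q hs hq ps
  cancel-sound b q ((+ suc a , p) ∷ hs) hq (hp ∷ ps) =
    subst (0ℤ ℤ.≤_)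
      (trans (value-combine (+ suc b) (+ suc a , p) (+ suc a) (-[1+ b ] , q) (x ∷ ρ))
      (trans (cancels (+ suc b) (+ suc a) (+ x) (value p ρ) (value q ρ))
             (sym (value-combine (+ suc b) p (+ suc a) q ρ))))
      (nonNeg-combine (x ∷ ρ) (suc b) (+ suc a , p) (suc a) (-[1+ b ] , q) hp hq)
    ∷ cancel-sound b q hs hq ps
    where
    cancels : ∀ b a x u v →
      b ℤ.* (a ℤ.* x ℤ.+ u) ℤ.+ a ℤ.* (ℤ.- b ℤ.* x ℤ.+ v) ≡ b ℤ.* u ℤ.+ a ℤ.* v
    cancels = solve-∀

  eliminate-sound : ∀ all hs → All (NonNeg (x ∷ ρ)) all → All (NonNeg (x ∷ ρ)) hs →
                    All (NonNeg ρ) (eliminate′ all hs)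
  eliminate-sound all [] ha [] = []
  eliminate-sound all ((+ 0 , f) ∷ hs) ha (h ∷ ps) =
    subst (0ℤ ℤ.≤_) (ℤₚ.+-identityˡ _) h ∷ eliminate-sound all hs ha ps
  eliminate-sound all ((+ suc a , f) ∷ hs) ha (h ∷ ps) = eliminate-sound all hs ha ps
  eliminate-sound all ((-[1+ b ] , f) ∷ hs) ha (h ∷ ps) =
    drop-negative b f h ∷ ++⁺ (cancel-sound b f all h ha) (eliminate-sound all hs ha ps)

refutes-sound : ∀ {k} (ρ : Vec ℕ k) hs → T (refutes hs) → All (NonNeg ρ) hs → ⊥
refutes-sound []      (+ _ ∷ hs)      r (_ ∷ ps) = refutes-sound [] hs r ps
refutes-sound []      (-[1+ _ ] ∷ hs) r (() ∷ _)
refutes-sound (x ∷ ρ) hs              r ps =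
  refutes-sound ρ (eliminate′ hs hs) r (eliminate-sound x ρ hs hs ps ps)

-- Reflection of linear sequents

data NatExpr (k : ℕ) : Set where
  con  : ℕ → NatExpr k
  var  : Fin k → NatExpr k
  _⊕_  : NatExpr k → NatExpr k → NatExpr k
  _⊠_  : ℕ → NatExpr k → NatExpr k

data IntExpr (k : ℕ) : Set where
  pos     : NatExpr k → IntExpr k
  neg     : IntExpr k → IntExpr k
  _⊞_ _⊖_ : IntExpr k → IntExpr k → IntExpr k

data Formula (k : ℕ) : Set where
  _≤ᴺ_ _<ᴺ_ _≡ᴺ_ : NatExpr k → NatExpr k → Formula k
  _≤ᶻ_ _≡ᶻ_ : IntExpr k → IntExpr k → Formula k
  falsum : Formula k

data Sequent (k : ℕ) : Set where
  _⊢_ : List (Formula k) → Formula k → Sequent k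

module _ {k : ℕ} (ρ : Vec ℕ k) where

  nat : NatExpr k → ℕ
  nat (con c) = c
  nat (var i) = Vec.lookup ρ i
  nat (e ⊕ f) = nat e + nat f
  nat (c ⊠ e) = c * nat e

  int : IntExpr k → ℤ
  int (pos e) = + nat e
  int (neg e) = ℤ.- int e
  int (e ⊞ f) = int e ℤ.+ int f
  int (e ⊖ f) = int e ℤ.- int f

  Holds : Formula k → Set
  Holds (e ≤ᴺ f) = nat e ≤ nat f
  Holds (e <ᴺ f) = nat e < nat f
  Holds (e ≡ᴺ f) = nat e ≡ nat f
  Holds (e ≤ᶻ f) = int e ℤ.≤ int f
  Holds (e ≡ᶻ f) = int e ≡ int f
  Holds falsum   = ⊥

  Implication : List (Formula k) → Formula k → Set
  Implication []       g = Holds g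
  Implication (h ∷ hs) g = Holds h → Implication hs g

  Valid : Sequent k → Set
  Valid (hs ⊢ g) = Implication hs g

natForm : ∀ {k} → NatExpr k → Form k
natForm (con c) = constant (+ c)
natForm (var i) = variable′ i
natForm (e ⊕ f) = combine (+ 1) (natForm e) (+ 1) (natForm f)
natForm (c ⊠ e) = combine (+ c) (natForm e) 0ℤ (constant 0ℤ)

intForm : ∀ {k} → IntExpr k → Form k
intForm (pos e) = natForm e
intForm (neg e) = combine -[1+ 0 ] (intForm e) 0ℤ (constant 0ℤ)
intForm (e ⊞ f) = combine (+ 1) (intForm e) (+ 1) (intForm f)
intForm (e ⊖ f) = combine (+ 1) (intForm e) -[1+ 0 ] (intForm f)

_∸ᶠ_ : ∀ {k} → Form k → Form k → Form k
f ∸ᶠ g = combine (+ 1) f -[1+ 0 ] g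

forms : ∀ {k} → Formula k → List (Form k)
forms (e ≤ᴺ f) = (natForm f ∸ᶠ natForm e) ∷ []
forms (e <ᴺ f) = (natForm f ∸ᶠ natForm (con 1 ⊕ e)) ∷ []
forms (e ≡ᴺ f) = (natForm f ∸ᶠ natForm e) ∷ (natForm e ∸ᶠ natForm f) ∷ []
forms (e ≤ᶻ f) = (intForm f ∸ᶠ intForm e) ∷ []
forms (e ≡ᶻ f) = (intForm f ∸ᶠ intForm e) ∷ (intForm e ∸ᶠ intForm f) ∷ []
forms falsum   = constant -[1+ 0 ] ∷ []

module _ {k : ℕ} (ρ : Vec ℕ k) where

  private
    1x+1y : ∀ x y → + 1 ℤ.* x ℤ.+ + 1 ℤ.* y ≡ x ℤ.+ y
    1x+1y = solve-∀
    1x-1y : ∀ x y → + 1 ℤ.* x ℤ.+ -[1+ 0 ] ℤ.* y ≡ x ℤ.- y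
    1x-1y = solve-∀
    cx+0y : ∀ c x y → c ℤ.* x ℤ.+ 0ℤ ℤ.* y ≡ c ℤ.* x
    cx+0y = solve-∀

  natForm-value : ∀ e → value (natForm e) ρ ≡ + nat ρ e
  natForm-value (con c) = value-constant (+ c) ρ
  natForm-value (var i) = value-variable i ρ
  natForm-value (e ⊕ f) =
    trans (value-combine (+ 1) (natForm e) (+ 1) (natForm f) ρ)
    (trans (1x+1y (value (natForm e) ρ) (value (natForm f) ρ))
           (cong₂ ℤ._+_ (natForm-value e) (natForm-value f)))
  natForm-value (c ⊠ e) =
    trans (value-combine (+ c) (natForm e) 0ℤ (constant 0ℤ) ρ)
    (trans (cx+0y (+ c) (value (natForm e) ρ) (value {k} (constant 0ℤ) ρ))
    (trans (cong (+ c ℤ.*_) (natForm-value e)) (sym (ℤₚ.pos-* c (nat ρ e)))))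

  ∸ᶠ-value : ∀ f g → value (f ∸ᶠ g) ρ ≡ value f ρ ℤ.- value g ρ
  ∸ᶠ-value f g = trans (value-combine (+ 1) f -[1+ 0 ] g ρ) (1x-1y (value f ρ) (value g ρ))

  intForm-value : ∀ e → value (intForm e) ρ ≡ int ρ e
  intForm-value (pos e) = natForm-value e
  intForm-value (neg e) =
    trans (value-combine -[1+ 0 ] (intForm e) 0ℤ (constant 0ℤ) ρ)
    (trans (cx+0y -[1+ 0 ] (value (intForm e) ρ) (value {k} (constant 0ℤ) ρ))
    (trans (ℤₚ.-1*i≡-i _) (cong ℤ.-_ (intForm-value e))))
  intForm-value (e ⊞ f) =
    trans (value-combine (+ 1) (intForm e) (+ 1) (intForm f) ρ)
    (trans (1x+1y (value (intForm e) ρ) (value (intForm f) ρ))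
           (cong₂ ℤ._+_ (intForm-value e) (intForm-value f)))
  intForm-value (e ⊖ f) =
    trans (∸ᶠ-value (intForm e) (intForm f)) (cong₂ ℤ._-_ (intForm-value e) (intForm-value f))

  ≤⇒nonNeg : ∀ f g {i j} → value f ρ ≡ i → value g ρ ≡ j → i ℤ.≤ j → NonNeg ρ (g ∸ᶠ f)
  ≤⇒nonNeg f g refl refl i≤j = subst (0ℤ ℤ.≤_) (sym (∸ᶠ-value g f)) (ℤₚ.i≤j⇒0≤j-i i≤j)

  nonNeg⇒≤ : ∀ f g {i j} → value f ρ ≡ i → value g ρ ≡ j → NonNeg ρ (g ∸ᶠ f) → i ℤ.≤ j
  nonNeg⇒≤ f g refl refl h = ℤₚ.0≤i-j⇒j≤i (subst (0ℤ ℤ.≤_) (∸ᶠ-value g f) h)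

  holds⇒nonNeg : ∀ φ → Holds ρ φ → All (NonNeg ρ) (forms φ)
  holds⇒nonNeg (e ≤ᴺ f) h = ≤⇒nonNeg _ _ (natForm-value e) (natForm-value f) (+≤+ h) ∷ []
  holds⇒nonNeg (e <ᴺ f) h = ≤⇒nonNeg _ _ (natForm-value (con 1 ⊕ e)) (natForm-value f) (+≤+ h) ∷ []
  holds⇒nonNeg (e ≡ᴺ f) h =
    ≤⇒nonNeg _ _ (natForm-value e) (natForm-value f) (ℤₚ.≤-reflexive (cong +_ h)) ∷
    ≤⇒nonNeg _ _ (natForm-value f) (natForm-value e) (ℤₚ.≤-reflexive (cong +_ (sym h))) ∷ []
  holds⇒nonNeg (e ≤ᶻ f) h = ≤⇒nonNeg _ _ (intForm-value e) (intForm-value f) h ∷ []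
  holds⇒nonNeg (e ≡ᶻ f) h =
    ≤⇒nonNeg _ _ (intForm-value e) (intForm-value f) (ℤₚ.≤-reflexive h) ∷
    ≤⇒nonNeg _ _ (intForm-value f) (intForm-value e) (ℤₚ.≤-reflexive (sym h)) ∷ []

  nonNeg⇒holds : ∀ φ → All (NonNeg ρ) (forms φ) → Holds ρ φ
  nonNeg⇒holds (e ≤ᴺ f) (h ∷ []) =
    ℤₚ.drop‿+≤+ (nonNeg⇒≤ _ _ (natForm-value e) (natForm-value f) h)
  nonNeg⇒holds (e <ᴺ f) (h ∷ []) =
    ℤₚ.drop‿+≤+ (nonNeg⇒≤ _ _ (natForm-value (con 1 ⊕ e)) (natForm-value f) h)
  nonNeg⇒holds (e ≡ᴺ f) (h ∷ h′ ∷ []) =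
    ℕₚ.≤-antisym (ℤₚ.drop‿+≤+ (nonNeg⇒≤ _ _ (natForm-value e) (natForm-value f) h))
                 (ℤₚ.drop‿+≤+ (nonNeg⇒≤ _ _ (natForm-value f) (natForm-value e) h′))
  nonNeg⇒holds (e ≤ᶻ f) (h ∷ []) = nonNeg⇒≤ _ _ (intForm-value e) (intForm-value f) h
  nonNeg⇒holds (e ≡ᶻ f) (h ∷ h′ ∷ []) =
    ℤₚ.≤-antisym (nonNeg⇒≤ _ _ (intForm-value e) (intForm-value f) h)
                 (nonNeg⇒≤ _ _ (intForm-value f) (intForm-value e) h′)
  nonNeg⇒holds falsum (h ∷ []) with () ← subst (0ℤ ℤ.≤_) (value-constant {k} -[1+ 0 ] ρ) h

-- Over ℤ the negation of g ≥ 0 is -1 - g ≥ 0, so a goal holds once this form is refuted together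
-- with the hypotheses. An equation contributes two goals.
proves : ∀ {k} → List (Form k) → List (Form k) → Bool
proves hs []       = true
proves hs (g ∷ gs) = refutes ((constant -[1+ 0 ] ∸ᶠ g) ∷ hs) ∧ proves hs gs

checkFrom : ∀ {k} → List (Form k) → List (Formula k) → Formula k → Bool
checkFrom acc []       g = proves acc (forms g)
checkFrom acc (h ∷ hs) g = checkFrom (forms h ++ acc) hs g

check : ∀ {k} → Sequent k → Bool
check (hs ⊢ g) = checkFrom [] hs g

module _ {k : ℕ} (ρ : Vec ℕ k) where

  proves-sound : ∀ hs gs → T (proves hs gs) → All (NonNeg ρ) hs → All (NonNeg ρ) gs
  proves-sound hs []       _ ps = []
  proves-sound hs (g ∷ gs) r ps with refutes ((constant -[1+ 0 ] ∸ᶠ g) ∷ hs) in eq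
  ... | true = nonNeg ∷ proves-sound hs gs r ps
    where
    nonNeg : NonNeg ρ g
    nonNeg with 0ℤ ℤₚ.≤? value g ρ
    ... | yes 0≤g = 0≤g
    ... | no  0≰g = ⊥-elim (refutes-sound ρ _ (subst T (sym eq) tt)
      (≤⇒nonNeg ρ g (constant -[1+ 0 ]) refl (value-constant {k} -[1+ 0 ] ρ) (ℤₚ.i<j⇒i≤pred[j] (ℤₚ.≰⇒> 0≰g)) ∷ ps))

  checkFrom-sound : ∀ acc hs g → T (checkFrom acc hs g) → All (NonNeg ρ) acc → Implication ρ hs g
  checkFrom-sound acc []       g r ps = nonNeg⇒holds ρ g (proves-sound acc (forms g) r ps)
  checkFrom-sound acc (h ∷ hs) g r ps holds =
    checkFrom-sound (forms h ++ acc) hs g r (++⁺ (holds⇒nonNeg ρ h holds) ps)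

  check-sound : ∀ s → T (check s) → Valid ρ s
  check-sound (hs ⊢ g) r = checkFrom-sound [] hs g r []

-- Writing the sequent as a function of its variables gives them names. When the check succeeds,
-- `T (check s)` computes to the unit type and the implicit evidence is found by eta.
linear : ∀ {k} (ρ : Vec ℕ k) (f : N-ary k (NatExpr k) (Sequent k)) →
         let s = f $ⁿ Vec.map var (Vec.allFin k) in {T (check s)} → Valid ρ s
linear ρ f {r} = check-sound ρ (f $ⁿ Vec.map var (Vec.allFin _)) r

apply : ∀ {k} (ρ : Vec ℕ k) hs {g} → Implication ρ hs g → All (Holds ρ) hs → Holds ρ g
apply ρ []       imp []       = imp
apply ρ (h ∷ hs) imp (p ∷ ps) = apply ρ hs (imp p) ps

-- Symbolic distinctness and bounds

module _ {k : ℕ} (hs : List (Formula k)) where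

  -- A disequality is not a linear constraint, but the equation is: it joins the hypotheses and the
  -- whole system is refuted.
  differs : IntExpr k → IntExpr k → Bool
  differs e f = check ((e ≡ᶻ f) ∷ hs ⊢ falsum)

  allDiffer : ∀ {l} → IntExpr k → Vec (IntExpr k) l → Bool
  allDiffer e []       = true
  allDiffer e (f ∷ fs) = differs e f ∧ allDiffer e fs

  pairwiseDiffer : ∀ {l} → Vec (IntExpr k) l → Bool
  pairwiseDiffer []       = true
  pairwiseDiffer (e ∷ es) = allDiffer e es ∧ pairwiseDiffer es

  allWithin : ∀ {l} → NatExpr k → Vec (IntExpr k) l → Bool
  allWithin b []       = true
  allWithin b (e ∷ es) =
    (check (hs ⊢ e ≤ᶻ pos b) ∧ check (hs ⊢ neg (pos b) ≤ᶻ e)) ∧ allWithin b es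

  module _ (ρ : Vec ℕ k) (ps : All (Holds ρ) hs) where

    ∧-left : ∀ {a b} → T (a ∧ b) → T a
    ∧-left {true} _ = tt

    ∧-right : ∀ {a b} → T (a ∧ b) → T b
    ∧-right {true} t = t

    allDiffer-sound : ∀ {l} e (es : Vec (IntExpr k) l) → T (allDiffer e es) →
                      ∀ i → int ρ e ≢ int ρ (Vec.lookup es i)
    allDiffer-sound e (f ∷ fs) r zero    eq =
      apply ρ hs (check-sound ρ ((e ≡ᶻ f) ∷ hs ⊢ falsum) (∧-left r) eq) ps
    allDiffer-sound e (f ∷ fs) r (suc i) eq =
      allDiffer-sound e fs (∧-right {differs e f} r) i eq

    -- The partial sums at a line are finitely many expressions, affine in the parameters of that
    -- line. Checking all pairs symbolically therefore settles every line at once.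
    lookup-injective : ∀ {l} (es : Vec (IntExpr k) l) → T (pairwiseDiffer es) → ∀ i j →
                       int ρ (Vec.lookup es i) ≡ int ρ (Vec.lookup es j) → i ≡ j
    lookup-injective (e ∷ es) r zero    zero    _  = refl
    lookup-injective (e ∷ es) r zero    (suc j) eq = ⊥-elim (allDiffer-sound e es (∧-left r) j eq)
    lookup-injective (e ∷ es) r (suc i) zero    eq = ⊥-elim (allDiffer-sound e es (∧-left r) i (sym eq))
    lookup-injective (e ∷ es) r (suc i) (suc j) eq =
      cong suc (lookup-injective es (∧-right {allDiffer e es} r) i j eq)

    lookup-within : ∀ {l} b (es : Vec (IntExpr k) l) → T (allWithin b es) → ∀ i →
                    ℤ.∣ int ρ (Vec.lookup es i) ∣ ≤ nat ρ b
    lookup-within b (e ∷ es) r zero = within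
      (apply ρ hs (check-sound ρ (hs ⊢ e ≤ᶻ pos b) (∧-left (∧-left r))) ps)
      (apply ρ hs (check-sound ρ (hs ⊢ neg (pos b) ≤ᶻ e)
        (∧-right {check (hs ⊢ e ≤ᶻ pos b)} (∧-left r))) ps)
      where
      within : ∀ {i b} → i ℤ.≤ + b → ℤ.- + b ℤ.≤ i → ℤ.∣ i ∣ ≤ b
      within {+ _}                  (+≤+ i≤b)     _             = i≤b
      within { -[1+ _ ]} {suc _} _ (ℤ.-≤- i≤b) = ℕ.s≤s i≤b
    lookup-within b (e ∷ es) r (suc i) =
      lookup-within b es
        (∧-right {check (hs ⊢ e ≤ᶻ pos b) ∧ check (hs ⊢ neg (pos b) ≤ᶻ e)} r) i

-- Embeddings from current graphs

iter-+ : {A : Set} (f : A → A) (i j : ℕ) (x : A) → iter f (i + j) x ≡ iter f i (iter f j x)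
iter-+ f zero    j x = refl
iter-+ f (suc i) j x = cong f (iter-+ f i j x)

iter-conjugate : {A B : Set} (f : A → A) (g : B → B) (h : A → B) →
                 (∀ x → h (f x) ≡ g (h x)) → ∀ i x → h (iter f i x) ≡ iter g i (h x)
iter-conjugate f g h e zero    x = refl
iter-conjugate f g h e (suc i) x = trans (e _) (cong g (iter-conjugate f g h e i x))

Reaches : {A : Set} → (A → A) → A → A → Set
Reaches f x y = ∃ λ i → iter f i x ≡ y

reaches-trans : {A : Set} {f : A → A} {x y z : A} → Reaches f x y → Reaches f y z → Reaches f x z
reaches-trans {f = f} {x} (i , p) (j , q) =
  j + i , trans (iter-+ f j i x) (trans (cong (iter f j) p) q)

∣∣-≡⇒± : ∀ i j → ∣ i ∣ ≡ ∣ j ∣ → i ≡ j ⊎ i ≡ ℤ.- j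
∣∣-≡⇒± (+ _)       (+ _)       refl = inj₁ refl
∣∣-≡⇒± (+ suc _)   (-[1+ _ ])  refl = inj₂ refl
∣∣-≡⇒± (-[1+ _ ])  (+ suc _)   refl = inj₂ refl
∣∣-≡⇒± (-[1+ _ ])  (-[1+ _ ])  refl = inj₁ refl

-- Residues modulo N

module Cyclic (N : ℕ) .{{_ : ℕ.NonZero N}} where

  residue : ℤ → Fin N
  residue a = fromℕ< (n%ℕd<d a N)

  residue-decomposition : ∀ a → a ≡ + toℕ (residue a) ℤ.+ a /ℕ N ℤ.* + N
  residue-decomposition a = trans (a≡a%ℕn+[a/ℕn]*n a N)
    (cong (λ r → + r ℤ.+ a /ℕ N ℤ.* + N) (sym (Finₚ.toℕ-fromℕ< (n%ℕd<d a N))))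

  small-multiple : ∀ a q → ∣ a ∣ < N → a ≡ q ℤ.* + N → a ≡ 0ℤ
  small-multiple a q ∣a∣<N eq with ∣ q ∣ | trans (cong ∣_∣ eq) (ℤₚ.abs-* q (+ N))
  ... | zero  | ∣a∣≡0 = ℤₚ.∣i∣≡0⇒i≡0 ∣a∣≡0
  ... | suc c | ∣a∣≡  =
    ⊥-elim (ℕₚ.<⇒≱ ∣a∣<N (subst (N ≤_) (sym ∣a∣≡) (ℕₚ.m≤m+n N (c * N))))

  residue-unique : ∀ a v q → a ≡ + toℕ v ℤ.+ q ℤ.* + N → residue a ≡ v
  residue-unique a v q eq = Finₚ.toℕ-injective (ℤₚ.+-injective
    (ℤₚ.i-j≡0⇒i≡j _ _ (small-multiple _ (q ℤ.- a /ℕ N) bound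
      (rearrange (+ toℕ (residue a)) (+ toℕ v) (a /ℕ N) q (+ N)
        (trans (sym (residue-decomposition a)) eq)))))
    where
    bound : ∣ + toℕ (residue a) ℤ.- + toℕ v ∣ < N
    bound = ℕₚ.≤-<-trans
      (subst (_≤ toℕ (residue a) ℕ.⊔ toℕ v)
             (cong ∣_∣ (sym (ℤₚ.m-n≡m⊖n (toℕ (residue a)) (toℕ v))))
             (ℤₚ.∣m⊝n∣≤m⊔n (toℕ (residue a)) (toℕ v)))
      (ℕₚ.⊔-pres-<m (Finₚ.toℕ<n (residue a)) (Finₚ.toℕ<n v))
    rearrange : ∀ r v s q n → r ℤ.+ s ℤ.* n ≡ v ℤ.+ q ℤ.* n → r ℤ.- v ≡ (q ℤ.- s) ℤ.* n
    rearrange r v s q n e =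
      trans (left r v s n) (trans (cong (λ x → x ℤ.- v ℤ.- s ℤ.* n) e) (right v s q n))
      where
      left : ∀ r v s n → r ℤ.- v ≡ r ℤ.+ s ℤ.* n ℤ.- v ℤ.- s ℤ.* n
      left = solve-∀
      right : ∀ v s q n → v ℤ.+ q ℤ.* n ℤ.- v ℤ.- s ℤ.* n ≡ (q ℤ.- s) ℤ.* n
      right = solve-∀

  residue-cong : ∀ a b q → a ≡ b ℤ.+ q ℤ.* + N → residue a ≡ residue b
  residue-cong a b q eq = residue-unique a (residue b) (b /ℕ N ℤ.+ q)
    (trans eq (trans (cong (ℤ._+ q ℤ.* + N) (residue-decomposition b))
                     (collect (+ toℕ (residue b)) (b /ℕ N) q (+ N))))
    where
    collect : ∀ r s q n → r ℤ.+ s ℤ.* n ℤ.+ q ℤ.* n ≡ r ℤ.+ (s ℤ.+ q) ℤ.* n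
    collect = solve-∀

  residue-assoc : ∀ (v : Fin N) a b → residue (+ toℕ (residue (+ toℕ v ℤ.+ a)) ℤ.+ b) ≡
                                      residue (+ toℕ v ℤ.+ (a ℤ.+ b))
  residue-assoc v a b = sym (residue-cong _ (+ toℕ (residue c) ℤ.+ b) (c /ℕ N)
    (trans (sym (ℤₚ.+-assoc (+ toℕ v) a b))
    (trans (cong (ℤ._+ b) (residue-decomposition c))
           (swap (+ toℕ (residue c)) (c /ℕ N ℤ.* + N) b))))
    where
    c = + toℕ v ℤ.+ a
    swap : ∀ x y z → x ℤ.+ y ℤ.+ z ≡ x ℤ.+ z ℤ.+ y
    swap = solve-∀

  residue-shift-injective : ∀ v a b → ∣ a ℤ.- b ∣ < N →
                            residue (v ℤ.+ a) ≡ residue (v ℤ.+ b) → a ≡ b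
  residue-shift-injective v a b small eq = ℤₚ.i-j≡0⇒i≡j a b
    (small-multiple _ (s ℤ.- t) small
      (trans (expand v a b)
      (trans (cong₂ ℤ._-_ (residue-decomposition (v ℤ.+ a))
                          (trans (residue-decomposition (v ℤ.+ b))
                                 (cong (λ r → + toℕ r ℤ.+ t ℤ.* + N) (sym eq))))
             (collect (+ toℕ (residue (v ℤ.+ a))) s t (+ N)))))
    where
    s = (v ℤ.+ a) /ℕ N
    t = (v ℤ.+ b) /ℕ N
    expand : ∀ v a b → a ℤ.- b ≡ (v ℤ.+ a) ℤ.- (v ℤ.+ b)
    expand = solve-∀
    collect : ∀ r s t n → (r ℤ.+ s ℤ.* n) ℤ.- (r ℤ.+ t ℤ.* n) ≡ (s ℤ.- t) ℤ.* n
    collect = solve-∀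

  infixl 6 _⊹_

  -- Sealed so that type checking never unfolds the division behind `residue`; everything later
  -- rests on the four laws below.
  abstract

    _⊹_ : Fin N → ℤ → Fin N
    v ⊹ a = residue (+ toℕ v ℤ.+ a)

    ⊹-≡ : ∀ v a u q → + toℕ v ℤ.+ a ≡ + toℕ u ℤ.+ q ℤ.* + N → v ⊹ a ≡ u
    ⊹-≡ v a u q = residue-unique _ u q

    ⊹-identity : ∀ v → v ⊹ 0ℤ ≡ v
    ⊹-identity v = residue-unique _ v 0ℤ refl

    ⊹-assoc : ∀ v a b → (v ⊹ a) ⊹ b ≡ v ⊹ (a ℤ.+ b)
    ⊹-assoc = residue-assoc

    ⊹-injective : ∀ v a b → ∣ a ℤ.- b ∣ < N → v ⊹ a ≡ v ⊹ b → a ≡ b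
    ⊹-injective v = residue-shift-injective (+ toℕ v)

-- One colour class of the vertices of the current graph, seen from the edges. Each edge has one end
-- in the class, `turn` passes to the next edge around that end, and `potential` is the sum of the
-- currents met before the edge. That `potential` is a function on edges while `turn` has period k
-- is Kirchhoff's law; `distinct` says that no proper run of currents vanishes.
record Polygons {X : Set} (f : X → ℤ) (M k : ℕ) : Set where
  field
    turn           : X → X
    potential      : X → ℤ
    potential-step : ∀ x → potential (turn x) ≡ potential x ℤ.+ f x
    bounded        : ∀ x → ∣ potential x ∣ ≤ M
    period         : ∀ x → iter turn k x ≡ x
    distinct       : ∀ x i j → i < k → j < k →
                     potential (iter turn i x) ≡ potential (iter turn j x) → i ≡ j

-- The bipartite graph and its rotations are stored as two permutations of the edge set. Their
-- composite is two steps of face tracing, so its transitivity means that there is a single face.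
record CurrentGraph (M k : ℕ) : Set₁ where
  field
    Edge                : Set
    edge                : Edge
    f                   : Edge → ℤ
    black white         : Polygons f M k
    magnitude-onto      : ∀ a → 1 ≤ a → a ≤ M → ∃ λ x → ∣ f x ∣ ≡ a
    magnitude-range     : ∀ x → 1 ≤ ∣ f x ∣ × ∣ f x ∣ ≤ M
    magnitude-injective : ∀ x y → ∣ f x ∣ ≡ ∣ f y ∣ → x ≡ y
    one-face            : ∀ x y → Reaches (Polygons.turn black ∘ Polygons.turn white) x y

-- By `small-bound`, integers of absolute value at most M are equal as soon as they are congruent
-- modulo N, so currents and potentials can be kept as integers.
record Circulant {N : ℕ} .{{_ : ℕ.NonZero N}} (G : Graph N) (M : ℕ) : Set where
  open Cyclic N
  field
    small-bound : M + M < N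
    adjacent    : ∀ v a → 1 ≤ ∣ a ∣ → ∣ a ∣ ≤ M → T (G v (v ⊹ a))
    difference  : ∀ v u → T (G v u) → ∃ λ a → (1 ≤ ∣ a ∣ × ∣ a ∣ ≤ M) × v ⊹ a ≡ u

-- The derived embedding

module Biembedding
  {N : ℕ} .{{_ : ℕ.NonZero N}} {G : Graph N} {M k : ℕ}
  (circulant : Circulant G M) (currentGraph : CurrentGraph M (suc k))
  where

  open Cyclic N
  open Circulant circulant
  open CurrentGraph currentGraph
  private
    module B = Polygons black
    module W = Polygons white

  -- The dart (true , x) has current f x and its black face lies ahead;
  -- (false , x) is its reverse.
  Dart : Set
  Dart = Bool × Edge

  current : Dart → ℤ
  current (true  , x) = f x
  current (false , x) = ℤ.- f x

  reverse : Dart → Dart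
  reverse (b , x) = not b , x

  along : Dart → Dart
  along (true  , x) = true  , B.turn x
  along (false , x) = false , W.turn x

  around : Dart → Dart
  around d = along (reverse d)

  -- A reversed dart carries the negated current; negating the white potential makes `height` grow
  -- by `current` along faces of both colours.
  height : Dart → ℤ
  height (true  , x) = B.potential x
  height (false , x) = ℤ.- W.potential x

  height-step : ∀ d → height (along d) ≡ height d ℤ.+ current d
  height-step (true  , x) = B.potential-step x
  height-step (false , x) =
    trans (cong ℤ.-_ (W.potential-step x)) (ℤₚ.neg-distrib-+ (W.potential x) (f x))

  ∣current∣ : ∀ b x → ∣ current (b , x) ∣ ≡ ∣ f x ∣
  ∣current∣ true  x = refl
  ∣current∣ false x = ℤₚ.∣-i∣≡∣i∣ (f x)

  ∣height∣≤M : ∀ d → ∣ height d ∣ ≤ M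
  ∣height∣≤M (true  , x) = B.bounded x
  ∣height∣≤M (false , x) = subst (_≤ M) (sym (ℤₚ.∣-i∣≡∣i∣ (W.potential x))) (W.bounded x)

  small-difference : ∀ a b → ∣ a ∣ ≤ M → ∣ b ∣ ≤ M → ∣ a ℤ.- b ∣ < N
  small-difference a b p q =
    ℕₚ.≤-<-trans (ℕₚ.≤-trans (ℤₚ.∣i-j∣≤∣i∣+∣j∣ a b) (ℕₚ.+-mono-≤ p q)) small-bound

  current-injective : ∀ d e → current d ≡ current e → d ≡ e
  current-injective (b , x) (c , y) eq
    with refl ← magnitude-injective x y
                  (trans (sym (∣current∣ b x)) (trans (cong ∣_∣ eq) (∣current∣ c y)))
    = cong (_, x) (same b c eq)
    where
    i≢-i : ∀ i → 1 ≤ ∣ i ∣ → i ≢ ℤ.- i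
    i≢-i (+ suc _)  _ ()
    i≢-i -[1+ _ ]   _ ()
    nonzero = proj₁ (magnitude-range x)
    same : ∀ b c → current (b , x) ≡ current (c , x) → b ≡ c
    same true  true  _ = refl
    same false false _ = refl
    same true  false e = ⊥-elim (i≢-i (f x) nonzero e)
    same false true  e = ⊥-elim (i≢-i (f x) nonzero (sym e))

  dart-of-current : ∀ a → 1 ≤ ∣ a ∣ → ∣ a ∣ ≤ M → ∃ λ d → current d ≡ a
  dart-of-current a p q with x , ∣fx∣≡∣a∣ ← magnitude-onto ∣ a ∣ p q
    with ∣∣-≡⇒± (f x) a ∣fx∣≡∣a∣
  ... | inj₁ eq = (true , x) , eq
  ... | inj₂ eq = (false , x) , trans (cong ℤ.-_ eq) (ℤₚ.neg-involutive a)

  current-range : ∀ d → 1 ≤ ∣ current d ∣ × ∣ current d ∣ ≤ M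
  current-range (b , x) = subst (λ n → 1 ≤ n × n ≤ M) (sym (∣current∣ b x)) (magnitude-range x)

  dart : Fin N → Fin N → Dart
  dart v u with T? (G v u)
  ... | yes e = let a , (p , q) , _ = difference v u e in proj₁ (dart-of-current a p q)
  ... | no _  = true , edge

  dart-correct : ∀ v u → T (G v u) → v ⊹ current (dart v u) ≡ u
  dart-correct v u e with T? (G v u)
  ... | yes e′ = let a , (p , q) , v⊹a≡u = difference v u e′ in
                 trans (cong (v ⊹_) (proj₂ (dart-of-current a p q))) v⊹a≡u
  ... | no ¬e = ⊥-elim (¬e e)

  head-adjacent : ∀ v d → T (G v (v ⊹ current d))
  head-adjacent v d = let p , q = current-range d in adjacent v (current d) p q

  dart-head : ∀ v d → dart v (v ⊹ current d) ≡ d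
  dart-head v d = current-injective _ d
    (⊹-injective v _ _
      (small-difference (current (dart v _)) (current d)
        (proj₂ (current-range (dart v _))) (proj₂ (current-range d)))
      (dart-correct v _ (head-adjacent v d)))

  -- The single face of the current graph lists all darts cyclically through `around`. Their
  -- currents, added to v, are the neighbours of v, and they inherit this cyclic order.
  rotation : Fin N → Fin N → Fin N
  rotation v u = v ⊹ current (around (dart v u))

  rotation-head : ∀ v d → rotation v (v ⊹ current d) ≡ v ⊹ current (around d)
  rotation-head v d = cong (λ e → v ⊹ current (around e)) (dart-head v d)

  -- A turn is undone by k further turns, the period being `suc k`.
  turn-white-onto : ∀ y → ∃ λ x → W.turn x ≡ y
  turn-white-onto y = iter W.turn k y , W.period y

  private
    black-dart : ∀ d → ∃ λ x → Reaches around d (true , x)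
    black-dart (true  , x) = x , 0 , refl
    black-dart (false , x) = B.turn x , 1 , refl

    double : ∀ i x → Reaches around (true , x) (true , iter (λ x → B.turn (W.turn x)) i x)
    double zero    x = 0 , refl
    double (suc i) x = reaches-trans {f = around} (double i x) (2 , refl)

    between-black : ∀ x y → Reaches around (true , x) (true , y)
    between-black x y with i , refl ← one-face x y = double i x

  -- Starting from a dart in direction `true`, two steps of `around` are one step of the transitive
  -- permutation in `one-face`; the darts in direction `false` lie one step before or after those.
  around-transitive : ∀ d e → Reaches around d e
  around-transitive d (true , y) with x , p ← black-dart d =
    reaches-trans {f = around} p (between-black x y)
  around-transitive d (false , y) with x , refl ← turn-white-onto y =
    reaches-trans {f = around} (around-transitive d (true , x)) (1 , refl)

  isRotation : IsRotation G rotation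
  isRotation = (λ v u _ → head-adjacent v (around (dart v u))) , λ v u w vu vw →
    let i , eq = around-transitive (dart v u) (dart v w) in
    i , trans (cong (iter (rotation v) i) (sym (dart-correct v u vu)))
        (trans (sym (iter-conjugate around (rotation v) (λ d → v ⊹ current d)
                       (λ d → sym (rotation-head v d)) i (dart v u)))
        (trans (cong (λ d → v ⊹ current d) eq) (dart-correct v w vw)))

  module _ (base : Fin N) where

    place : Dart → Fin N × Fin N
    place d = base ⊹ height d , base ⊹ height (along d)

    -- This makes the faces translates of the polygons. Seen from the head of `place d`, the tail
    -- lies along `reverse d`; the rotation there advances to `around (reverse d)`, which is
    -- `along d`, the next edge at the same vertex of the current graph.
    place-step : ∀ d → place (along d) ≡ faceStep rotation (place d)
    place-step d = cong (base ⊹ height (along d) ,_) (sym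
      (trans (cong (rotation (base ⊹ height (along d))) (sym back))
      (trans (rotation-head _ (reverse d))
      (trans (cong (λ e → base ⊹ height (along d) ⊹ current e) (forward d))
      (trans (⊹-assoc base _ _) (cong (base ⊹_) (sym (height-step (along d)))))))))
      where
      cancels : ∀ h c → h ℤ.+ c ℤ.+ ℤ.- c ≡ h
      cancels = solve-∀
      current-reverse : ∀ d → current (reverse d) ≡ ℤ.- current d
      current-reverse (true  , x) = refl
      current-reverse (false , x) = sym (ℤₚ.neg-involutive (f x))
      back : base ⊹ height (along d) ⊹ current (reverse d) ≡ base ⊹ height d
      back = trans (⊹-assoc base _ _) (cong (base ⊹_)
        (trans (cong₂ ℤ._+_ (height-step d) (current-reverse d)) (cancels (height d) (current d))))
      forward : ∀ d → around (reverse d) ≡ along d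
      forward (true  , x) = refl
      forward (false , x) = refl

    along-period : ∀ d → iter along (suc k) d ≡ d
    along-period (true , x) =
      trans (sym (iter-conjugate B.turn along (true ,_) (λ _ → refl) (suc k) x)) (cong (true ,_) (B.period x))
    along-period (false , x) =
      trans (sym (iter-conjugate W.turn along (false ,_) (λ _ → refl) (suc k) x)) (cong (false ,_) (W.period x))

    along-distinct : ∀ d i j → i < suc k → j < suc k →
                     height (iter along i d) ≡ height (iter along j d) → i ≡ j
    along-distinct (true , x) i j i<k j<k eq
      rewrite sym (iter-conjugate B.turn along (true ,_) (λ _ → refl) i x)
            | sym (iter-conjugate B.turn along (true ,_) (λ _ → refl) j x)
      = B.distinct x i j i<k j<k eq
    along-distinct (false , x) i j i<k j<k eq
      rewrite sym (iter-conjugate W.turn along (false ,_) (λ _ → refl) i x)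
            | sym (iter-conjugate W.turn along (false ,_) (λ _ → refl) j x)
      = W.distinct x i j i<k j<k (ℤₚ.neg-injective eq)

    face-at : ∀ d i → iter (faceStep rotation) i (place d) ≡ place (iter along i d)
    face-at d i = sym (iter-conjugate along (faceStep rotation) place place-step i d)

    face-period : ∀ d → iter (faceStep rotation) (suc k) (place d) ≡ place d
    face-period d = trans (face-at d (suc k)) (cong place (along-period d))

    face-simple : ∀ d i j → i < suc k → j < suc k →
      proj₁ (iter (faceStep rotation) i (place d)) ≡ proj₁ (iter (faceStep rotation) j (place d)) →
      i ≡ j
    face-simple d i j i<k j<k eq = along-distinct d i j i<k j<k
      (⊹-injective base _ _
        (small-difference (height (iter along i d)) (height (iter along j d))
          (∣height∣≤M (iter along i d)) (∣height∣≤M (iter along j d)))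
        (trans (sym (cong proj₁ (face-at d i))) (trans eq (cong proj₁ (face-at d j)))))

  -- The polygon through the dart is translated until its corner of height `height d` falls on u.
  -- Hence every arc lies on a face already described by `place`.
  placed : ∀ u v → T (G u v) → place (u ⊹ ℤ.- height (dart u v)) (dart u v) ≡ (u , v)
  placed u v e = cong₂ _,_
    (trans (⊹-assoc u _ _) (trans (cong (u ⊹_) (ℤₚ.+-inverseˡ (height d))) (⊹-identity u)))
    (trans (⊹-assoc u _ _) (trans (cong (u ⊹_) total) (dart-correct u v e)))
    where
    d = dart u v
    cancels : ∀ h c → ℤ.- h ℤ.+ (h ℤ.+ c) ≡ c
    cancels = solve-∀
    total : ℤ.- height d ℤ.+ height (along d) ≡ current d
    total = trans (cong (λ h → ℤ.- height d ℤ.+ h) (height-step d)) (cancels (height d) (current d))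

  allFacesCycles : AllFacesKCycles G rotation (suc k)
  allFacesCycles u v e =
    subst (λ p → (iter (faceStep rotation) (suc k) p ≡ p) ×
                 ((i j : ℕ) → i < suc k → j < suc k →
                  proj₁ (iter (faceStep rotation) i p) ≡ proj₁ (iter (faceStep rotation) j p) → i ≡ j))
          (placed u v e)
          (face-period _ (dart u v) , face-simple _ (dart u v))

  dart-back : ∀ u v → T (G u v) → dart v u ≡ reverse (dart u v)
  dart-back u v e = trans (cong (dart v) (sym back)) (dart-head v (reverse d))
    where
    d = dart u v
    current-reverse : ∀ d → current d ℤ.+ current (reverse d) ≡ 0ℤ
    current-reverse (true  , x) = ℤₚ.+-inverseʳ (f x)
    current-reverse (false , x) = ℤₚ.+-inverseˡ (f x)
    back : v ⊹ current (reverse d) ≡ u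
    back = trans (cong (_⊹ current (reverse d)) (sym (dart-correct u v e)))
      (trans (⊹-assoc u _ _) (trans (cong (u ⊹_) (current-reverse d)) (⊹-identity u)))

  -- A face takes its colour from the class of the vertex of the current graph it comes from. The
  -- two directions of an edge belong to different classes.
  twoColourable : FacesTwoColourable G rotation
  twoColourable = colour , constant-along , differ
    where
    colour : Fin N → Fin N → Bool
    colour u v = proj₁ (dart u v)
    along-colour : ∀ d → proj₁ (along d) ≡ proj₁ d
    along-colour (true  , x) = refl
    along-colour (false , x) = refl
    not-fixed : ∀ b → b ≢ not b
    not-fixed true  ()
    not-fixed false ()
    constant-along : ∀ u v → T (G u v) → colour v (rotation v u) ≡ colour u v
    constant-along u v e =
      trans (cong proj₁ (dart-head v (around (dart v u))))
      (trans (along-colour (reverse (dart v u)))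
      (trans (cong (λ d → not (proj₁ d)) (dart-back u v e)) (not-involutive (proj₁ (dart u v)))))
    differ : ∀ u v → T (G u v) → colour u v ≢ colour v u
    differ u v e eq = not-fixed (colour u v) (trans eq (cong proj₁ (dart-back u v e)))

  biembedding : OrientableKBiembedding G (suc k)
  biembedding = rotation , isRotation , allFacesCycles , twoColourable

-- Complete graphs and cocktail party graphs

-- The two ways around ℤ/N between vertices whose labels differ by D.
Short : ℕ → ℕ → ℕ → Set
Short N M D = (1 ≤ D × D ≤ M) ⊎ ∃ λ r → (1 ≤ r × r ≤ M) × D + r ≡ N

module _ {N : ℕ} .{{_ : ℕ.NonZero N}} (M : ℕ) where

  open Cyclic N

  short-up : ∀ v u D → toℕ v + D ≡ toℕ u → Short N M D →
             ∃ λ a → (1 ≤ ∣ a ∣ × ∣ a ∣ ≤ M) × v ⊹ a ≡ u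
  short-up v u D eq (inj₁ (p , q)) = + D , (p , q) , ⊹-≡ v _ u 0ℤ
    (linear (toℕ v ∷ D ∷ toℕ u ∷ []) (λ v D u → (v ⊕ D ≡ᴺ u) ∷ [] ⊢ pos v ⊞ pos D ≡ᶻ pos u ⊞ pos (con 0)) eq)
  short-up v u D eq (inj₂ (r , (p , q) , eq′)) =
    ℤ.- + r , subst (λ m → 1 ≤ m × m ≤ M) (sym (ℤₚ.∣-i∣≡∣i∣ (+ r))) (p , q) , ⊹-≡ v _ u -[1+ 0 ]
    (trans (linear (toℕ v ∷ D ∷ toℕ u ∷ r ∷ N ∷ [])
      (λ v D u r N → (v ⊕ D ≡ᴺ u) ∷ (D ⊕ r ≡ᴺ N) ∷ [] ⊢ pos v ⊞ neg (pos r) ≡ᶻ pos u ⊞ neg (pos N)) eq eq′)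
      (cong (λ x → + toℕ u ℤ.+ x) (sym (ℤₚ.-1*i≡-i (+ N)))))

  short-down : ∀ v u D → toℕ u + D ≡ toℕ v → Short N M D →
               ∃ λ a → (1 ≤ ∣ a ∣ × ∣ a ∣ ≤ M) × v ⊹ a ≡ u
  short-down v u D eq (inj₁ (p , q)) =
    ℤ.- + D , subst (λ m → 1 ≤ m × m ≤ M) (sym (ℤₚ.∣-i∣≡∣i∣ (+ D))) (p , q) , ⊹-≡ v _ u 0ℤ
    (linear (toℕ v ∷ D ∷ toℕ u ∷ []) (λ v D u → (u ⊕ D ≡ᴺ v) ∷ [] ⊢ pos v ⊞ neg (pos D) ≡ᶻ pos u ⊞ pos (con 0)) eq)
  short-down v u D eq (inj₂ (r , (p , q) , eq′)) =
    + r , (p , q) , ⊹-≡ v _ u (+ 1)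
    (trans (linear (toℕ v ∷ D ∷ toℕ u ∷ r ∷ N ∷ [])
      (λ v D u r N → (u ⊕ D ≡ᴺ v) ∷ (D ⊕ r ≡ᴺ N) ∷ [] ⊢ pos v ⊞ pos r ≡ᶻ pos u ⊞ pos N) eq eq′)
      (cong (λ x → + toℕ u ℤ.+ x) (sym (ℤₚ.*-identityˡ (+ N)))))

  distance : ∀ v u → v ≢ u →
    (∀ D → (toℕ v + D ≡ toℕ u) ⊎ (toℕ u + D ≡ toℕ v) → 1 ≤ D → D < N → Short N M D) →
    ∃ λ a → (1 ≤ ∣ a ∣ × ∣ a ∣ ≤ M) × v ⊹ a ≡ u
  distance v u v≢u short with ℕₚ.<-cmp (toℕ v) (toℕ u)
  ... | tri≈ _ eq _ = ⊥-elim (v≢u (Finₚ.toℕ-injective eq))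
  ... | tri< v<u _ _ = short-up v u D eq (short D (inj₁ eq) (ℕₚ.m<n⇒0<n∸m v<u)
                         (ℕₚ.≤-<-trans (ℕₚ.m∸n≤m _ (toℕ v)) (Finₚ.toℕ<n u)))
    where
    D = toℕ u ℕ.∸ toℕ v
    eq = ℕₚ.m+[n∸m]≡n (ℕₚ.<⇒≤ v<u)
  ... | tri> _ _ u<v = short-down v u D eq (short D (inj₂ eq) (ℕₚ.m<n⇒0<n∸m u<v)
                         (ℕₚ.≤-<-trans (ℕₚ.m∸n≤m _ (toℕ u)) (Finₚ.toℕ<n v)))
    where
    D = toℕ v ℕ.∸ toℕ u
    eq = ℕₚ.m+[n∸m]≡n (ℕₚ.<⇒≤ u<v)

  ≢-shift : ∀ (v : Fin N) a → M < N → 1 ≤ ∣ a ∣ → ∣ a ∣ ≤ M → v ≢ v ⊹ a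
  ≢-shift v a M<N 1≤∣a∣ ∣a∣≤M eq with refl ← ⊹-injective v a 0ℤ
      (ℕₚ.≤-<-trans (subst (λ b → ∣ b ∣ ≤ M) (sym (ℤₚ.+-identityʳ a)) ∣a∣≤M) M<N)
      (trans (sym eq) (sym (⊹-identity v)))
    with () ← 1≤∣a∣

completeGraph-circulant : ∀ M N → N ≡ 2 * M + 1 → .{{_ : ℕ.NonZero N}} → Circulant (completeGraph N) M
completeGraph-circulant M N N≡ = record
  { small-bound = linear (M ∷ N ∷ []) (λ M N → (N ≡ᴺ 2 ⊠ M ⊕ con 1) ∷ [] ⊢ M ⊕ M <ᴺ N) N≡
  ; adjacent    = λ v a p q → fromWitnessFalse
      (≢-shift M v a (linear (M ∷ N ∷ []) (λ M N → (N ≡ᴺ 2 ⊠ M ⊕ con 1) ∷ [] ⊢ M <ᴺ N) N≡) p q)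
  ; difference  = λ v u e → distance M v u (toWitnessFalse e) (λ D _ → short D)
  }
  where
  short : ∀ D → 1 ≤ D → D < N → Short N M D
  short D 1≤D D<N with D ℕ.≤? M
  ... | yes D≤M = inj₁ (1≤D , D≤M)
  ... | no  D≰M = inj₂ (N ℕ.∸ D , (ℕₚ.m<n⇒0<n∸m D<N ,
      linear (M ∷ N ∷ D ∷ (N ℕ.∸ D) ∷ [])
        (λ M N D r → (N ≡ᴺ 2 ⊠ M ⊕ con 1) ∷ (D ⊕ r ≡ᴺ N) ∷ (M <ᴺ D) ∷ [] ⊢ r ≤ᴺ M)
        N≡ eq (ℕₚ.≰⇒> D≰M)) , eq)
    where eq = ℕₚ.m+[n∸m]≡n (ℕₚ.<⇒≤ D<N)

cocktailParty-edge : ∀ t (v u : Fin (t + t)) → T (cocktailParty t v u) →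
  v ≢ u × toℕ v + t ≢ toℕ u × toℕ u + t ≢ toℕ v
cocktailParty-edge t v u e with v Fin.≟ u | toℕ v + t ℕ.≟ toℕ u | toℕ u + t ℕ.≟ toℕ v
... | no p | no q | no r = p , q , r

edge-cocktailParty : ∀ t (v u : Fin (t + t)) → v ≢ u → toℕ v + t ≢ toℕ u → toℕ u + t ≢ toℕ v →
  T (cocktailParty t v u)
edge-cocktailParty t v u p q r with v Fin.≟ u | toℕ v + t ℕ.≟ toℕ u | toℕ u + t ℕ.≟ toℕ v
... | yes p′ | _     | _      = ⊥-elim (p p′)
... | no _   | yes q′ | _     = ⊥-elim (q q′)
... | no _   | no _  | yes r′ = ⊥-elim (r r′)
... | no _   | no _  | no _   = tt

cocktailParty-circulant : ∀ M t → t ≡ M + 1 → .{{_ : ℕ.NonZero (t + t)}} → Circulant (cocktailParty t) M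
cocktailParty-circulant M t t≡ = record
  { small-bound = linear (M ∷ t ∷ []) (λ M t → (t ≡ᴺ M ⊕ con 1) ∷ [] ⊢ M ⊕ M <ᴺ t ⊕ t) t≡
  ; adjacent    = λ v a p q → edge-cocktailParty t v (v ⊹ a)
      (≢-shift M v a (linear (M ∷ t ∷ []) (λ M t → (t ≡ᴺ M ⊕ con 1) ∷ [] ⊢ M <ᴺ t ⊕ t) t≡) p q)
      (not-up v a q) (not-down v a q)
  ; difference  = λ v u e → let v≢u , ≢up , ≢down = cocktailParty-edge t v u e in
      distance M v u v≢u (short v u ≢up ≢down)
  }
  where
  open Cyclic (t + t)
  -- The antipodal difference t = M + 1 is just out of reach: the integers a and b differ by at most
  -- 2M + 1, which is less than 2t.
  not-near : ∀ v a b → ∣ a ∣ ≤ M → ∣ b ∣ ≡ t → v ⊹ a ≢ v ⊹ b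
  not-near v a b ∣a∣≤M ∣b∣≡t eq =
    linear (∣ a ∣ ∷ ∣ b ∣ ∷ M ∷ t ∷ [])
      (λ a b M t → (t ≡ᴺ M ⊕ con 1) ∷ (a ≤ᴺ M) ∷ (b ≡ᴺ t) ∷ (a ≡ᴺ b) ∷ [] ⊢ falsum)
      t≡ ∣a∣≤M ∣b∣≡t (cong ∣_∣ (⊹-injective v a b small eq))
    where
    small : ∣ a ℤ.- b ∣ < t + t
    small = ℕₚ.≤-<-trans (ℤₚ.∣i-j∣≤∣i∣+∣j∣ a b)
      (linear (∣ a ∣ ∷ ∣ b ∣ ∷ M ∷ t ∷ [])
        (λ a b M t → (t ≡ᴺ M ⊕ con 1) ∷ (a ≤ᴺ M) ∷ (b ≡ᴺ t) ∷ [] ⊢ a ⊕ b <ᴺ t ⊕ t) t≡ ∣a∣≤M ∣b∣≡t)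
  not-up : ∀ v a → ∣ a ∣ ≤ M → toℕ v + t ≢ toℕ (v ⊹ a)
  not-up v a ∣a∣≤M eq = not-near v a (+ t) ∣a∣≤M refl
    (sym (⊹-≡ v _ (v ⊹ a) 0ℤ (trans (cong +_ eq) (sym (ℤₚ.+-identityʳ _)))))
  not-down : ∀ v a → ∣ a ∣ ≤ M → toℕ (v ⊹ a) + t ≢ toℕ v
  not-down v a ∣a∣≤M eq = not-near v a (ℤ.- + t) ∣a∣≤M (ℤₚ.∣-i∣≡∣i∣ (+ t))
    (sym (⊹-≡ v _ (v ⊹ a) 0ℤ
      (linear (toℕ v ∷ toℕ (v ⊹ a) ∷ t ∷ [])
        (λ v u t → (u ⊕ t ≡ᴺ v) ∷ [] ⊢ pos v ⊞ neg (pos t) ≡ᶻ pos u ⊞ pos (con 0)) eq)))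
  short : ∀ v u → toℕ v + t ≢ toℕ u → toℕ u + t ≢ toℕ v →
          ∀ D → (toℕ v + D ≡ toℕ u) ⊎ (toℕ u + D ≡ toℕ v) → 1 ≤ D → D < t + t → Short (t + t) M D
  short v u ≢up ≢down D diff 1≤D D<N with ℕₚ.<-cmp D t
  ... | tri< D<t _ _ = inj₁ (1≤D ,
      linear (D ∷ M ∷ t ∷ []) (λ D M t → (t ≡ᴺ M ⊕ con 1) ∷ (D <ᴺ t) ∷ [] ⊢ D ≤ᴺ M) t≡ D<t)
  ... | tri≈ _ refl _ = ⊥-elim (antipodal diff)
    where
    antipodal : (toℕ v + t ≡ toℕ u) ⊎ (toℕ u + t ≡ toℕ v) → ⊥
    antipodal (inj₁ eq) = ≢up eq
    antipodal (inj₂ eq) = ≢down eq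
  ... | tri> _ _ t<D = inj₂ (t + t ℕ.∸ D , (ℕₚ.m<n⇒0<n∸m D<N ,
      linear (M ∷ t ∷ D ∷ (t + t ℕ.∸ D) ∷ [])
        (λ M t D r → (t ≡ᴺ M ⊕ con 1) ∷ (D ⊕ r ≡ᴺ t ⊕ t) ∷ (t <ᴺ D) ∷ [] ⊢ r ≤ᴺ M) t≡ eq t<D) , eq)
    where eq = ℕₚ.m+[n∸m]≡n (ℕₚ.<⇒≤ D<N)

-- Cyclic order on Fin n and orbits of injections

next : ∀ {n} → Fin (suc n) → Fin (suc n)
next i with view i
... | ‵fromℕ     = zero
... | ‵inject₁ j = suc j

prev : ∀ {n} → Fin (suc n) → Fin (suc n)
prev zero    = fromℕ _
prev (suc i) = inject₁ i

next-fromℕ : ∀ n → next (fromℕ n) ≡ zero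
next-fromℕ n rewrite view-fromℕ n = refl

next-inject₁ : ∀ {n} (i : Fin n) → next (inject₁ i) ≡ suc i
next-inject₁ i rewrite view-inject₁ i = refl

next-prev : ∀ {n} (i : Fin (suc n)) → next (prev i) ≡ i
next-prev zero    = next-fromℕ _
next-prev (suc i) = next-inject₁ i

prev-next : ∀ {n} (i : Fin (suc n)) → prev (next i) ≡ i
prev-next i with view i
... | ‵fromℕ     = refl
... | ‵inject₁ j = refl

next-injective : ∀ {n} {i j : Fin (suc n)} → next i ≡ next j → i ≡ j
next-injective {i = i} {j} eq = trans (sym (prev-next i)) (trans (cong prev eq) (prev-next j))

toℕ-next : ∀ {n} (i : Fin (suc n)) → toℕ i < n → toℕ (next i) ≡ suc (toℕ i)
toℕ-next {n} i i<n with view i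
... | ‵fromℕ     = ⊥-elim (ℕₚ.<-irrefl (Finₚ.toℕ-fromℕ n) i<n)
... | ‵inject₁ j = cong suc (sym (Finₚ.toℕ-inject₁ j))

ahead : ∀ {n} → ℕ → Fin (suc n)
ahead i = iter next i zero

toℕ-ahead : ∀ {n} i → i ≤ n → toℕ (ahead {n} i) ≡ i
toℕ-ahead zero    _   = refl
toℕ-ahead {n} (suc i) i<n =
  trans (toℕ-next (ahead i) (subst (_< n) (sym eq) i<n)) (cong suc eq)
  where eq = toℕ-ahead {n} i (ℕₚ.<⇒≤ i<n)

ahead-toℕ : ∀ {n} (i : Fin (suc n)) → ahead (toℕ i) ≡ i
ahead-toℕ i = Finₚ.toℕ-injective (toℕ-ahead (toℕ i) (Finₚ.toℕ≤pred[n] i))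

ahead-period : ∀ n → ahead {n} (suc n) ≡ zero
ahead-period n = trans (cong next (trans (cong ahead (sym (Finₚ.toℕ-fromℕ n))) (ahead-toℕ (fromℕ n))))
                       (next-fromℕ n)

iter-comm : {A : Set} (f : A → A) (i j : ℕ) (x : A) → iter f i (iter f j x) ≡ iter f j (iter f i x)
iter-comm f i j x =
  trans (sym (iter-+ f i j x)) (trans (cong (λ l → iter f l x) (ℕₚ.+-comm i j)) (iter-+ f j i x))

next-period : ∀ {n} (p : Fin (suc n)) → iter next (suc n) p ≡ p
next-period {n} p = subst (λ p → iter next (suc n) p ≡ p) (ahead-toℕ p)
  (trans (iter-comm next (suc n) (toℕ p) zero) (cong (iter next (toℕ p)) (ahead-period n)))

-- Rotating by `d` carries p to zero, and from zero the first `suc n` iterates have the values 0,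
-- ..., n.
next-distinct : ∀ {n} (p : Fin (suc n)) i j → i < suc n → j < suc n →
                iter next i p ≡ iter next j p → i ≡ j
next-distinct {n} p i j (s≤s i≤n) (s≤s j≤n) eq =
  trans (sym (toℕ-ahead i i≤n)) (trans (cong toℕ (trans (sym (rewind i))
    (trans (cong (iter next d) eq) (rewind j)))) (toℕ-ahead j j≤n))
  where
  d = suc n ℕ.∸ toℕ p
  to-zero : iter next d p ≡ zero
  to-zero = trans (cong (iter next d) (sym (ahead-toℕ p)))
    (trans (sym (iter-+ next d (toℕ p) zero))
    (trans (cong ahead (ℕₚ.m∸n+n≡m (ℕₚ.<⇒≤ (Finₚ.toℕ<n p)))) (ahead-period n)))
  rewind : ∀ i → iter next d (iter next i p) ≡ ahead i
  rewind i = trans (iter-comm next d i p) (cong (iter next i) to-zero)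

module _ {A : Set} {f : A → A} {m : ℕ} (code : A → Fin m)
         (code-injective : ∀ {x y} → code x ≡ code y → x ≡ y)
         (f-injective : ∀ {x y} → f x ≡ f y → x ≡ y) where

  iter-injective : ∀ i {x y} → iter f i x ≡ iter f i y → x ≡ y
  iter-injective zero    eq = eq
  iter-injective (suc i) eq = iter-injective i (f-injective eq)

  -- Two iterates agree by the pigeonhole principle, and injectivity cancels their common initial
  -- steps.
  recurrent : ∀ x → ∃ λ p → iter f (suc p) x ≡ x
  recurrent x with i , j , i<j , eq ← Finₚ.pigeonhole (ℕₚ.n<1+n m) (λ i → code (iter f (toℕ i) x)) =
    p , iter-injective (toℕ i)
      (trans (sym (iter-+ f (toℕ i) (suc p) x)) (trans (cong (λ l → iter f l x) i+p≡j) (sym (code-injective eq))))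
    where
    p = toℕ j ℕ.∸ suc (toℕ i)
    i+p≡j : toℕ i + suc p ≡ toℕ j
    i+p≡j = trans (ℕₚ.+-suc (toℕ i) p) (ℕₚ.m+[n∸m]≡n i<j)

  iter-multiple : ∀ p x → iter f p x ≡ x → ∀ l → iter f (l * p) x ≡ x
  iter-multiple p x eq zero    = refl
  iter-multiple p x eq (suc l) =
    trans (iter-+ f p (l * p) x) (trans (cong (iter f p) (iter-multiple p x eq l)) eq)

  -- If l steps lead from x to y and x has period p + 1, then l * p further steps complete l full
  -- periods. Orbits can thus be followed in whichever direction is convenient.
  reaches-sym : ∀ {x y} → Reaches f x y → Reaches f y x
  reaches-sym {x} (l , refl) with p , eq ← recurrent x =
    l * p , trans (sym (iter-+ f (l * p) l x))
      (trans (cong (λ i → iter f i x) (trans (ℕₚ.+-comm (l * p) l) (sym (ℕₚ.*-suc l p))))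
             (iter-multiple (suc p) x eq l))

injective⇒onto : ∀ {m} (g : Fin m → Fin m) → (∀ {i j} → g i ≡ g j → i ≡ j) → ∀ y → ∃ λ i → g i ≡ y
injective⇒onto {m} g g-injective y = search (Finₚ.pigeonhole (ℕₚ.n<1+n m) extended)
  where
  extended : Fin (suc m) → Fin m
  extended zero    = y
  extended (suc i) = g i
  search : ∃₂ (λ i j → i Fin.< j × extended i ≡ extended j) → ∃ λ i → g i ≡ y
  search (zero  , suc j , _ , eq) = j , sym eq
  search (suc i , suc j , i<j , eq) =
    ⊥-elim (Finₚ.<⇒≢ {i = suc i} {suc j} i<j (cong suc (g-injective eq)))

module _ {A : Set} {M : ℕ} (code : A → Fin M) (code-injective : ∀ {x y} → code x ≡ code y → x ≡ y)
         (g : A → ℕ) (onto : ∀ a → 1 ≤ a → a ≤ M → ∃ λ x → g x ≡ a) where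

  private
    section : Fin M → A
    section i = proj₁ (onto (suc (toℕ i)) (s≤s z≤n) (Finₚ.toℕ<n i))

    g-section : ∀ i → g (section i) ≡ suc (toℕ i)
    g-section i = proj₂ (onto (suc (toℕ i)) (s≤s z≤n) (Finₚ.toℕ<n i))

    section-onto : ∀ x → ∃ λ i → section i ≡ x
    section-onto x with i , eq ← injective⇒onto (λ i → code (section i)) (λ {i} {j} eq →
        Finₚ.toℕ-injective (ℕₚ.suc-injective (trans (sym (g-section i))
          (trans (cong g (code-injective eq)) (g-section j))))) (code x)
      = i , code-injective eq

  -- By counting, a set of at most M elements that attains all of 1, ..., M attains each of them
  -- once and nothing else. So it is enough to show that the currents are onto.
  onto⇒range : ∀ x → 1 ≤ g x × g x ≤ M
  onto⇒range x with i , refl ← section-onto x =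
    subst (1 ≤_) (sym (g-section i)) (s≤s z≤n) , subst (_≤ M) (sym (g-section i)) (Finₚ.toℕ<n i)

  onto⇒injective : ∀ x y → g x ≡ g y → x ≡ y
  onto⇒injective x y eq with i , refl ← section-onto x | j , refl ← section-onto y =
    cong section (Finₚ.toℕ-injective (ℕₚ.suc-injective (trans (sym (g-section i)) (trans eq (g-section j)))))

-- The twisted ladder and its single face

Cell : ℕ → ℕ → Set
Cell n k = Fin n × Fin k

shift : ∀ {n k} → Cell n (suc k) → Cell n (suc k)
shift (t , p) = t , next p

iter-shift : ∀ {n k} i (x : Cell n (suc k)) → iter shift i x ≡ (proj₁ x , iter next i (proj₂ x))
iter-shift zero    x = refl
iter-shift (suc i) x = cong shift (iter-shift i x)

shift-injective : ∀ {n k} {x y : Cell n (suc k)} → shift x ≡ shift y → x ≡ y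
shift-injective eq = cong₂ _,_ (cong proj₁ eq) (next-injective (cong proj₂ eq))

module _ {X : Set} {n k M : ℕ} (f : X → ℤ)
         (φ : X → Cell n (suc k)) (φ⁻¹ : Cell n (suc k) → X)
         (inverseˡ : ∀ x → φ⁻¹ (φ x) ≡ x) (inverseʳ : ∀ y → φ (φ⁻¹ y) ≡ y)
         (h : Fin n → Fin (suc k) → ℤ)
         (h-step : ∀ x → uncurry h (shift (φ x)) ≡ uncurry h (φ x) ℤ.+ f x)
         (h-injective : ∀ t {p q} → h t p ≡ h t q → p ≡ q)
         (h-bounded : ∀ t p → ∣ h t p ∣ ≤ M) where

  private
    turn : X → X
    turn x = φ⁻¹ (shift (φ x))

    φ-iter : ∀ i x → φ (iter turn i x) ≡ (proj₁ (φ x) , iter next i (proj₂ (φ x)))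
    φ-iter i x = trans (iter-conjugate turn shift φ (λ x → inverseʳ _) i x) (iter-shift i (φ x))

  -- The vertices of one colour are the lines of the grid in the coordinates `φ`. The two colours
  -- put different coordinates on the same edges.
  linePolygons : Polygons f M (suc k)
  linePolygons = record
    { turn           = turn
    ; potential      = λ x → uncurry h (φ x)
    ; potential-step = λ x → trans (cong (uncurry h) (inverseʳ (shift (φ x)))) (h-step x)
    ; bounded        = λ x → h-bounded (proj₁ (φ x)) (proj₂ (φ x))
    ; period         = λ x → trans (sym (inverseˡ _)) (trans (cong φ⁻¹
                         (trans (φ-iter (suc k) x) (cong (proj₁ (φ x) ,_) (next-period (proj₂ (φ x))))))
                         (inverseˡ x))
    ; distinct       = λ x i j i<k j<k eq → next-distinct (proj₂ (φ x)) i j i<k j<k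
                         (h-injective (proj₁ (φ x)) (trans (cong (uncurry h) (sym (φ-iter i x)))
                           (trans eq (cong (uncurry h) (φ-iter j x)))))
    }

-- In column coordinates slots 0 and 1 of line t are the rails towards row t + 1
-- and from row t - 1.  In row coordinates they are the rails towards column
-- t + 1 and from column t - 1, except that row 0 is read in the opposite sense.

module _ {n k : ℕ} where

  toRow toColumn : Cell (suc n) (suc (suc k)) → Cell (suc n) (suc (suc k))

  toRow (t , zero) with next t
  ... | zero  = zero , zero
  ... | suc i = suc i , suc zero
  toRow (t , suc zero) with prev t
  ... | zero  = zero , suc zero
  ... | suc i = suc i , zero
  toRow (t , suc (suc p)) = t , suc (suc p)

  toColumn (zero  , zero)        = prev zero , zero
  toColumn (zero  , suc zero)    = next zero , suc zero
  toColumn (suc i , zero)        = next (suc i) , suc zero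
  toColumn (suc i , suc zero)    = prev (suc i) , zero
  toColumn (t     , suc (suc p)) = t , suc (suc p)

  toColumn-toRow : ∀ x → toColumn (toRow x) ≡ x
  toColumn-toRow (t , zero) with next t in eq
  ... | zero  = cong (_, zero) (trans (cong prev (sym eq)) (prev-next t))
  ... | suc i = cong (_, zero) (trans (cong prev (sym eq)) (prev-next t))
  toColumn-toRow (t , suc zero) with prev t in eq
  ... | zero  = cong (_, suc zero) (trans (cong next (sym eq)) (next-prev t))
  ... | suc i = cong (_, suc zero) (trans (cong next (sym eq)) (next-prev t))
  toColumn-toRow (zero  , suc (suc p)) = refl
  toColumn-toRow (suc i , suc (suc p)) = refl

  toRow-toColumn : ∀ x → toRow (toColumn x) ≡ x
  toRow-toColumn (zero , zero) rewrite next-prev (zero {n}) = refl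
  toRow-toColumn (zero , suc zero) rewrite prev-next (zero {n}) = refl
  toRow-toColumn (suc i , zero) rewrite prev-next (suc i) = refl
  toRow-toColumn (suc i , suc zero) rewrite next-prev (suc i) = refl
  toRow-toColumn (zero  , suc (suc p)) = refl
  toRow-toColumn (suc i , suc (suc p)) = refl

  toRow-inner : ∀ t p → 2 ≤ toℕ p → toRow (t , p) ≡ (t , p)
  toRow-inner t (suc zero)    (s≤s ())
  toRow-inner t (suc (suc p)) _ = refl

  toColumn-inner : ∀ t p → 2 ≤ toℕ p → toColumn (t , p) ≡ (t , p)
  toColumn-inner t       (suc zero)    (s≤s ())
  toColumn-inner zero    (suc (suc p)) _ = refl
  toColumn-inner (suc i) (suc (suc p)) _ = refl

  rail-row : ∀ t {s} → next t ≡ suc s → toRow (t , zero) ≡ (suc s , suc zero)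
  rail-row t eq with next t | eq
  ... | suc s | refl = refl

  rail-row₀ : ∀ t → next t ≡ zero → toRow (t , zero) ≡ (zero , zero)
  rail-row₀ t eq with next t | eq
  ... | zero | refl = refl

  rail-row′ : ∀ t {s} → prev t ≡ suc s → toRow (t , suc zero) ≡ (suc s , zero)
  rail-row′ t eq with prev t | eq
  ... | suc s | refl = refl

  rail-row₀′ : ∀ t → prev t ≡ zero → toRow (t , suc zero) ≡ (zero , suc zero)
  rail-row₀′ t eq with prev t | eq
  ... | zero | refl = refl

-- In column coordinates the black turn is `shift`, and the white one is `shift` conjugated by
-- `toRow`; this is black after white.
faceWalk : ∀ {n k} → Cell (suc n) (suc (suc k)) → Cell (suc n) (suc (suc k))
faceWalk x = shift (toColumn (shift (toRow x)))

parity : ∀ i → (∃ λ l → i ≡ 2 * l) ⊎ (∃ λ l → i ≡ 1 + 2 * l)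
parity zero    = inj₁ (0 , refl)
parity (suc i) with parity i
... | inj₁ (l , eq) = inj₂ (l , cong suc eq)
... | inj₂ (l , eq) = inj₁ (suc l ,
  linear (i ∷ l ∷ []) (λ i l → (i ≡ᴺ con 1 ⊕ 2 ⊠ l) ∷ [] ⊢ con 1 ⊕ i ≡ᴺ 2 ⊠ (con 1 ⊕ l)) eq)

-- A step raises the slot by 2 inside a bundle. So a line splits into the even slots 2, ..., k - 1,
-- the odd slots 3, ..., k, where slot k is slot 0, and slot 1. Away from row 0, slot 0 leads to
-- slot 3 of the next line, slot k - 1 to slot 2 of the next line, and slot 1 to slot 1 two lines
-- back. If row 0 were no exception, these would be the three faces. Row 0 sends slot 0 to slot 2,
-- slot k - 1 to slot 1 and slot 1 to slot 3, which links them into one.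
module OneFace (d c : ℕ) where

  private
    n₀ k₀ n k : ℕ
    n₀ = 2 + 2 * d
    k₀ = 2 + 2 * c
    n  = suc n₀
    k  = suc k₀

  private
    walk : Cell n k → Cell n k
    walk = faceWalk

    _~_ : Cell n k → Cell n k → Set
    _~_ = Reaches walk

    cell : ℕ → ℕ → Cell n k
    cell i p = ahead i , ahead p

    walk-injective : ∀ {x y} → walk x ≡ walk y → x ≡ y
    walk-injective {x} {y} eq =
      trans (sym (toColumn-toRow x)) (trans (cong toColumn (shift-injective
        (trans (sym (toRow-toColumn _)) (trans (cong toRow (shift-injective eq)) (toRow-toColumn _)))))
        (toColumn-toRow y))

    code : Cell n k → Fin (n * k)
    code = uncurry Fin.combine

    code-injective : ∀ {x y} → code x ≡ code y → x ≡ y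
    code-injective {t , p} {u , q} eq = uncurry (cong₂ _,_) (Finₚ.combine-injective t p u q eq)

    ~-sym : ∀ {x y} → x ~ y → y ~ x
    ~-sym = reaches-sym code code-injective walk-injective

    ~-trans : ∀ {x y z} → x ~ y → y ~ z → x ~ z
    ~-trans {x} = reaches-trans {f = walk} {x}

    step : ∀ {x y} → walk x ≡ y → x ~ y
    step eq = 1 , eq

  hop : ∀ t i → 2 ≤ i → i < k₀ → (t , ahead i) ~ (t , ahead (2 + i))
  hop t i 2≤i i<k₀ = step
    (trans (cong (λ x → shift (toColumn (shift x))) (toRow-inner t (ahead i)
             (subst (2 ≤_) (sym (toℕ-ahead i (ℕₚ.<⇒≤ i<k₀))) 2≤i)))
           (cong shift (toColumn-inner t (ahead (1 + i))
             (subst (2 ≤_) (sym (toℕ-ahead (suc i) i<k₀)) (ℕₚ.m≤n⇒m≤1+n 2≤i)))))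

  hops : ∀ t l i → 2 ≤ i → i + 2 * l ≤ suc k₀ → (t , ahead i) ~ (t , ahead (i + 2 * l))
  hops t zero    i 2≤i _ = 0 , cong (λ j → t , ahead j) (sym (ℕₚ.+-identityʳ i))
  hops t (suc l) i 2≤i i+2l≤k = ~-trans (hop t i 2≤i
      (linear (i ∷ l ∷ k₀ ∷ []) (λ i l k → (i ⊕ 2 ⊠ (con 1 ⊕ l) ≤ᴺ con 1 ⊕ k) ∷ [] ⊢ i <ᴺ k) i+2l≤k))
    (subst (λ j → (t , ahead (2 + i)) ~ (t , ahead j)) eq
      (hops t l (2 + i) (ℕₚ.m≤n⇒m≤1+n (ℕₚ.m≤n⇒m≤1+n 2≤i)) (subst (_≤ suc k₀) (sym eq) i+2l≤k)))
    where
    eq : 2 + i + 2 * l ≡ i + 2 * suc l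
    eq = linear (i ∷ l ∷ []) (λ i l → [] ⊢ con 2 ⊕ i ⊕ 2 ⊠ l ≡ᴺ i ⊕ 2 ⊠ (con 1 ⊕ l))

  private
    inner-2 : 2 ≤ toℕ (ahead {k₀} 2)
    inner-2 = ℕₚ.≤-reflexive (sym (toℕ-ahead {k₀} 2 (s≤s (s≤s z≤n))))

    positive : ∀ i → i < n₀ → ∃ λ s → ahead {n₀} (suc i) ≡ suc s
    positive i i<n₀ with ahead {n₀} (suc i) | toℕ-ahead {n₀} (suc i) i<n₀
    ... | suc s | _ = s , refl

  private
    via : ∀ {x y z} → toRow x ≡ y → shift (toColumn (shift y)) ≡ z → x ~ z
    via refl eq = step eq

    zero~three : ∀ t {s} → next t ≡ suc s → (t , zero) ~ (next t , ahead 3)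
    zero~three t {s} eq = subst (λ u → (t , zero) ~ (u , ahead 3)) (sym eq)
      (via (rail-row t eq) (cong shift (toColumn-inner (suc s) (ahead 2) inner-2)))

    last-zero~two : ∀ t → next t ≡ zero → (t , zero) ~ (ahead 1 , ahead 2)
    last-zero~two t eq = via (rail-row₀ t eq) refl

    one~one : ∀ t {s} → prev t ≡ suc s → (t , suc zero) ~ (prev (prev t) , suc zero)
    one~one t eq = subst (λ u → (t , suc zero) ~ (prev u , suc zero)) (sym eq) (via (rail-row′ t eq) refl)

    one~three : ∀ t → prev t ≡ zero → (t , suc zero) ~ (zero , ahead 3)
    one~three t eq = via (rail-row₀′ t eq) (cong shift (toColumn-inner zero (ahead 2) inner-2))

    last~two : ∀ t {s} → t ≡ suc s → (t , ahead k₀) ~ (next t , ahead 2)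
    last~two t {s} refl = via
      (toRow-inner (suc s) (ahead k₀) (subst (2 ≤_) (sym (toℕ-ahead {k₀} k₀ ℕₚ.≤-refl)) (s≤s (s≤s z≤n))))
      (cong (λ p → shift (toColumn (suc s , p))) (ahead-period k₀))

    three~odd : ∀ t l → 3 + 2 * l ≤ suc k₀ → (t , ahead 3) ~ (t , ahead (3 + 2 * l))
    three~odd t l = hops t l 3 (s≤s (s≤s z≤n))

    three~zero : ∀ t → (t , ahead 3) ~ (t , zero)
    three~zero t = subst (λ p → (t , ahead 3) ~ (t , p)) (ahead-period k₀) (three~odd t c ℕₚ.≤-refl)

    two~even : ∀ t l → 2 + 2 * l ≤ k₀ → (t , ahead 2) ~ (t , ahead (2 + 2 * l))
    two~even t l 2+2l≤k₀ = hops t l 2 (s≤s (s≤s z≤n)) (ℕₚ.m≤n⇒m≤1+n 2+2l≤k₀)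

    base : Cell n k
    base = zero , zero

    zeros : ∀ i → i ≤ n₀ → base ~ (ahead i , zero)
    zeros zero    _    = 0 , refl
    zeros (suc i) i<n₀ = ~-trans (zeros i (ℕₚ.<⇒≤ i<n₀))
      (~-trans (zero~three (ahead i) (proj₂ (positive i i<n₀))) (three~zero (ahead (suc i))))

    threes : ∀ i → i ≤ n₀ → base ~ (ahead i , ahead 3)
    threes i i≤n₀ = ~-trans (zeros i i≤n₀) (~-sym (three~zero (ahead i)))

    twos : ∀ i → i ≤ n₀ → base ~ (ahead (suc i) , ahead 2)
    twos zero    _    = ~-trans (zeros n₀ ℕₚ.≤-refl) (last-zero~two (ahead n₀) (ahead-period n₀))
    twos (suc i) i<n₀ = ~-trans (twos i (ℕₚ.<⇒≤ i<n₀)) (~-trans (two~even (ahead (suc i)) c ℕₚ.≤-refl)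
      (last~two (ahead (suc i)) (proj₂ (positive i i<n₀))))

    all-twos : ∀ t → base ~ (t , ahead 2)
    all-twos zero    = subst (λ t → base ~ (t , ahead 2)) (ahead-period n₀) (twos n₀ ℕₚ.≤-refl)
    all-twos (suc s) = subst (λ t → base ~ (t , ahead 2)) (ahead-toℕ (suc s))
                        (twos (toℕ s) (ℕₚ.<⇒≤ (Finₚ.toℕ<n s)))

    -- The walk on slot 1 descends by two lines; read backwards it climbs.
    ones-from : ∀ l i → i + 2 * l ≤ n → base ~ (ahead i , suc zero) → base ~ (ahead (i + 2 * l) , suc zero)
    ones-from zero    i _ b = subst (λ i → base ~ (ahead i , suc zero)) (sym (ℕₚ.+-identityʳ i)) b
    ones-from (suc l) i i+2l≤n b = subst (λ j → base ~ (ahead j , suc zero)) eq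
      (ones-from l (2 + i) (subst (_≤ n) (sym eq) i+2l≤n)
        (~-trans b (~-sym (subst (λ t → (ahead (2 + i) , suc zero) ~ (t , suc zero))
          (trans (cong prev (prev-next (ahead (1 + i)))) (prev-next (ahead i)))
          (one~one (ahead (2 + i)) (trans (prev-next (ahead (1 + i))) (proj₂ (positive i
            (linear (i ∷ l ∷ n₀ ∷ []) (λ i l n → (i ⊕ 2 ⊠ (con 1 ⊕ l) ≤ᴺ con 1 ⊕ n) ∷ [] ⊢ i <ᴺ n) i+2l≤n)))))))))
      where
      eq : 2 + i + 2 * l ≡ i + 2 * suc l
      eq = linear (i ∷ l ∷ []) (λ i l → [] ⊢ con 2 ⊕ i ⊕ 2 ⊠ l ≡ᴺ i ⊕ 2 ⊠ (con 1 ⊕ l))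

    odd-ones : ∀ l → 1 + 2 * l ≤ n → base ~ (ahead (1 + 2 * l) , suc zero)
    odd-ones l 1+2l≤n = ones-from l 1 1+2l≤n
      (~-trans (threes 0 z≤n) (~-sym (one~three (ahead 1) (prev-next zero))))

    -- n is odd, so two steps at a time reach line n = 0 from line 1.
    even-ones : ∀ l → 2 * l ≤ n → base ~ (ahead (2 * l) , suc zero)
    even-ones l 2l≤n = ones-from l 0 2l≤n
      (subst (λ t → base ~ (t , suc zero)) (ahead-period n₀)
        (subst (λ i → base ~ (ahead i , suc zero)) eq (odd-ones (1 + d) (ℕₚ.≤-reflexive eq))))
      where
      eq : 1 + 2 * (1 + d) ≡ n
      eq = linear (d ∷ []) (λ d → [] ⊢ con 1 ⊕ 2 ⊠ (con 1 ⊕ d) ≡ᴺ con 1 ⊕ (con 2 ⊕ 2 ⊠ d))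

    reached : ∀ i j → i ≤ n₀ → j ≤ k₀ → base ~ cell i j
    reached i zero i≤n₀ _ = zeros i i≤n₀
    reached i (suc zero) i≤n₀ _ with parity i
    ... | inj₁ (l , refl) = even-ones l (ℕₚ.m≤n⇒m≤1+n i≤n₀)
    ... | inj₂ (l , refl) = odd-ones l (ℕₚ.m≤n⇒m≤1+n i≤n₀)
    reached i (suc (suc j)) i≤n₀ j≤k₀ with parity j
    ... | inj₁ (l , refl) = ~-trans (all-twos (ahead i)) (two~even (ahead i) l j≤k₀)
    ... | inj₂ (l , refl) = ~-trans (threes i i≤n₀) (three~odd (ahead i) l (ℕₚ.m≤n⇒m≤1+n j≤k₀))

    base~ : ∀ x → base ~ x
    base~ (t , p) = subst₂ (λ t p → base ~ (t , p)) (ahead-toℕ t) (ahead-toℕ p)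
      (reached (toℕ t) (toℕ p) (Finₚ.toℕ≤pred[n] t) (Finₚ.toℕ≤pred[n] p))

  faceWalk-transitive : (x y : Cell n k) → Reaches faceWalk x y
  faceWalk-transitive x y = ~-trans (~-sym (base~ x)) (base~ y)

-- Currents on the ladder

-- The potentials of a vertex in the order of its slots: slot 2 opens the bundle at 0, slot 0 comes
-- after the whole bundle, and since the rails are adjacent only one more partial sum r appears,
-- between them.
insertRail : ∀ {b} → ℤ → (Fin (suc b) → ℤ) → Fin (suc (suc b)) → ℤ
insertRail r V zero          = V zero
insertRail r V (suc zero)    = r
insertRail r V (suc (suc j)) = V (suc j)

insertRail-next : ∀ {b} r (V : Fin (suc b) → ℤ) q → insertRail r V (next (suc q)) ≡ V (next q)
insertRail-next r V q with view q
... | ‵fromℕ     = refl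
... | ‵inject₁ j = refl

module _ {b} {r : ℤ} {V : Fin (suc b) → ℤ} {B : ℕ} where

  -- The partial sum between the rails is minus a rail current. Giving the rails the currents above
  -- B keeps it apart from the sums of the bundle.
  insertRail-injective : (∀ {i j} → V i ≡ V j → i ≡ j) → (∀ j → ∣ V j ∣ ≤ B) → B < ∣ r ∣ →
                         ∀ {p q} → insertRail r V p ≡ insertRail r V q → p ≡ q
  insertRail-injective inj V≤B B<r {p} {q} = go p q
    where
    r≢ : ∀ j → r ≢ V j
    r≢ j refl = ℕₚ.<⇒≱ B<r (V≤B j)
    go : ∀ p q → insertRail r V p ≡ insertRail r V q → p ≡ q
    go zero          zero          _  = refl
    go zero          (suc zero)    eq = ⊥-elim (r≢ zero (sym eq))
    go zero          (suc (suc j)) eq with () ← inj eq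
    go (suc zero)    zero          eq = ⊥-elim (r≢ zero eq)
    go (suc zero)    (suc zero)    _  = refl
    go (suc zero)    (suc (suc j)) eq = ⊥-elim (r≢ (suc j) eq)
    go (suc (suc i)) zero          eq with () ← inj eq
    go (suc (suc i)) (suc zero)    eq = ⊥-elim (r≢ (suc i) (sym eq))
    go (suc (suc i)) (suc (suc j)) eq = cong suc (inj eq)

  insertRail-bounded : ∀ {M} → (∀ j → ∣ V j ∣ ≤ B) → B ≤ M → ∣ r ∣ ≤ M → ∀ p → ∣ insertRail r V p ∣ ≤ M
  insertRail-bounded V≤B B≤M r≤M zero          = ℕₚ.≤-trans (V≤B zero) B≤M
  insertRail-bounded V≤B B≤M r≤M (suc zero)    = r≤M
  insertRail-bounded V≤B B≤M r≤M (suc (suc j)) = ℕₚ.≤-trans (V≤B (suc j)) B≤M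

-- Line t consists of row t and column t.  They are joined by 1 + b₀ parallel
-- edges whose partial sums are bundle t; the rail from row t to column t + 1
-- carries B + out t, and the one from row t + 1 to column t carries −(B + inn t).
record Ladder (n₀ b₀ : ℕ) : Set where
  n = suc n₀
  k = 3 + b₀
  field
    B R              : ℕ
    size             : B + R ≡ n * k
    out inn          : Fin n → ℕ
    bundle           : Fin n → Fin (2 + b₀) → ℤ
    out-positive     : ∀ t → 1 ≤ out t
    inn-positive     : ∀ t → 1 ≤ inn t
    complementary    : ∀ t → out t + inn t ≡ R + 1
    rails-onto       : ∀ a → 1 ≤ a → a ≤ R → ∃ λ t → out t ≡ a ⊎ inn t ≡ a
    bundle-total     : ∀ t → bundle t zero ≡ + inn (prev t) ℤ.- + out t
    bundle-start     : ∀ t → bundle t (suc zero) ≡ 0ℤ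
    bundle-injective : ∀ t {i j} → bundle t i ≡ bundle t j → i ≡ j
    bundle-bounded   : ∀ t j → ∣ bundle t j ∣ ≤ B
    bundles-onto     : ∀ a → 1 ≤ a → a ≤ B →
                       ∃₂ λ t j → ∣ bundle t (next (suc j)) ℤ.- bundle t (suc j) ∣ ≡ a

module LadderGraph {n₀ b₀ : ℕ} (L : Ladder n₀ b₀) (transitive : ∀ x y → Reaches (faceWalk {n₀} {suc b₀}) x y) where

  open Ladder L

  private
    P N : Fin n → ℤ
    P t = + (B + out t)
    N t = ℤ.- + (B + inn t)

    -- Minus the current of the rail in slot 1: in row 0 this is the rail to column 1, in every
    -- other row the one from the previous column.
    rowRail : Fin n → ℤ
    rowRail zero    = ℤ.- P zero
    rowRail (suc s) = ℤ.- N (prev (suc s))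

    column row : Fin n → Fin k → ℤ
    column t = insertRail (ℤ.- P (prev t)) (bundle t)
    row    t = insertRail (rowRail t) (bundle t)

    -- Currents are differences of column potentials, so the columns satisfy Kirchhoff's law by
    -- construction and only the rows remain to be checked.
    f : Cell n k → ℤ
    f x = uncurry column (shift x) ℤ.- uncurry column x

    difference-step : ∀ a b → b ≡ a ℤ.+ (b ℤ.- a)
    difference-step = solve-∀

    -- The bundle total is what row t needs. The column needs the same total because `out + inn` is
    -- the same for lines t and t - 1.
    in-rail : ∀ t → f (t , zero) ≡ N t
    in-rail t = trans (cong (λ S → ℤ.- P (prev t) ℤ.- S) (bundle-total t))
      (linear (B ∷ out (prev t) ∷ inn (prev t) ∷ out t ∷ inn t ∷ R ∷ [])
        (λ B o′ i′ o i n → (o ⊕ i ≡ᴺ n ⊕ con 1) ∷ (o′ ⊕ i′ ≡ᴺ n ⊕ con 1) ∷ [] ⊢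
          neg (pos (B ⊕ o′)) ⊖ (pos i′ ⊖ pos o) ≡ᶻ neg (pos (B ⊕ i)))
        (complementary t) (complementary (prev t)))

    out-rail : ∀ t → f (t , suc zero) ≡ P (prev t)
    out-rail t = trans (cong (λ s → s ℤ.- ℤ.- P (prev t)) (bundle-start t))
      (trans (ℤₚ.+-identityˡ _) (ℤₚ.neg-involutive _))

    conservation : ∀ t → ℤ.- N (prev t) ≡ bundle t zero ℤ.+ P t
    conservation t = trans
      (linear (B ∷ out t ∷ inn (prev t) ∷ [])
        (λ B o i → [] ⊢ neg (neg (pos (B ⊕ i))) ≡ᶻ (pos i ⊖ pos o) ⊞ pos (B ⊕ o)))
      (cong (ℤ._+ P t) (sym (bundle-total t)))

    solve-for-N : ∀ t → ℤ.- P t ≡ bundle t zero ℤ.+ N (prev t)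
    solve-for-N t = sym (cancels (bundle t zero) (P t) (N (prev t)) (conservation t))
      where
      cancels : ∀ s p m → ℤ.- m ≡ s ℤ.+ p → s ℤ.+ m ≡ ℤ.- p
      cancels s p m eq = trans (expand s p m) (trans (cong (λ x → x ℤ.+ m ℤ.- p) (sym eq)) (collapse p m))
        where
        expand : ∀ s p m → s ℤ.+ m ≡ s ℤ.+ p ℤ.+ m ℤ.- p
        expand = solve-∀
        collapse : ∀ p m → ℤ.- m ℤ.+ m ℤ.- p ≡ ℤ.- p
        collapse = solve-∀

    back-to-start : ∀ t r → bundle t (suc zero) ≡ ℤ.- r ℤ.+ r
    back-to-start t r = trans (bundle-start t) (sym (ℤₚ.+-inverseˡ r))

    RowStep : Cell n k → Cell n k → Set
    RowStep x y = uncurry row (shift y) ≡ uncurry row y ℤ.+ f x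

    in-rail-step : ∀ t u → next t ≡ u → RowStep (t , zero) (toRow (t , zero))
    in-rail-step t u eq = by u eq
      where
      at : ∀ {u} → next t ≡ u → N (prev u) ≡ f (t , zero)
      at eq = sym (trans (in-rail t) (cong N (trans (sym (prev-next t)) (cong prev eq))))
      by : ∀ u → next t ≡ u → RowStep (t , zero) (toRow (t , zero))
      by zero    eq = subst (RowStep (t , zero)) (sym (rail-row₀ t eq))
        (trans (solve-for-N zero) (cong (λ i → bundle zero zero ℤ.+ i) (at eq)))
      by (suc s) eq = subst (RowStep (t , zero)) (sym (rail-row t eq))
        (trans (back-to-start (suc s) (N (prev (suc s)))) (cong (λ i → ℤ.- N (prev (suc s)) ℤ.+ i) (at eq)))

    out-rail-step : ∀ t u → prev t ≡ u → RowStep (t , suc zero) (toRow (t , suc zero))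
    out-rail-step t u eq = by u eq
      where
      at : ∀ {u} → prev t ≡ u → P u ≡ f (t , suc zero)
      at eq = sym (trans (out-rail t) (cong P eq))
      by : ∀ u → prev t ≡ u → RowStep (t , suc zero) (toRow (t , suc zero))
      by zero    eq = subst (RowStep (t , suc zero)) (sym (rail-row₀′ t eq))
        (trans (back-to-start zero (P zero)) (cong (λ i → ℤ.- P zero ℤ.+ i) (at eq)))
      by (suc s) eq = subst (RowStep (t , suc zero)) (sym (rail-row′ t eq))
        (trans (conservation (suc s)) (cong (λ i → bundle (suc s) zero ℤ.+ i) (at eq)))

    row-step : ∀ x → RowStep x (toRow x)
    row-step (t , zero)     = in-rail-step t (next t) refl
    row-step (t , suc zero) = out-rail-step t (prev t) refl
    row-step (t , suc (suc j)) = trans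
      (trans (insertRail-next (rowRail t) (bundle t) (suc j))
             (sym (insertRail-next (ℤ.- P (prev t)) (bundle t) (suc j))))
      (difference-step (bundle t (suc j)) (column t (next (suc (suc j)))))

    M : ℕ
    M = n * k

    B≤M : B ≤ M
    B≤M = subst (B ≤_) size (ℕₚ.m≤m+n B (R))

    out-≤ : ∀ t → B + out t ≤ M
    out-≤ t = linear (B ∷ out t ∷ inn t ∷ R ∷ M ∷ [])
      (λ B o i n M → (B ⊕ n ≡ᴺ M) ∷ (o ⊕ i ≡ᴺ n ⊕ con 1) ∷ (con 1 ≤ᴺ i) ∷ [] ⊢ B ⊕ o ≤ᴺ M)
      size (complementary t) (inn-positive t)

    inn-≤ : ∀ t → B + inn t ≤ M
    inn-≤ t = linear (B ∷ out t ∷ inn t ∷ R ∷ M ∷ [])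
      (λ B o i n M → (B ⊕ n ≡ᴺ M) ∷ (o ⊕ i ≡ᴺ n ⊕ con 1) ∷ (con 1 ≤ᴺ o) ∷ [] ⊢ B ⊕ i ≤ᴺ M)
      size (complementary t) (out-positive t)

    RailRange : ℤ → Set
    RailRange r = B < ∣ r ∣ × ∣ r ∣ ≤ M

    out-range : ∀ t → RailRange (ℤ.- P t)
    out-range t = subst (λ r → B < r × r ≤ M) (sym (ℤₚ.∣-i∣≡∣i∣ (P t)))
      (ℕₚ.m<m+n B (out-positive t) , out-≤ t)

    inn-range : ∀ t → RailRange (ℤ.- N t)
    inn-range t = subst RailRange (sym (ℤₚ.neg-involutive (+ (B + inn t))))
      (ℕₚ.m<m+n B (inn-positive t) , inn-≤ t)

    rowRail-range : ∀ t → RailRange (rowRail t)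
    rowRail-range zero    = out-range zero
    rowRail-range (suc s) = inn-range (prev (suc s))

    Attained : ℕ → Set
    Attained a = ∃ λ x → ∣ f x ∣ ≡ a

    bundle-attained : ∀ {a} → (∃₂ λ t j → ∣ bundle t (next (suc j)) ℤ.- bundle t (suc j) ∣ ≡ a) → Attained a
    bundle-attained (t , j , eq) = (t , suc (suc j)) ,
      trans (cong (λ v → ∣ v ℤ.- bundle t (suc j) ∣) (insertRail-next (ℤ.- P (prev t)) (bundle t) (suc j))) eq

    rail-attained : ∀ {a} → (∃ λ t → out t ≡ a ⊎ inn t ≡ a) → Attained (B + a)
    rail-attained (t , inj₁ eq) = (next t , suc zero) ,
      trans (cong ∣_∣ (trans (out-rail (next t)) (cong P (prev-next t)))) (cong (λ b → B + b) eq)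
    rail-attained (t , inj₂ eq) = (t , zero) ,
      trans (cong ∣_∣ (in-rail t)) (trans (ℤₚ.∣-i∣≡∣i∣ (+ (B + inn t))) (cong (λ b → B + b) eq))

    onto : ∀ a → 1 ≤ a → a ≤ M → Attained a
    onto a 1≤a a≤M = case a ℕ.≤? B of λ
      { (yes a≤B) → bundle-attained (bundles-onto a 1≤a a≤B)
      ; (no  a≰B) → subst Attained (B+a′≡a a≰B) (rail-attained (rails-onto (a ℕ.∸ B)
          (linear (B ∷ a ∷ (a ℕ.∸ B) ∷ [])
            (λ B a a′ → (B ⊕ a′ ≡ᴺ a) ∷ (B <ᴺ a) ∷ [] ⊢ con 1 ≤ᴺ a′) (B+a′≡a a≰B) (ℕₚ.≰⇒> a≰B))
          (linear (B ∷ a ∷ (a ℕ.∸ B) ∷ R ∷ M ∷ [])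
            (λ B a a′ R M → (B ⊕ a′ ≡ᴺ a) ∷ (a ≤ᴺ M) ∷ (B ⊕ R ≡ᴺ M) ∷ [] ⊢ a′ ≤ᴺ R) (B+a′≡a a≰B) a≤M size)))
      }
      where
      B+a′≡a : ¬ a ≤ B → B + (a ℕ.∸ B) ≡ a
      B+a′≡a a≰B = ℕₚ.m+[n∸m]≡n (ℕₚ.<⇒≤ (ℕₚ.≰⇒> a≰B))

    code : Cell n k → Fin M
    code = uncurry Fin.combine

    code-injective : ∀ {x y} → code x ≡ code y → x ≡ y
    code-injective {t , p} {u , q} eq = uncurry (cong₂ _,_) (Finₚ.combine-injective t p u q eq)

  currentGraph : CurrentGraph M k
  currentGraph = record
    { Edge                = Cell n k
    ; edge                = zero , zero
    ; f                   = f
    ; black               = linePolygons f id id (λ _ → refl) (λ _ → refl) column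
        (λ x → difference-step (uncurry column x) (uncurry column (shift x)))
        (λ t → insertRail-injective (bundle-injective t) (bundle-bounded t) (proj₁ (out-range (prev t))))
        (λ t → insertRail-bounded (bundle-bounded t) B≤M (proj₂ (out-range (prev t))))
    ; white               = linePolygons f toRow toColumn toColumn-toRow toRow-toColumn row row-step
        (λ t → insertRail-injective (bundle-injective t) (bundle-bounded t) (proj₁ (rowRail-range t)))
        (λ t → insertRail-bounded (bundle-bounded t) B≤M (proj₂ (rowRail-range t)))
    ; magnitude-onto      = onto
    ; magnitude-range     = onto⇒range code code-injective (λ x → ∣ f x ∣) onto
    ; magnitude-injective = onto⇒injective code code-injective (λ x → ∣ f x ∣) onto
    ; one-face            = transitive
    }

-- Rail currents, n = 4m + 3

signed : Bool → ℤ → ℤ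
signed true  i = i
signed false i = ℤ.- i

signed-injective : ∀ b {i j} → signed b i ≡ signed b j → i ≡ j
signed-injective true  eq = eq
signed-injective false eq = ℤₚ.neg-injective eq

∣signed∣ : ∀ b i → ∣ signed b i ∣ ≡ ∣ i ∣
∣signed∣ true  i = refl
∣signed∣ false i = ℤₚ.∣-i∣≡∣i∣ i

signed-0 : ∀ b → signed b 0ℤ ≡ 0ℤ
signed-0 true  = refl
signed-0 false = refl

signed-difference : ∀ b i j → ∣ signed b i ℤ.- signed b j ∣ ≡ ∣ i ℤ.- j ∣
signed-difference true  i j = refl
signed-difference false i j =
  trans (cong ∣_∣ (sym (ℤₚ.neg-distrib-+ i (ℤ.- j)))) (ℤₚ.∣-i∣≡∣i∣ (i ℤ.- j))

-- Rails and bundles as independent data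

record Rails (n₀ : ℕ) : Set where
  n = suc n₀
  field
    sign          : ℕ → Bool
    total         : ℕ → ℕ
    out inn       : ℕ → ℕ
    out-positive  : ∀ t → t ≤ n₀ → 1 ≤ out t
    inn-positive  : ∀ t → t ≤ n₀ → 1 ≤ inn t
    complementary : ∀ t → t ≤ n₀ → out t + inn t ≡ 2 * n + 1
    rails-onto    : ∀ a → 1 ≤ a → a ≤ 2 * n → ∃ λ t → t ≤ n₀ × (out t ≡ a ⊎ inn t ≡ a)
    total-start   : signed (sign 0) (+ total 0) ≡ + inn n₀ ℤ.- + out 0
    total-step    : ∀ t → suc t ≤ n₀ → signed (sign (suc t)) (+ total (suc t)) ≡ + inn t ℤ.- + out (suc t)

record Bundles (n₀ b₀ : ℕ) (total : ℕ → ℕ) : Set where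
  n = suc n₀
  B = (1 + b₀) * n
  field
    partial           : ℕ → Fin (2 + b₀) → ℤ
    partial-total     : ∀ t → partial t zero ≡ + total t
    partial-start     : ∀ t → partial t (suc zero) ≡ 0ℤ
    partial-injective : ∀ t → t ≤ n₀ → ∀ i j → partial t i ≡ partial t j → i ≡ j
    partial-bounded   : ∀ t → t ≤ n₀ → ∀ j → ∣ partial t j ∣ ≤ B
    partial-onto      : ∀ a → 1 ≤ a → a ≤ B → ∃₂ λ t j → t ≤ n₀ ×
                        ∣ partial t (next (suc j)) ℤ.- partial t (suc j) ∣ ≡ a

ladder : ∀ {n₀ b₀} (R : Rails n₀) → Bundles n₀ b₀ (Rails.total R) → Ladder n₀ b₀
ladder {n₀} {b₀} R 𝓑 = record
  { B                = B
  ; R                = 2 * n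
  ; size             = size b₀ n
  ; out              = λ t → out (toℕ t)
  ; inn              = λ t → inn (toℕ t)
  ; bundle           = λ t j → signed (sign (toℕ t)) (partial (toℕ t) j)
  ; out-positive     = λ t → out-positive (toℕ t) (Finₚ.toℕ≤pred[n] t)
  ; inn-positive     = λ t → inn-positive (toℕ t) (Finₚ.toℕ≤pred[n] t)
  ; complementary    = λ t → complementary (toℕ t) (Finₚ.toℕ≤pred[n] t)
  ; rails-onto       = λ a p q → let t , t≤n₀ , r = rails-onto a p q in
      line t t≤n₀ , subst (λ t → out t ≡ a ⊎ inn t ≡ a) (sym (toℕ-line t t≤n₀)) r
  ; bundle-total     = λ t → trans (cong (signed (sign (toℕ t))) (partial-total (toℕ t))) (at-line t)
  ; bundle-start     = λ t → trans (cong (signed (sign (toℕ t))) (partial-start (toℕ t))) (signed-0 (sign (toℕ t)))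
  ; bundle-injective = λ t {i} {j} eq → partial-injective (toℕ t) (Finₚ.toℕ≤pred[n] t) i j
                         (signed-injective (sign (toℕ t)) eq)
  ; bundle-bounded   = λ t j → subst (_≤ B) (sym (∣signed∣ (sign (toℕ t)) _))
                         (partial-bounded (toℕ t) (Finₚ.toℕ≤pred[n] t) j)
  ; bundles-onto     = λ a p q → let t , j , t≤n₀ , r = partial-onto a p q in line t t≤n₀ , j ,
      trans (signed-difference (sign (toℕ (line t t≤n₀))) _ _)
            (subst (λ t → ∣ partial t (next (suc j)) ℤ.- partial t (suc j) ∣ ≡ a) (sym (toℕ-line t t≤n₀)) r)
  }
  where
  open Rails R
  open Bundles 𝓑 hiding (n)
  size : ∀ b n → (1 + b) * n + 2 * n ≡ n * (3 + b)
  size = ℕSolver.solve-∀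
  line : ∀ t → t ≤ n₀ → Fin n
  line t t≤n₀ = fromℕ< (s≤s t≤n₀)
  toℕ-line : ∀ t t≤n₀ → toℕ (line t t≤n₀) ≡ t
  toℕ-line t t≤n₀ = Finₚ.toℕ-fromℕ< (s≤s t≤n₀)
  at-line : ∀ t → signed (sign (toℕ t)) (+ total (toℕ t)) ≡ + inn (toℕ (prev t)) ℤ.- + out (toℕ t)
  at-line zero    = trans total-start (cong (λ i → + inn i ℤ.- + out 0) (sym (Finₚ.toℕ-fromℕ n₀)))
  at-line (suc s) = trans (total-step (toℕ s) (Finₚ.toℕ<n s))
    (cong (λ i → + inn i ℤ.- + out (suc (toℕ s))) (sym (Finₚ.toℕ-inject₁ s)))

-- With S = ± total (t + 1), out (t + 1) = inn t − S and inn (t + 1) = out t + S;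
-- the subtraction is truncated unless there is room for total (t + 1).
module Walk (sign : ℕ → Bool) (total : ℕ → ℕ) (out₀ inn₀ : ℕ) where

  private
    transition : Bool → ℕ → ℕ × ℕ → ℕ × ℕ
    transition true  d (o , i) = i ℕ.∸ d , o + d
    transition false d (o , i) = i + d , o ℕ.∸ d

    rails : ℕ → ℕ × ℕ
    rails zero    = out₀ , inn₀
    rails (suc t) = transition (sign (suc t)) (total (suc t)) (rails t)

  abstract

    out inn : ℕ → ℕ
    out t = proj₁ (rails t)
    inn t = proj₂ (rails t)

    out-start : out 0 ≡ out₀
    out-start = refl

    inn-start : inn 0 ≡ inn₀
    inn-start = refl

    rails-up : ∀ t → sign (suc t) ≡ true → total (suc t) ≤ inn t →
               out (suc t) + total (suc t) ≡ inn t × inn (suc t) ≡ out t + total (suc t)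
    rails-up t s d≤i rewrite s = ℕₚ.m∸n+n≡m d≤i , refl

    rails-down : ∀ t → sign (suc t) ≡ false → total (suc t) ≤ out t →
                 out (suc t) ≡ inn t + total (suc t) × inn (suc t) + total (suc t) ≡ out t
    rails-down t s d≤o rewrite s = refl , ℕₚ.m∸n+n≡m d≤o

  total-up : ∀ t → sign (suc t) ≡ true → total (suc t) ≤ inn t →
             signed (sign (suc t)) (+ total (suc t)) ≡ + inn t ℤ.- + out (suc t)
  total-up t s d≤i = trans (cong (λ b → signed b (+ total (suc t))) s)
    (linear (total (suc t) ∷ inn t ∷ out (suc t) ∷ [])
      (λ d i o → (o ⊕ d ≡ᴺ i) ∷ [] ⊢ pos d ≡ᶻ pos i ⊖ pos o) (proj₁ (rails-up t s d≤i)))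

  total-down : ∀ t → sign (suc t) ≡ false → total (suc t) ≤ out t →
               signed (sign (suc t)) (+ total (suc t)) ≡ + inn t ℤ.- + out (suc t)
  total-down t s d≤o = trans (cong (λ b → signed b (+ total (suc t))) s)
    (linear (total (suc t) ∷ inn t ∷ out (suc t) ∷ [])
      (λ d i o → (o ≡ᴺ i ⊕ d) ∷ [] ⊢ neg (pos d) ≡ᶻ pos i ⊖ pos o) (proj₁ (rails-down t s d≤o)))

remainder : ∀ {a b} → a ≤ b → ∃ λ i → a + i ≡ b
remainder a≤b = _ , ℕₚ.m+[n∸m]≡n a≤b

-- The labels 2m+1, 2m+2, 2m, 2m+3, …, 0 form a graceful path, but closing it up
-- repeats the total 2m + 2; the pairs of rung edges make up for that.
module Beta (m n₀ : ℕ) (n₀≡ : n₀ ≡ 4 * m + 2) where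

  total : ℕ → ℕ
  total zero    = 2 * m + 2
  total (suc t) = suc t

  sign : ℕ → Bool
  sign zero    = false
  sign (suc t) = true

  open Walk sign total (6 * m + 5) (2 * m + 2)

  data Position (t : ℕ) : Set where
    even : ∀ i → i ≤ 2 * m + 1 → t ≡ 2 * i     → out t + i ≡ 6 * m + 5 → inn t ≡ 2 * m + 2 + i → Position t
    odd  : ∀ i → i ≤ 2 * m     → t ≡ 1 + 2 * i → out t + i ≡ 2 * m + 1 → inn t ≡ 6 * m + 6 + i → Position t

  room : ∀ {t} → suc t ≤ n₀ → Position t → suc t ≤ inn t
  room {t} t<n₀ (even i i≤ t≡ o≡ i≡) = linear (m ∷ n₀ ∷ t ∷ i ∷ inn t ∷ [])
    (λ m n t i I → (n ≡ᴺ 4 ⊠ m ⊕ con 2) ∷ (con 1 ⊕ t ≤ᴺ n) ∷ (t ≡ᴺ 2 ⊠ i) ∷ (I ≡ᴺ 2 ⊠ m ⊕ con 2 ⊕ i) ∷ [] ⊢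
      con 1 ⊕ t ≤ᴺ I)
    n₀≡ t<n₀ t≡ i≡
  room {t} t<n₀ (odd i i≤ t≡ o≡ i≡) = linear (m ∷ n₀ ∷ t ∷ inn t ∷ i ∷ [])
    (λ m n t I i → (n ≡ᴺ 4 ⊠ m ⊕ con 2) ∷ (con 1 ⊕ t ≤ᴺ n) ∷ (I ≡ᴺ 6 ⊠ m ⊕ con 6 ⊕ i) ∷ [] ⊢
      con 1 ⊕ t ≤ᴺ I)
    n₀≡ t<n₀ i≡

  position : ∀ t → t ≤ n₀ → Position t
  position zero    _    = even 0 z≤n refl (trans (ℕₚ.+-identityʳ _) out-start) (trans inn-start (sym (ℕₚ.+-identityʳ _)))
  position (suc t) t<n₀ = move (position t (ℕₚ.<⇒≤ t<n₀))
    where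
    move : Position t → Position (suc t)
    move p@(even i i≤ t≡ o≡ i≡) = let o′≡ , i′≡ = rails-up t refl (room t<n₀ p) in odd i
      (linear (m ∷ n₀ ∷ t ∷ i ∷ [])
        (λ m n t i → (n ≡ᴺ 4 ⊠ m ⊕ con 2) ∷ (con 1 ⊕ t ≤ᴺ n) ∷ (t ≡ᴺ 2 ⊠ i) ∷ [] ⊢ i ≤ᴺ 2 ⊠ m) n₀≡ t<n₀ t≡)
      (cong suc t≡)
      (linear (m ∷ t ∷ i ∷ inn t ∷ out (suc t) ∷ [])
        (λ m t i I O → (t ≡ᴺ 2 ⊠ i) ∷ (I ≡ᴺ 2 ⊠ m ⊕ con 2 ⊕ i) ∷ (O ⊕ (con 1 ⊕ t) ≡ᴺ I) ∷ [] ⊢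
          O ⊕ i ≡ᴺ 2 ⊠ m ⊕ con 1) t≡ i≡ o′≡)
      (linear (m ∷ t ∷ i ∷ out t ∷ inn (suc t) ∷ [])
        (λ m t i O I → (t ≡ᴺ 2 ⊠ i) ∷ (O ⊕ i ≡ᴺ 6 ⊠ m ⊕ con 5) ∷ (I ≡ᴺ O ⊕ (con 1 ⊕ t)) ∷ [] ⊢
          I ≡ᴺ 6 ⊠ m ⊕ con 6 ⊕ i) t≡ o≡ i′≡)
    move p@(odd i i≤ t≡ o≡ i≡) = let o′≡ , i′≡ = rails-up t refl (room t<n₀ p) in even (suc i)
      (linear (m ∷ i ∷ []) (λ m i → (i ≤ᴺ 2 ⊠ m) ∷ [] ⊢ con 1 ⊕ i ≤ᴺ 2 ⊠ m ⊕ con 1) i≤)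
      (linear (t ∷ i ∷ []) (λ t i → (t ≡ᴺ con 1 ⊕ 2 ⊠ i) ∷ [] ⊢ con 1 ⊕ t ≡ᴺ 2 ⊠ (con 1 ⊕ i)) t≡)
      (linear (m ∷ t ∷ i ∷ inn t ∷ out (suc t) ∷ [])
        (λ m t i I O → (t ≡ᴺ con 1 ⊕ 2 ⊠ i) ∷ (I ≡ᴺ 6 ⊠ m ⊕ con 6 ⊕ i) ∷ (O ⊕ (con 1 ⊕ t) ≡ᴺ I) ∷ [] ⊢
          O ⊕ (con 1 ⊕ i) ≡ᴺ 6 ⊠ m ⊕ con 5) t≡ i≡ o′≡)
      (linear (m ∷ t ∷ i ∷ out t ∷ inn (suc t) ∷ [])
        (λ m t i O I → (t ≡ᴺ con 1 ⊕ 2 ⊠ i) ∷ (O ⊕ i ≡ᴺ 2 ⊠ m ⊕ con 1) ∷ (I ≡ᴺ O ⊕ (con 1 ⊕ t)) ∷ [] ⊢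
          I ≡ᴺ 2 ⊠ m ⊕ con 2 ⊕ (con 1 ⊕ i)) t≡ o≡ i′≡)

  at-even : ∀ i → i ≤ 2 * m + 1 → 2 * i ≤ n₀ × out (2 * i) + i ≡ 6 * m + 5 × inn (2 * i) ≡ 2 * m + 2 + i
  at-even i i≤ = 2i≤n₀ , by (position (2 * i) 2i≤n₀)
    where
    2i≤n₀ : 2 * i ≤ n₀
    2i≤n₀ = linear (m ∷ n₀ ∷ i ∷ [])
      (λ m n i → (n ≡ᴺ 4 ⊠ m ⊕ con 2) ∷ (i ≤ᴺ 2 ⊠ m ⊕ con 1) ∷ [] ⊢ 2 ⊠ i ≤ᴺ n) n₀≡ i≤
    by : Position (2 * i) → out (2 * i) + i ≡ 6 * m + 5 × inn (2 * i) ≡ 2 * m + 2 + i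
    by (even j _ t≡ o≡ i≡) with refl ← ℕₚ.*-cancelˡ-≡ i j 2 t≡ = o≡ , i≡
    by (odd j _ t≡ _ _) = ⊥-elim (ℕₚ.even≢odd i j t≡)

  at-odd : ∀ i → i ≤ 2 * m → 1 + 2 * i ≤ n₀ × out (1 + 2 * i) + i ≡ 2 * m + 1 × inn (1 + 2 * i) ≡ 6 * m + 6 + i
  at-odd i i≤ = 1+2i≤n₀ , by (position (1 + 2 * i) 1+2i≤n₀)
    where
    1+2i≤n₀ : 1 + 2 * i ≤ n₀
    1+2i≤n₀ = linear (m ∷ n₀ ∷ i ∷ [])
      (λ m n i → (n ≡ᴺ 4 ⊠ m ⊕ con 2) ∷ (i ≤ᴺ 2 ⊠ m) ∷ [] ⊢ con 1 ⊕ 2 ⊠ i ≤ᴺ n) n₀≡ i≤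
    by : Position (1 + 2 * i) → out (1 + 2 * i) + i ≡ 2 * m + 1 × inn (1 + 2 * i) ≡ 6 * m + 6 + i
    by (even j _ t≡ _ _) = ⊥-elim (ℕₚ.even≢odd j i (sym t≡))
    by (odd j _ t≡ o≡ i≡) with refl ← ℕₚ.*-cancelˡ-≡ i j 2 (ℕₚ.suc-injective t≡) = o≡ , i≡

  Attained : ℕ → Set
  Attained a = ∃ λ t → t ≤ n₀ × (out t ≡ a ⊎ inn t ≡ a)

  out-even : ∀ a i → i ≤ 2 * m + 1 → a + i ≡ 6 * m + 5 → Attained a
  out-even a i i≤ eq = 2 * i , proj₁ (at-even i i≤) ,
    inj₁ (ℕₚ.+-cancelʳ-≡ i (out (2 * i)) a (trans (proj₁ (proj₂ (at-even i i≤))) (sym eq)))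

  out-odd : ∀ a i → i ≤ 2 * m → a + i ≡ 2 * m + 1 → Attained a
  out-odd a i i≤ eq = 1 + 2 * i , proj₁ (at-odd i i≤) ,
    inj₁ (ℕₚ.+-cancelʳ-≡ i (out (1 + 2 * i)) a (trans (proj₁ (proj₂ (at-odd i i≤))) (sym eq)))

  inn-even : ∀ a i → i ≤ 2 * m + 1 → 2 * m + 2 + i ≡ a → Attained a
  inn-even a i i≤ eq = 2 * i , proj₁ (at-even i i≤) , inj₂ (trans (proj₂ (proj₂ (at-even i i≤))) eq)

  inn-odd : ∀ a i → i ≤ 2 * m → 6 * m + 6 + i ≡ a → Attained a
  inn-odd a i i≤ eq = 1 + 2 * i , proj₁ (at-odd i i≤) , inj₂ (trans (proj₂ (proj₂ (at-odd i i≤))) eq)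

  -- In increasing order the runs are `out` on odd lines, `inn` on even lines, `out` on even lines
  -- and `inn` on odd lines, with upper ends 2m + 1, 4m + 3, 6m + 5 and 8m + 6 = 2n.
  rails-onto : ∀ a → 1 ≤ a → a ≤ 2 * suc n₀ → Attained a
  rails-onto a 1≤a a≤2n with a ℕ.≤? 2 * m + 1 | a ℕ.≤? 4 * m + 3 | a ℕ.≤? 6 * m + 5
  ... | yes a≤ | _ | _ = let i , eq = remainder a≤ in out-odd a i (linear (a ∷ i ∷ m ∷ [])
          (λ a i m → (con 1 ≤ᴺ a) ∷ (a ⊕ i ≡ᴺ 2 ⊠ m ⊕ con 1) ∷ [] ⊢ i ≤ᴺ 2 ⊠ m) 1≤a eq) eq
  ... | no a≰ | yes a≤ | _ = let i , eq = remainder (2m+2≤ (ℕₚ.≰⇒> a≰)) in inn-even a i (linear (a ∷ i ∷ m ∷ [])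
          (λ a i m → (a ≤ᴺ 4 ⊠ m ⊕ con 3) ∷ (2 ⊠ m ⊕ con 2 ⊕ i ≡ᴺ a) ∷ [] ⊢ i ≤ᴺ 2 ⊠ m ⊕ con 1) a≤ eq) eq
    where
    2m+2≤ : 2 * m + 1 < a → 2 * m + 2 ≤ a
    2m+2≤ = linear (a ∷ m ∷ []) (λ a m → (2 ⊠ m ⊕ con 1 <ᴺ a) ∷ [] ⊢ 2 ⊠ m ⊕ con 2 ≤ᴺ a)
  ... | no _ | no a≰ | yes a≤ = let i , eq = remainder a≤ in out-even a i (linear (a ∷ i ∷ m ∷ [])
          (λ a i m → (4 ⊠ m ⊕ con 3 <ᴺ a) ∷ (a ⊕ i ≡ᴺ 6 ⊠ m ⊕ con 5) ∷ [] ⊢ i ≤ᴺ 2 ⊠ m ⊕ con 1) (ℕₚ.≰⇒> a≰) eq) eq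
  ... | no _ | no _ | no a≰ = let i , eq = remainder (6m+6≤ (ℕₚ.≰⇒> a≰)) in inn-odd a i (linear (a ∷ i ∷ m ∷ n₀ ∷ [])
          (λ a i m n → (n ≡ᴺ 4 ⊠ m ⊕ con 2) ∷ (a ≤ᴺ 2 ⊠ (con 1 ⊕ n)) ∷ (6 ⊠ m ⊕ con 6 ⊕ i ≡ᴺ a) ∷ [] ⊢
            i ≤ᴺ 2 ⊠ m) n₀≡ a≤2n eq) eq
    where
    6m+6≤ : 6 * m + 5 < a → 6 * m + 6 ≤ a
    6m+6≤ = linear (a ∷ m ∷ []) (λ a m → (6 ⊠ m ⊕ con 5 <ᴺ a) ∷ [] ⊢ 6 ⊠ m ⊕ con 6 ≤ᴺ a)

  betaRails : Rails n₀
  betaRails = record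
    { sign          = sign
    ; total         = total
    ; out           = out
    ; inn           = inn
    ; out-positive  = λ t t≤n₀ → out-positive (position t t≤n₀)
    ; inn-positive  = λ t t≤n₀ → inn-positive (position t t≤n₀)
    ; complementary = λ t t≤n₀ → complementary (position t t≤n₀)
    ; rails-onto    = rails-onto
    ; total-start   = total-start (position n₀ ℕₚ.≤-refl)
    ; total-step    = λ t t<n₀ → total-up t refl (room t<n₀ (position t (ℕₚ.<⇒≤ t<n₀)))
    }
    where
    out-positive : ∀ {t} → Position t → 1 ≤ out t
    out-positive {t} (even i i≤ t≡ o≡ i≡) = linear (m ∷ i ∷ out t ∷ [])
      (λ m i O → (i ≤ᴺ 2 ⊠ m ⊕ con 1) ∷ (O ⊕ i ≡ᴺ 6 ⊠ m ⊕ con 5) ∷ [] ⊢ con 1 ≤ᴺ O) i≤ o≡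
    out-positive {t} (odd i i≤ t≡ o≡ i≡) = linear (m ∷ i ∷ out t ∷ [])
      (λ m i O → (i ≤ᴺ 2 ⊠ m) ∷ (O ⊕ i ≡ᴺ 2 ⊠ m ⊕ con 1) ∷ [] ⊢ con 1 ≤ᴺ O) i≤ o≡
    inn-positive : ∀ {t} → Position t → 1 ≤ inn t
    inn-positive {t} (even i _ _ _ i≡) = linear (m ∷ i ∷ inn t ∷ [])
      (λ m i I → (I ≡ᴺ 2 ⊠ m ⊕ con 2 ⊕ i) ∷ [] ⊢ con 1 ≤ᴺ I) i≡
    inn-positive {t} (odd i _ _ _ i≡) = linear (m ∷ i ∷ inn t ∷ [])
      (λ m i I → (I ≡ᴺ 6 ⊠ m ⊕ con 6 ⊕ i) ∷ [] ⊢ con 1 ≤ᴺ I) i≡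
    complementary : ∀ {t} → Position t → out t + inn t ≡ 2 * suc n₀ + 1
    complementary {t} (even i _ _ o≡ i≡) = linear (m ∷ n₀ ∷ i ∷ out t ∷ inn t ∷ [])
      (λ m n i O I → (n ≡ᴺ 4 ⊠ m ⊕ con 2) ∷ (O ⊕ i ≡ᴺ 6 ⊠ m ⊕ con 5) ∷ (I ≡ᴺ 2 ⊠ m ⊕ con 2 ⊕ i) ∷ [] ⊢
        O ⊕ I ≡ᴺ 2 ⊠ (con 1 ⊕ n) ⊕ con 1) n₀≡ o≡ i≡
    complementary {t} (odd i _ _ o≡ i≡) = linear (m ∷ n₀ ∷ i ∷ out t ∷ inn t ∷ [])
      (λ m n i O I → (n ≡ᴺ 4 ⊠ m ⊕ con 2) ∷ (O ⊕ i ≡ᴺ 2 ⊠ m ⊕ con 1) ∷ (I ≡ᴺ 6 ⊠ m ⊕ con 6 ⊕ i) ∷ [] ⊢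
        O ⊕ I ≡ᴺ 2 ⊠ (con 1 ⊕ n) ⊕ con 1) n₀≡ o≡ i≡
    -- The first and the last line are both even, so the alternation fails here. Their labels 2m + 1
    -- and 0 give the total -(2m + 2), which is why `sign 0` is `false`.
    total-start : Position n₀ → ℤ.- + (2 * m + 2) ≡ + inn n₀ ℤ.- + out 0
    total-start (even i _ t≡ _ i≡) = linear (m ∷ n₀ ∷ i ∷ inn n₀ ∷ out 0 ∷ [])
      (λ m n i I O → (n ≡ᴺ 4 ⊠ m ⊕ con 2) ∷ (n ≡ᴺ 2 ⊠ i) ∷ (I ≡ᴺ 2 ⊠ m ⊕ con 2 ⊕ i) ∷ (O ≡ᴺ 6 ⊠ m ⊕ con 5) ∷ [] ⊢
        neg (pos (2 ⊠ m ⊕ con 2)) ≡ᶻ pos I ⊖ pos O) n₀≡ t≡ i≡ out-start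
    total-start (odd i _ t≡ _ _) = ⊥-elim (ℕₚ.even≢odd (2 * m + 1) i
      (linear (m ∷ n₀ ∷ i ∷ []) (λ m n i → (n ≡ᴺ 4 ⊠ m ⊕ con 2) ∷ (n ≡ᴺ con 1 ⊕ 2 ⊠ i) ∷ [] ⊢
        2 ⊠ (2 ⊠ m ⊕ con 1) ≡ᴺ con 1 ⊕ 2 ⊠ i) n₀≡ t≡))

-- Rail currents, n = 4m + 1

-- The labels m, 3m+1, m−1, 3m+2, …, 4m, 0, 2m, 2m+1, 2m−1, …, 3m form a graceful
-- path whose ends add up to n − 1, so that closing it up produces the missing
-- total n.  Line 0 is the start of the second zigzag.
module Alpha (m n₀ : ℕ) (1≤m : 1 ≤ m) (n₀≡ : n₀ ≡ 4 * m) where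

  total : ℕ → ℕ
  total zero    = 2 * m
  total (suc t) = if does (suc t ℕ.≟ 2 * m) then 4 * m + 1 else suc t

  sign : ℕ → Bool
  sign zero    = true
  sign (suc t) = not (does (suc t ℕ.≤? 2 * m))

  total-mid : ∀ t → suc t ≡ 2 * m → total (suc t) ≡ 4 * m + 1
  total-mid t eq = cong (λ b → if b then 4 * m + 1 else suc t) (dec-true (suc t ℕ.≟ 2 * m) eq)

  total-off : ∀ t → suc t ≢ 2 * m → total (suc t) ≡ suc t
  total-off t neq = cong (λ b → if b then 4 * m + 1 else suc t) (dec-false (suc t ℕ.≟ 2 * m) neq)

  sign-low : ∀ t → suc t ≤ 2 * m → sign (suc t) ≡ false
  sign-low t p = cong not (dec-true (suc t ℕ.≤? 2 * m) p)

  sign-high : ∀ t → 2 * m < suc t → sign (suc t) ≡ true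
  sign-high t p = cong not (dec-false (suc t ℕ.≤? 2 * m) (ℕₚ.<⇒≱ p))

  open Walk sign total (2 * m + 1) (6 * m + 2)

  data Position (t : ℕ) : Set where
    even  : ∀ i → i < m → t ≡ 2 * i     → out t ≡ 2 * m + 1 + i → inn t + i ≡ 6 * m + 2 → Position t
    odd   : ∀ i → i < m → t ≡ 1 + 2 * i → out t ≡ 6 * m + 3 + i → inn t + i ≡ 2 * m     → Position t
    even′ : ∀ i → i ≤ m → t ≡ 2 * m + 2 * i       → out t + i ≡ 5 * m + 2 → inn t ≡ 3 * m + 1 + i → Position t
    odd′  : ∀ i → i < m → t ≡ 1 + (2 * m + 2 * i) → out t + i ≡ m         → inn t ≡ 7 * m + 3 + i → Position t

  data Next (t : ℕ) : Set where
    up   : sign (suc t) ≡ true  → total (suc t) ≤ inn t → Position (suc t) → Next t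
    down : sign (suc t) ≡ false → total (suc t) ≤ out t → Position (suc t) → Next t

  private
    next-even : ∀ {t} i → i < m → t ≡ 2 * i → out t ≡ 2 * m + 1 + i → inn t + i ≡ 6 * m + 2 → Next t
    next-even {t} i i< t≡ o≡ i≡ = down low room
      (odd i i< (cong suc t≡)
        (linear (m ∷ t ∷ i ∷ inn t ∷ d ∷ out (suc t) ∷ [])
          (λ m t i I d O → (t ≡ᴺ 2 ⊠ i) ∷ (I ⊕ i ≡ᴺ 6 ⊠ m ⊕ con 2) ∷ (d ≡ᴺ con 1 ⊕ t) ∷ (O ≡ᴺ I ⊕ d) ∷ [] ⊢
            O ≡ᴺ 6 ⊠ m ⊕ con 3 ⊕ i) t≡ i≡ d≡ (proj₁ (rails-down t low room)))
        (linear (m ∷ t ∷ i ∷ out t ∷ d ∷ inn (suc t) ∷ [])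
          (λ m t i O d I → (t ≡ᴺ 2 ⊠ i) ∷ (O ≡ᴺ 2 ⊠ m ⊕ con 1 ⊕ i) ∷ (d ≡ᴺ con 1 ⊕ t) ∷ (I ⊕ d ≡ᴺ O) ∷ [] ⊢
            I ⊕ i ≡ᴺ 2 ⊠ m) t≡ o≡ d≡ (proj₂ (rails-down t low room))))
      where
      d = total (suc t)
      t<2m : suc t < 2 * m
      t<2m = linear (m ∷ t ∷ i ∷ []) (λ m t i → (i <ᴺ m) ∷ (t ≡ᴺ 2 ⊠ i) ∷ [] ⊢ con 1 ⊕ t <ᴺ 2 ⊠ m) i< t≡
      low : sign (suc t) ≡ false
      low = sign-low t (ℕₚ.<⇒≤ t<2m)
      d≡ : d ≡ suc t
      d≡ = total-off t (ℕₚ.<⇒≢ t<2m)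
      room : d ≤ out t
      room = linear (m ∷ t ∷ i ∷ d ∷ out t ∷ [])
        (λ m t i d O → (i <ᴺ m) ∷ (t ≡ᴺ 2 ⊠ i) ∷ (O ≡ᴺ 2 ⊠ m ⊕ con 1 ⊕ i) ∷ (d ≡ᴺ con 1 ⊕ t) ∷ [] ⊢ d ≤ᴺ O)
        i< t≡ o≡ d≡

    next-odd : ∀ {t} i → suc i < m → t ≡ 1 + 2 * i → out t ≡ 6 * m + 3 + i → inn t + i ≡ 2 * m → Next t
    next-odd {t} i i< t≡ o≡ i≡ = down low room
      (even (suc i) i<
        (linear (t ∷ i ∷ []) (λ t i → (t ≡ᴺ con 1 ⊕ 2 ⊠ i) ∷ [] ⊢ con 1 ⊕ t ≡ᴺ 2 ⊠ (con 1 ⊕ i)) t≡)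
        (linear (m ∷ t ∷ i ∷ inn t ∷ d ∷ out (suc t) ∷ [])
          (λ m t i I d O → (t ≡ᴺ con 1 ⊕ 2 ⊠ i) ∷ (I ⊕ i ≡ᴺ 2 ⊠ m) ∷ (d ≡ᴺ con 1 ⊕ t) ∷ (O ≡ᴺ I ⊕ d) ∷ [] ⊢
            O ≡ᴺ 2 ⊠ m ⊕ con 1 ⊕ (con 1 ⊕ i)) t≡ i≡ d≡ (proj₁ (rails-down t low room)))
        (linear (m ∷ t ∷ i ∷ out t ∷ d ∷ inn (suc t) ∷ [])
          (λ m t i O d I → (t ≡ᴺ con 1 ⊕ 2 ⊠ i) ∷ (O ≡ᴺ 6 ⊠ m ⊕ con 3 ⊕ i) ∷ (d ≡ᴺ con 1 ⊕ t) ∷ (I ⊕ d ≡ᴺ O) ∷ [] ⊢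
            I ⊕ (con 1 ⊕ i) ≡ᴺ 6 ⊠ m ⊕ con 2) t≡ o≡ d≡ (proj₂ (rails-down t low room))))
      where
      d = total (suc t)
      t<2m : suc t < 2 * m
      t<2m = linear (m ∷ t ∷ i ∷ [])
        (λ m t i → (con 1 ⊕ i <ᴺ m) ∷ (t ≡ᴺ con 1 ⊕ 2 ⊠ i) ∷ [] ⊢ con 1 ⊕ t <ᴺ 2 ⊠ m) i< t≡
      low : sign (suc t) ≡ false
      low = sign-low t (ℕₚ.<⇒≤ t<2m)
      d≡ : d ≡ suc t
      d≡ = total-off t (ℕₚ.<⇒≢ t<2m)
      room : d ≤ out t
      room = linear (m ∷ t ∷ i ∷ d ∷ out t ∷ [])
        (λ m t i d O → (con 1 ⊕ i <ᴺ m) ∷ (t ≡ᴺ con 1 ⊕ 2 ⊠ i) ∷ (O ≡ᴺ 6 ⊠ m ⊕ con 3 ⊕ i) ∷ (d ≡ᴺ con 1 ⊕ t) ∷ [] ⊢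
          d ≤ᴺ O) i< t≡ o≡ d≡

    -- The junction of the two ends of the path: both lines have `out` as the larger rail, so their
    -- labels 3m and m add instead of subtracting and the total is 3m + m + 1 = n.
    next-mid : ∀ {t} i → suc i ≡ m → t ≡ 1 + 2 * i → out t ≡ 6 * m + 3 + i → inn t + i ≡ 2 * m → Next t
    next-mid {t} i i≡m t≡ o≡ i≡ = down low room
      (even′ 0 z≤n (trans t≡2m (sym (ℕₚ.+-identityʳ _)))
        (linear (m ∷ i ∷ inn t ∷ d ∷ out (suc t) ∷ [])
          (λ m i I d O → (con 1 ⊕ i ≡ᴺ m) ∷ (I ⊕ i ≡ᴺ 2 ⊠ m) ∷ (d ≡ᴺ 4 ⊠ m ⊕ con 1) ∷ (O ≡ᴺ I ⊕ d) ∷ [] ⊢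
            O ⊕ con 0 ≡ᴺ 5 ⊠ m ⊕ con 2) i≡m i≡ d≡ (proj₁ (rails-down t low room)))
        (linear (m ∷ i ∷ out t ∷ d ∷ inn (suc t) ∷ [])
          (λ m i O d I → (con 1 ⊕ i ≡ᴺ m) ∷ (O ≡ᴺ 6 ⊠ m ⊕ con 3 ⊕ i) ∷ (d ≡ᴺ 4 ⊠ m ⊕ con 1) ∷ (I ⊕ d ≡ᴺ O) ∷ [] ⊢
            I ≡ᴺ 3 ⊠ m ⊕ con 1 ⊕ con 0) i≡m o≡ d≡ (proj₂ (rails-down t low room))))
      where
      d = total (suc t)
      t≡2m : suc t ≡ 2 * m
      t≡2m = linear (m ∷ t ∷ i ∷ [])
        (λ m t i → (con 1 ⊕ i ≡ᴺ m) ∷ (t ≡ᴺ con 1 ⊕ 2 ⊠ i) ∷ [] ⊢ con 1 ⊕ t ≡ᴺ 2 ⊠ m) i≡m t≡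
      low : sign (suc t) ≡ false
      low = sign-low t (ℕₚ.≤-reflexive t≡2m)
      d≡ : d ≡ 4 * m + 1
      d≡ = total-mid t t≡2m
      room : d ≤ out t
      room = linear (m ∷ i ∷ d ∷ out t ∷ [])
        (λ m i d O → (O ≡ᴺ 6 ⊠ m ⊕ con 3 ⊕ i) ∷ (d ≡ᴺ 4 ⊠ m ⊕ con 1) ∷ [] ⊢ d ≤ᴺ O) o≡ d≡

    next-even′ : ∀ {t} i → i < m → t ≡ 2 * m + 2 * i → out t + i ≡ 5 * m + 2 → inn t ≡ 3 * m + 1 + i → Next t
    next-even′ {t} i i< t≡ o≡ i≡ = up high room
      (odd′ i i< (cong suc t≡)
        (linear (m ∷ t ∷ i ∷ inn t ∷ d ∷ out (suc t) ∷ [])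
          (λ m t i I d O → (t ≡ᴺ 2 ⊠ m ⊕ 2 ⊠ i) ∷ (I ≡ᴺ 3 ⊠ m ⊕ con 1 ⊕ i) ∷ (d ≡ᴺ con 1 ⊕ t) ∷ (O ⊕ d ≡ᴺ I) ∷ [] ⊢
            O ⊕ i ≡ᴺ m) t≡ i≡ d≡ (proj₁ (rails-up t high room)))
        (linear (m ∷ t ∷ i ∷ out t ∷ d ∷ inn (suc t) ∷ [])
          (λ m t i O d I → (t ≡ᴺ 2 ⊠ m ⊕ 2 ⊠ i) ∷ (O ⊕ i ≡ᴺ 5 ⊠ m ⊕ con 2) ∷ (d ≡ᴺ con 1 ⊕ t) ∷ (I ≡ᴺ O ⊕ d) ∷ [] ⊢
            I ≡ᴺ 7 ⊠ m ⊕ con 3 ⊕ i) t≡ o≡ d≡ (proj₂ (rails-up t high room))))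
      where
      d = total (suc t)
      2m<t : 2 * m < suc t
      2m<t = linear (m ∷ t ∷ i ∷ []) (λ m t i → (t ≡ᴺ 2 ⊠ m ⊕ 2 ⊠ i) ∷ [] ⊢ 2 ⊠ m <ᴺ con 1 ⊕ t) t≡
      high : sign (suc t) ≡ true
      high = sign-high t 2m<t
      d≡ : d ≡ suc t
      d≡ = total-off t (ℕₚ.<⇒≢ 2m<t ∘ sym)
      room : d ≤ inn t
      room = linear (m ∷ t ∷ i ∷ d ∷ inn t ∷ [])
        (λ m t i d I → (i <ᴺ m) ∷ (t ≡ᴺ 2 ⊠ m ⊕ 2 ⊠ i) ∷ (I ≡ᴺ 3 ⊠ m ⊕ con 1 ⊕ i) ∷ (d ≡ᴺ con 1 ⊕ t) ∷ [] ⊢ d ≤ᴺ I)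
        i< t≡ i≡ d≡

    next-odd′ : ∀ {t} i → i < m → t ≡ 1 + (2 * m + 2 * i) → out t + i ≡ m → inn t ≡ 7 * m + 3 + i → Next t
    next-odd′ {t} i i< t≡ o≡ i≡ = up high room
      (even′ (suc i) i<
        (linear (m ∷ t ∷ i ∷ []) (λ m t i → (t ≡ᴺ con 1 ⊕ (2 ⊠ m ⊕ 2 ⊠ i)) ∷ [] ⊢
          con 1 ⊕ t ≡ᴺ 2 ⊠ m ⊕ 2 ⊠ (con 1 ⊕ i)) t≡)
        (linear (m ∷ t ∷ i ∷ inn t ∷ d ∷ out (suc t) ∷ [])
          (λ m t i I d O → (t ≡ᴺ con 1 ⊕ (2 ⊠ m ⊕ 2 ⊠ i)) ∷ (I ≡ᴺ 7 ⊠ m ⊕ con 3 ⊕ i) ∷ (d ≡ᴺ con 1 ⊕ t) ∷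
            (O ⊕ d ≡ᴺ I) ∷ [] ⊢ O ⊕ (con 1 ⊕ i) ≡ᴺ 5 ⊠ m ⊕ con 2) t≡ i≡ d≡ (proj₁ (rails-up t high room)))
        (linear (m ∷ t ∷ i ∷ out t ∷ d ∷ inn (suc t) ∷ [])
          (λ m t i O d I → (t ≡ᴺ con 1 ⊕ (2 ⊠ m ⊕ 2 ⊠ i)) ∷ (O ⊕ i ≡ᴺ m) ∷ (d ≡ᴺ con 1 ⊕ t) ∷
            (I ≡ᴺ O ⊕ d) ∷ [] ⊢ I ≡ᴺ 3 ⊠ m ⊕ con 1 ⊕ (con 1 ⊕ i)) t≡ o≡ d≡ (proj₂ (rails-up t high room))))
      where
      d = total (suc t)
      2m<t : 2 * m < suc t
      2m<t = linear (m ∷ t ∷ i ∷ []) (λ m t i → (t ≡ᴺ con 1 ⊕ (2 ⊠ m ⊕ 2 ⊠ i)) ∷ [] ⊢ 2 ⊠ m <ᴺ con 1 ⊕ t) t≡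
      high : sign (suc t) ≡ true
      high = sign-high t 2m<t
      d≡ : d ≡ suc t
      d≡ = total-off t (ℕₚ.<⇒≢ 2m<t ∘ sym)
      room : d ≤ inn t
      room = linear (m ∷ t ∷ i ∷ d ∷ inn t ∷ [])
        (λ m t i d I → (i <ᴺ m) ∷ (t ≡ᴺ con 1 ⊕ (2 ⊠ m ⊕ 2 ⊠ i)) ∷ (I ≡ᴺ 7 ⊠ m ⊕ con 3 ⊕ i) ∷ (d ≡ᴺ con 1 ⊕ t) ∷ [] ⊢
          d ≤ᴺ I) i< t≡ i≡ d≡

  next-position : ∀ t → suc t ≤ n₀ → Position t → Next t
  next-position t t<n₀ (even i i< t≡ o≡ i≡) = next-even i i< t≡ o≡ i≡
  next-position t t<n₀ (odd i i< t≡ o≡ i≡) with ℕₚ.m≤n⇒m<n∨m≡n i<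
  ... | inj₁ i+1<m = next-odd i i+1<m t≡ o≡ i≡
  ... | inj₂ i+1≡m = next-mid i i+1≡m t≡ o≡ i≡
  next-position t t<n₀ (even′ i i≤ t≡ o≡ i≡) = next-even′ i
    (linear (m ∷ n₀ ∷ t ∷ i ∷ [])
      (λ m n t i → (n ≡ᴺ 4 ⊠ m) ∷ (con 1 ⊕ t ≤ᴺ n) ∷ (t ≡ᴺ 2 ⊠ m ⊕ 2 ⊠ i) ∷ [] ⊢ i <ᴺ m) n₀≡ t<n₀ t≡)
    t≡ o≡ i≡
  next-position t t<n₀ (odd′ i i< t≡ o≡ i≡) = next-odd′ i i< t≡ o≡ i≡

  position : ∀ t → t ≤ n₀ → Position t
  position zero    _    = even 0 1≤m refl (trans out-start (sym (ℕₚ.+-identityʳ _)))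
                                          (trans (ℕₚ.+-identityʳ _) inn-start)
  position (suc t) t<n₀ = move (next-position t t<n₀ (position t (ℕₚ.<⇒≤ t<n₀)))
    where
    move : Next t → Position (suc t)
    move (up   _ _ p) = p
    move (down _ _ p) = p

  private
    ≤n₀ : ∀ {t} → t ≤ 4 * m → t ≤ n₀
    ≤n₀ {t} = subst (t ≤_) (sym n₀≡)

  at-even : ∀ i → i < m → 2 * i ≤ n₀ × out (2 * i) ≡ 2 * m + 1 + i × inn (2 * i) + i ≡ 6 * m + 2
  at-even i i< = t≤ , by (position (2 * i) t≤)
    where
    t≤ = ≤n₀ (linear (m ∷ i ∷ []) (λ m i → (i <ᴺ m) ∷ [] ⊢ 2 ⊠ i ≤ᴺ 4 ⊠ m) i<)
    by : Position (2 * i) → out (2 * i) ≡ 2 * m + 1 + i × inn (2 * i) + i ≡ 6 * m + 2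
    by (even j _ t≡ o≡ i≡) with refl ← ℕₚ.*-cancelˡ-≡ i j 2 t≡ = o≡ , i≡
    by (odd j _ t≡ _ _) = ⊥-elim (ℕₚ.even≢odd i j t≡)
    by (even′ j _ t≡ _ _) = ⊥-elim (linear (m ∷ i ∷ j ∷ [])
      (λ m i j → (i <ᴺ m) ∷ (2 ⊠ i ≡ᴺ 2 ⊠ m ⊕ 2 ⊠ j) ∷ [] ⊢ falsum) i< t≡)
    by (odd′ j _ t≡ _ _) = ⊥-elim (linear (m ∷ i ∷ j ∷ [])
      (λ m i j → (i <ᴺ m) ∷ (2 ⊠ i ≡ᴺ con 1 ⊕ (2 ⊠ m ⊕ 2 ⊠ j)) ∷ [] ⊢ falsum) i< t≡)

  at-odd : ∀ i → i < m → 1 + 2 * i ≤ n₀ × out (1 + 2 * i) ≡ 6 * m + 3 + i × inn (1 + 2 * i) + i ≡ 2 * m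
  at-odd i i< = t≤ , by (position (1 + 2 * i) t≤)
    where
    t≤ = ≤n₀ (linear (m ∷ i ∷ []) (λ m i → (i <ᴺ m) ∷ [] ⊢ con 1 ⊕ 2 ⊠ i ≤ᴺ 4 ⊠ m) i<)
    by : Position (1 + 2 * i) → out (1 + 2 * i) ≡ 6 * m + 3 + i × inn (1 + 2 * i) + i ≡ 2 * m
    by (even j _ t≡ _ _) = ⊥-elim (ℕₚ.even≢odd j i (sym t≡))
    by (odd j _ t≡ o≡ i≡) with refl ← ℕₚ.*-cancelˡ-≡ i j 2 (ℕₚ.suc-injective t≡) = o≡ , i≡
    by (even′ j _ t≡ _ _) = ⊥-elim (linear (m ∷ i ∷ j ∷ [])
      (λ m i j → (i <ᴺ m) ∷ (con 1 ⊕ 2 ⊠ i ≡ᴺ 2 ⊠ m ⊕ 2 ⊠ j) ∷ [] ⊢ falsum) i< t≡)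
    by (odd′ j _ t≡ _ _) = ⊥-elim (linear (m ∷ i ∷ j ∷ [])
      (λ m i j → (i <ᴺ m) ∷ (con 1 ⊕ 2 ⊠ i ≡ᴺ con 1 ⊕ (2 ⊠ m ⊕ 2 ⊠ j)) ∷ [] ⊢ falsum) i< t≡)

  at-even′ : ∀ i → i ≤ m → 2 * m + 2 * i ≤ n₀ ×
             out (2 * m + 2 * i) + i ≡ 5 * m + 2 × inn (2 * m + 2 * i) ≡ 3 * m + 1 + i
  at-even′ i i≤ = t≤ , by (position (2 * m + 2 * i) t≤)
    where
    t≤ = ≤n₀ (linear (m ∷ i ∷ []) (λ m i → (i ≤ᴺ m) ∷ [] ⊢ 2 ⊠ m ⊕ 2 ⊠ i ≤ᴺ 4 ⊠ m) i≤)
    by : Position (2 * m + 2 * i) → out (2 * m + 2 * i) + i ≡ 5 * m + 2 × inn (2 * m + 2 * i) ≡ 3 * m + 1 + i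
    by (even j j< t≡ _ _) = ⊥-elim (linear (m ∷ i ∷ j ∷ [])
      (λ m i j → (j <ᴺ m) ∷ (2 ⊠ m ⊕ 2 ⊠ i ≡ᴺ 2 ⊠ j) ∷ [] ⊢ falsum) j< t≡)
    by (odd j j< t≡ _ _) = ⊥-elim (linear (m ∷ i ∷ j ∷ [])
      (λ m i j → (j <ᴺ m) ∷ (2 ⊠ m ⊕ 2 ⊠ i ≡ᴺ con 1 ⊕ 2 ⊠ j) ∷ [] ⊢ falsum) j< t≡)
    by (even′ j _ t≡ o≡ i≡) with refl ← ℕₚ.*-cancelˡ-≡ i j 2 (ℕₚ.+-cancelˡ-≡ (2 * m) _ _ t≡) = o≡ , i≡
    by (odd′ j _ t≡ _ _) = ⊥-elim (ℕₚ.even≢odd i j (linear (m ∷ i ∷ j ∷ [])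
      (λ m i j → (2 ⊠ m ⊕ 2 ⊠ i ≡ᴺ con 1 ⊕ (2 ⊠ m ⊕ 2 ⊠ j)) ∷ [] ⊢ 2 ⊠ i ≡ᴺ con 1 ⊕ 2 ⊠ j) t≡))

  at-odd′ : ∀ i → i < m → 1 + (2 * m + 2 * i) ≤ n₀ ×
            out (1 + (2 * m + 2 * i)) + i ≡ m × inn (1 + (2 * m + 2 * i)) ≡ 7 * m + 3 + i
  at-odd′ i i< = t≤ , by (position (1 + (2 * m + 2 * i)) t≤)
    where
    t≤ = ≤n₀ (linear (m ∷ i ∷ []) (λ m i → (i <ᴺ m) ∷ [] ⊢ con 1 ⊕ (2 ⊠ m ⊕ 2 ⊠ i) ≤ᴺ 4 ⊠ m) i<)
    by : Position (1 + (2 * m + 2 * i)) →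
         out (1 + (2 * m + 2 * i)) + i ≡ m × inn (1 + (2 * m + 2 * i)) ≡ 7 * m + 3 + i
    by (even j j< t≡ _ _) = ⊥-elim (linear (m ∷ i ∷ j ∷ [])
      (λ m i j → (j <ᴺ m) ∷ (con 1 ⊕ (2 ⊠ m ⊕ 2 ⊠ i) ≡ᴺ 2 ⊠ j) ∷ [] ⊢ falsum) j< t≡)
    by (odd j j< t≡ _ _) = ⊥-elim (linear (m ∷ i ∷ j ∷ [])
      (λ m i j → (j <ᴺ m) ∷ (con 1 ⊕ (2 ⊠ m ⊕ 2 ⊠ i) ≡ᴺ con 1 ⊕ 2 ⊠ j) ∷ [] ⊢ falsum) j< t≡)
    by (even′ j _ t≡ _ _) = ⊥-elim (ℕₚ.even≢odd j i (linear (m ∷ i ∷ j ∷ [])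
      (λ m i j → (con 1 ⊕ (2 ⊠ m ⊕ 2 ⊠ i) ≡ᴺ 2 ⊠ m ⊕ 2 ⊠ j) ∷ [] ⊢ 2 ⊠ j ≡ᴺ con 1 ⊕ 2 ⊠ i) t≡))
    by (odd′ j _ t≡ o≡ i≡)
      with refl ← ℕₚ.*-cancelˡ-≡ i j 2 (ℕₚ.+-cancelˡ-≡ (2 * m) _ _ (ℕₚ.suc-injective t≡)) = o≡ , i≡

  Attained : ℕ → Set
  Attained a = ∃ λ t → t ≤ n₀ × (out t ≡ a ⊎ inn t ≡ a)

  private
    equal : ∀ {x a c} i → x + i ≡ c → a + i ≡ c → x ≡ a
    equal i p q = ℕₚ.+-cancelʳ-≡ i _ _ (trans p (sym q))

    out-even : ∀ a i → i < m → 2 * m + 1 + i ≡ a → Attained a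
    out-even a i i< eq = 2 * i , proj₁ (at-even i i<) , inj₁ (trans (proj₁ (proj₂ (at-even i i<))) eq)

    inn-even : ∀ a i → i < m → a + i ≡ 6 * m + 2 → Attained a
    inn-even a i i< eq = 2 * i , proj₁ (at-even i i<) , inj₂ (equal i (proj₂ (proj₂ (at-even i i<))) eq)

    out-odd : ∀ a i → i < m → 6 * m + 3 + i ≡ a → Attained a
    out-odd a i i< eq = 1 + 2 * i , proj₁ (at-odd i i<) , inj₁ (trans (proj₁ (proj₂ (at-odd i i<))) eq)

    inn-odd : ∀ a i → i < m → a + i ≡ 2 * m → Attained a
    inn-odd a i i< eq = 1 + 2 * i , proj₁ (at-odd i i<) , inj₂ (equal i (proj₂ (proj₂ (at-odd i i<))) eq)

    out-even′ : ∀ a i → i ≤ m → a + i ≡ 5 * m + 2 → Attained a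
    out-even′ a i i≤ eq = 2 * m + 2 * i , proj₁ (at-even′ i i≤) , inj₁ (equal i (proj₁ (proj₂ (at-even′ i i≤))) eq)

    inn-even′ : ∀ a i → i ≤ m → 3 * m + 1 + i ≡ a → Attained a
    inn-even′ a i i≤ eq = 2 * m + 2 * i , proj₁ (at-even′ i i≤) , inj₂ (trans (proj₂ (proj₂ (at-even′ i i≤))) eq)

    out-odd′ : ∀ a i → i < m → a + i ≡ m → Attained a
    out-odd′ a i i< eq = 1 + (2 * m + 2 * i) , proj₁ (at-odd′ i i<) , inj₁ (equal i (proj₁ (proj₂ (at-odd′ i i<))) eq)

    inn-odd′ : ∀ a i → i < m → 7 * m + 3 + i ≡ a → Attained a
    inn-odd′ a i i< eq = 1 + (2 * m + 2 * i) , proj₁ (at-odd′ i i<) , inj₂ (trans (proj₂ (proj₂ (at-odd′ i i<))) eq)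

    -- The runs come in the order `odd′` out, `odd` inn, `even` out, `even′` inn. The upper half is
    -- their mirror image under the exchange of a and 2n + 1 - a.
    lower-half : ∀ a → 1 ≤ a → a ≤ 4 * m + 1 → Attained a
    lower-half a 1≤a a≤4m+1 with a ℕ.≤? m | a ℕ.≤? 2 * m | a ℕ.≤? 3 * m
    ... | yes a≤ | _ | _ = let i , eq = remainder a≤ in out-odd′ a i (linear (a ∷ i ∷ m ∷ [])
            (λ a i m → (con 1 ≤ᴺ a) ∷ (a ⊕ i ≡ᴺ m) ∷ [] ⊢ i <ᴺ m) 1≤a eq) eq
    ... | no a≰ | yes a≤ | _ = let i , eq = remainder a≤ in inn-odd a i (linear (a ∷ i ∷ m ∷ [])
            (λ a i m → (m <ᴺ a) ∷ (a ⊕ i ≡ᴺ 2 ⊠ m) ∷ [] ⊢ i <ᴺ m) (ℕₚ.≰⇒> a≰) eq) eq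
    ... | no _ | no a≰ | yes a≤ = let i , eq = remainder (lower (ℕₚ.≰⇒> a≰)) in out-even a i (linear (a ∷ i ∷ m ∷ [])
            (λ a i m → (a ≤ᴺ 3 ⊠ m) ∷ (2 ⊠ m ⊕ con 1 ⊕ i ≡ᴺ a) ∷ [] ⊢ i <ᴺ m) a≤ eq) eq
      where
      lower : 2 * m < a → 2 * m + 1 ≤ a
      lower = linear (a ∷ m ∷ []) (λ a m → (2 ⊠ m <ᴺ a) ∷ [] ⊢ 2 ⊠ m ⊕ con 1 ≤ᴺ a)
    ... | no _ | no _ | no a≰ = let i , eq = remainder (lower (ℕₚ.≰⇒> a≰)) in inn-even′ a i (linear (a ∷ i ∷ m ∷ [])
            (λ a i m → (a ≤ᴺ 4 ⊠ m ⊕ con 1) ∷ (3 ⊠ m ⊕ con 1 ⊕ i ≡ᴺ a) ∷ [] ⊢ i ≤ᴺ m) a≤4m+1 eq) eq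
      where
      lower : 3 * m < a → 3 * m + 1 ≤ a
      lower = linear (a ∷ m ∷ []) (λ a m → (3 ⊠ m <ᴺ a) ∷ [] ⊢ 3 ⊠ m ⊕ con 1 ≤ᴺ a)

    upper-half : ∀ a → 4 * m + 1 < a → a ≤ 8 * m + 2 → Attained a
    upper-half a 4m+1< a≤8m+2 with a ℕ.≤? 5 * m + 2 | a ℕ.≤? 6 * m + 2 | a ℕ.≤? 7 * m + 2
    ... | yes a≤ | _ | _ = let i , eq = remainder a≤ in out-even′ a i (linear (a ∷ i ∷ m ∷ [])
            (λ a i m → (4 ⊠ m ⊕ con 1 <ᴺ a) ∷ (a ⊕ i ≡ᴺ 5 ⊠ m ⊕ con 2) ∷ [] ⊢ i ≤ᴺ m) 4m+1< eq) eq
    ... | no a≰ | yes a≤ | _ = let i , eq = remainder a≤ in inn-even a i (linear (a ∷ i ∷ m ∷ [])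
            (λ a i m → (5 ⊠ m ⊕ con 2 <ᴺ a) ∷ (a ⊕ i ≡ᴺ 6 ⊠ m ⊕ con 2) ∷ [] ⊢ i <ᴺ m) (ℕₚ.≰⇒> a≰) eq) eq
    ... | no _ | no a≰ | yes a≤ = let i , eq = remainder (lower (ℕₚ.≰⇒> a≰)) in out-odd a i (linear (a ∷ i ∷ m ∷ [])
            (λ a i m → (a ≤ᴺ 7 ⊠ m ⊕ con 2) ∷ (6 ⊠ m ⊕ con 3 ⊕ i ≡ᴺ a) ∷ [] ⊢ i <ᴺ m) a≤ eq) eq
      where
      lower : 6 * m + 2 < a → 6 * m + 3 ≤ a
      lower = linear (a ∷ m ∷ []) (λ a m → (6 ⊠ m ⊕ con 2 <ᴺ a) ∷ [] ⊢ 6 ⊠ m ⊕ con 3 ≤ᴺ a)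
    ... | no _ | no _ | no a≰ = let i , eq = remainder (lower (ℕₚ.≰⇒> a≰)) in inn-odd′ a i (linear (a ∷ i ∷ m ∷ [])
            (λ a i m → (a ≤ᴺ 8 ⊠ m ⊕ con 2) ∷ (7 ⊠ m ⊕ con 3 ⊕ i ≡ᴺ a) ∷ [] ⊢ i <ᴺ m) a≤8m+2 eq) eq
      where
      lower : 7 * m + 2 < a → 7 * m + 3 ≤ a
      lower = linear (a ∷ m ∷ []) (λ a m → (7 ⊠ m ⊕ con 2 <ᴺ a) ∷ [] ⊢ 7 ⊠ m ⊕ con 3 ≤ᴺ a)

  rails-onto : ∀ a → 1 ≤ a → a ≤ 2 * suc n₀ → Attained a
  rails-onto a 1≤a a≤2n with a ℕ.≤? 4 * m + 1
  ... | yes a≤ = lower-half a 1≤a a≤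
  ... | no  a≰ = upper-half a (ℕₚ.≰⇒> a≰) (linear (a ∷ m ∷ n₀ ∷ [])
          (λ a m n → (n ≡ᴺ 4 ⊠ m) ∷ (a ≤ᴺ 2 ⊠ (con 1 ⊕ n)) ∷ [] ⊢ a ≤ᴺ 8 ⊠ m ⊕ con 2) n₀≡ a≤2n)

  alphaRails : Rails n₀
  alphaRails = record
    { sign          = sign
    ; total         = total
    ; out           = out
    ; inn           = inn
    ; out-positive  = λ t t≤n₀ → out-positive (position t t≤n₀)
    ; inn-positive  = λ t t≤n₀ → inn-positive (position t t≤n₀)
    ; complementary = λ t t≤n₀ → complementary (position t t≤n₀)
    ; rails-onto    = rails-onto
    ; total-start   = total-start (position n₀ ℕₚ.≤-refl)
    ; total-step    = λ t t<n₀ → total-step (next-position t t<n₀ (position t (ℕₚ.<⇒≤ t<n₀)))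
    }
    where
    out-positive : ∀ {t} → Position t → 1 ≤ out t
    out-positive {t} (even i _ _ o≡ _) = linear (m ∷ i ∷ out t ∷ [])
      (λ m i O → (O ≡ᴺ 2 ⊠ m ⊕ con 1 ⊕ i) ∷ [] ⊢ con 1 ≤ᴺ O) o≡
    out-positive {t} (odd i _ _ o≡ _) = linear (m ∷ i ∷ out t ∷ [])
      (λ m i O → (O ≡ᴺ 6 ⊠ m ⊕ con 3 ⊕ i) ∷ [] ⊢ con 1 ≤ᴺ O) o≡
    out-positive {t} (even′ i i≤ _ o≡ _) = linear (m ∷ i ∷ out t ∷ [])
      (λ m i O → (i ≤ᴺ m) ∷ (O ⊕ i ≡ᴺ 5 ⊠ m ⊕ con 2) ∷ [] ⊢ con 1 ≤ᴺ O) i≤ o≡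
    out-positive {t} (odd′ i i< _ o≡ _) = linear (m ∷ i ∷ out t ∷ [])
      (λ m i O → (i <ᴺ m) ∷ (O ⊕ i ≡ᴺ m) ∷ [] ⊢ con 1 ≤ᴺ O) i< o≡
    inn-positive : ∀ {t} → Position t → 1 ≤ inn t
    inn-positive {t} (even i i< _ _ i≡) = linear (m ∷ i ∷ inn t ∷ [])
      (λ m i I → (i <ᴺ m) ∷ (I ⊕ i ≡ᴺ 6 ⊠ m ⊕ con 2) ∷ [] ⊢ con 1 ≤ᴺ I) i< i≡
    inn-positive {t} (odd i i< _ _ i≡) = linear (m ∷ i ∷ inn t ∷ [])
      (λ m i I → (i <ᴺ m) ∷ (I ⊕ i ≡ᴺ 2 ⊠ m) ∷ [] ⊢ con 1 ≤ᴺ I) i< i≡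
    inn-positive {t} (even′ i _ _ _ i≡) = linear (m ∷ i ∷ inn t ∷ [])
      (λ m i I → (I ≡ᴺ 3 ⊠ m ⊕ con 1 ⊕ i) ∷ [] ⊢ con 1 ≤ᴺ I) i≡
    inn-positive {t} (odd′ i _ _ _ i≡) = linear (m ∷ i ∷ inn t ∷ [])
      (λ m i I → (I ≡ᴺ 7 ⊠ m ⊕ con 3 ⊕ i) ∷ [] ⊢ con 1 ≤ᴺ I) i≡
    complementary : ∀ {t} → Position t → out t + inn t ≡ 2 * suc n₀ + 1
    complementary {t} (even i _ _ o≡ i≡) = linear (m ∷ n₀ ∷ i ∷ out t ∷ inn t ∷ [])
      (λ m n i O I → (n ≡ᴺ 4 ⊠ m) ∷ (O ≡ᴺ 2 ⊠ m ⊕ con 1 ⊕ i) ∷ (I ⊕ i ≡ᴺ 6 ⊠ m ⊕ con 2) ∷ [] ⊢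
        O ⊕ I ≡ᴺ 2 ⊠ (con 1 ⊕ n) ⊕ con 1) n₀≡ o≡ i≡
    complementary {t} (odd i _ _ o≡ i≡) = linear (m ∷ n₀ ∷ i ∷ out t ∷ inn t ∷ [])
      (λ m n i O I → (n ≡ᴺ 4 ⊠ m) ∷ (O ≡ᴺ 6 ⊠ m ⊕ con 3 ⊕ i) ∷ (I ⊕ i ≡ᴺ 2 ⊠ m) ∷ [] ⊢
        O ⊕ I ≡ᴺ 2 ⊠ (con 1 ⊕ n) ⊕ con 1) n₀≡ o≡ i≡
    complementary {t} (even′ i _ _ o≡ i≡) = linear (m ∷ n₀ ∷ i ∷ out t ∷ inn t ∷ [])
      (λ m n i O I → (n ≡ᴺ 4 ⊠ m) ∷ (O ⊕ i ≡ᴺ 5 ⊠ m ⊕ con 2) ∷ (I ≡ᴺ 3 ⊠ m ⊕ con 1 ⊕ i) ∷ [] ⊢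
        O ⊕ I ≡ᴺ 2 ⊠ (con 1 ⊕ n) ⊕ con 1) n₀≡ o≡ i≡
    complementary {t} (odd′ i _ _ o≡ i≡) = linear (m ∷ n₀ ∷ i ∷ out t ∷ inn t ∷ [])
      (λ m n i O I → (n ≡ᴺ 4 ⊠ m) ∷ (O ⊕ i ≡ᴺ m) ∷ (I ≡ᴺ 7 ⊠ m ⊕ con 3 ⊕ i) ∷ [] ⊢
        O ⊕ I ≡ᴺ 2 ⊠ (con 1 ⊕ n) ⊕ con 1) n₀≡ o≡ i≡
    total-start : Position n₀ → + (2 * m) ≡ + inn n₀ ℤ.- + out 0
    total-start (even i i< t≡ _ _) = ⊥-elim (linear (m ∷ n₀ ∷ i ∷ [])
      (λ m n i → (n ≡ᴺ 4 ⊠ m) ∷ (i <ᴺ m) ∷ (n ≡ᴺ 2 ⊠ i) ∷ [] ⊢ falsum) n₀≡ i< t≡)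
    total-start (odd i i< t≡ _ _) = ⊥-elim (linear (m ∷ n₀ ∷ i ∷ [])
      (λ m n i → (n ≡ᴺ 4 ⊠ m) ∷ (i <ᴺ m) ∷ (n ≡ᴺ con 1 ⊕ 2 ⊠ i) ∷ [] ⊢ falsum) n₀≡ i< t≡)
    total-start (even′ i _ t≡ _ i≡) = linear (m ∷ n₀ ∷ i ∷ inn n₀ ∷ out 0 ∷ [])
      (λ m n i I O → (n ≡ᴺ 4 ⊠ m) ∷ (n ≡ᴺ 2 ⊠ m ⊕ 2 ⊠ i) ∷ (I ≡ᴺ 3 ⊠ m ⊕ con 1 ⊕ i) ∷ (O ≡ᴺ 2 ⊠ m ⊕ con 1) ∷ [] ⊢
        pos (2 ⊠ m) ≡ᶻ pos I ⊖ pos O) n₀≡ t≡ i≡ out-start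
    total-start (odd′ i i< t≡ _ _) = ⊥-elim (linear (m ∷ n₀ ∷ i ∷ [])
      (λ m n i → (n ≡ᴺ 4 ⊠ m) ∷ (i <ᴺ m) ∷ (n ≡ᴺ con 1 ⊕ (2 ⊠ m ⊕ 2 ⊠ i)) ∷ [] ⊢ falsum) n₀≡ i< t≡)
    total-step : ∀ {t} → Next t → signed (sign (suc t)) (+ total (suc t)) ≡ + inn t ℤ.- + out (suc t)
    total-step {t} (up   s d≤ _) = total-up t s d≤
    total-step {t} (down s d≤ _) = total-down t s d≤

-- Parallel edges of the rungs

∣∣-neg : ∀ {i} a → i ≡ ℤ.- + a → ∣ i ∣ ≡ a
∣∣-neg a eq = trans (cong ∣_∣ eq) (ℤₚ.∣-i∣≡∣i∣ (+ a))

∣∣-pos : ∀ {i} a → i ≡ + a → ∣ i ∣ ≡ a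
∣∣-pos a eq = cong ∣_∣ eq

data Mod4 (x : ℕ) : Set where
  rem0 : ∀ t → x ≡ 4 * t → Mod4 x
  rem1 : ∀ t → x ≡ 1 + 4 * t → Mod4 x
  rem2 : ∀ t → x ≡ 2 + 4 * t → Mod4 x
  rem3 : ∀ t → x ≡ 3 + 4 * t → Mod4 x

mod4 : ∀ x → Mod4 x
mod4 zero    = rem0 0 refl
mod4 (suc x) with mod4 x
... | rem0 t eq = rem1 t (cong suc eq)
... | rem1 t eq = rem2 t (cong suc eq)
... | rem2 t eq = rem3 t (cong suc eq)
... | rem3 t eq = rem0 (suc t) (trans (cong suc eq) (sym (ℕₚ.*-suc 4 t)))

module Single (n₀ : ℕ) (total : ℕ → ℕ)
  (total-positive : ∀ t → t ≤ n₀ → 1 ≤ total t)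
  (total-bounded : ∀ t → t ≤ n₀ → total t ≤ suc n₀)
  (total-onto : ∀ a → 1 ≤ a → a ≤ suc n₀ → ∃ λ t → t ≤ n₀ × total t ≡ a) where

  private
    n : ℕ
    n = suc n₀

    d ν τ : NatExpr 3
    d = var 0F
    ν = con 1 ⊕ var 1F
    τ = var 2F

    env : ℕ → Vec ℕ 3
    env t = total t ∷ n₀ ∷ t ∷ []

    facts : List (Formula 3)
    facts = (con 1 ≤ᴺ d) ∷ (d ≤ᴺ ν) ∷ (τ ≤ᴺ var 1F) ∷ []

    true-facts : ∀ t → t ≤ n₀ → All (Holds (env t)) facts
    true-facts t t≤n₀ = total-positive t t≤n₀ ∷ total-bounded t t≤n₀ ∷ t≤n₀ ∷ []

    sums₃ : Vec (IntExpr 3) 2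
    sums₃ = pos d ∷ pos (con 0) ∷ []

    x : NatExpr 3
    x = ν ⊕ con 1 ⊕ 4 ⊠ τ

    -- The rung edge d is inserted into the quadruple: the edges are
    -- −(x+1), d, x+3, −(x+2), x.
    sums₇ : Vec (IntExpr 3) 6
    sums₇ = pos d ∷ pos (con 0) ∷ neg (pos (x ⊕ con 1)) ∷ pos d ⊖ pos (x ⊕ con 1) ∷
            pos (d ⊕ con 2) ∷ pos d ⊖ pos x ∷ []

  bundles₃ : Bundles n₀ 0 total
  bundles₃ = record
    { partial           = λ t j → int (env t) (lookup sums₃ j)
    ; partial-total     = λ t → refl
    ; partial-start     = λ t → refl
    ; partial-injective = λ t t≤n₀ → lookup-injective facts (env t) (true-facts t t≤n₀) sums₃ _
    ; partial-bounded   = λ t t≤n₀ → lookup-within facts (env t) (true-facts t t≤n₀) (1 ⊠ ν) sums₃ _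
    ; partial-onto      = λ a 1≤a a≤n →
        let t , t≤n₀ , eq = total-onto a 1≤a (subst (a ≤_) (ℕₚ.*-identityˡ n) a≤n) in
        t , 0F , t≤n₀ , ∣∣-pos a (trans (ℤₚ.+-identityʳ _) (cong +_ eq))
    }

  -- The quadruple adds up to zero, so placing d before or after all four of its edges would repeat
  -- the partial sum d or 0. With x = n + 1 + 4t the quadruples of all lines fill n + 1, ..., 5n.
  bundles₇ : Bundles n₀ 4 total
  bundles₇ = record
    { partial           = partial
    ; partial-total     = λ t → refl
    ; partial-start     = λ t → refl
    ; partial-injective = λ t t≤n₀ → lookup-injective facts (env t) (true-facts t t≤n₀) sums₇ _
    ; partial-bounded   = λ t t≤n₀ → lookup-within facts (env t) (true-facts t t≤n₀) (5 ⊠ ν) sums₇ _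
    ; partial-onto      = onto
    }
    where
    partial : ℕ → Fin 6 → ℤ
    partial t j = int (env t) (lookup sums₇ j)
    Attained : ℕ → Set
    Attained a = ∃₂ λ t j → t ≤ n₀ × ∣ partial t (next (suc j)) ℤ.- partial t (suc j) ∣ ≡ a
    line : ∀ a x t q → a ≤ 5 * n → n + 1 + x ≡ a → x ≡ q + 4 * t → t ≤ n₀
    line a x t q a≤5n eq x≡ = linear (a ∷ n₀ ∷ x ∷ t ∷ q ∷ [])
      (λ a n x t q → (a ≤ᴺ 5 ⊠ (con 1 ⊕ n)) ∷ (con 1 ⊕ n ⊕ con 1 ⊕ x ≡ᴺ a) ∷ (x ≡ᴺ q ⊕ 4 ⊠ t) ∷ [] ⊢ t ≤ᴺ n)
      a≤5n eq x≡
    quad : ∀ a x → a ≤ 5 * n → n + 1 + x ≡ a → Mod4 x → Attained a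
    quad a x a≤5n eq (rem0 t x≡) = t , 4F , line a x t 0 a≤5n eq x≡ , ∣∣-pos a
      (linear (total t ∷ n₀ ∷ t ∷ a ∷ x ∷ [])
        (λ d n t a x → (con 1 ⊕ n ⊕ con 1 ⊕ x ≡ᴺ a) ∷ (x ≡ᴺ 4 ⊠ t) ∷ [] ⊢
          pos d ⊖ (pos d ⊖ pos (con 1 ⊕ n ⊕ con 1 ⊕ 4 ⊠ t)) ≡ᶻ pos a) eq x≡)
    quad a x a≤5n eq (rem1 t x≡) = t , 0F , line a x t 1 a≤5n eq x≡ , ∣∣-neg a
      (linear (total t ∷ n₀ ∷ t ∷ a ∷ x ∷ [])
        (λ d n t a x → (con 1 ⊕ n ⊕ con 1 ⊕ x ≡ᴺ a) ∷ (x ≡ᴺ con 1 ⊕ 4 ⊠ t) ∷ [] ⊢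
          neg (pos (con 1 ⊕ n ⊕ con 1 ⊕ 4 ⊠ t ⊕ con 1)) ⊖ pos (con 0) ≡ᶻ neg (pos a)) eq x≡)
    quad a x a≤5n eq (rem2 t x≡) = t , 3F , line a x t 2 a≤5n eq x≡ , ∣∣-neg a
      (linear (total t ∷ n₀ ∷ t ∷ a ∷ x ∷ [])
        (λ d n t a x → (con 1 ⊕ n ⊕ con 1 ⊕ x ≡ᴺ a) ∷ (x ≡ᴺ con 2 ⊕ 4 ⊠ t) ∷ [] ⊢
          (pos d ⊖ pos (con 1 ⊕ n ⊕ con 1 ⊕ 4 ⊠ t)) ⊖ pos (d ⊕ con 2) ≡ᶻ neg (pos a)) eq x≡)
    quad a x a≤5n eq (rem3 t x≡) = t , 2F , line a x t 3 a≤5n eq x≡ , ∣∣-pos a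
      (linear (total t ∷ n₀ ∷ t ∷ a ∷ x ∷ [])
        (λ d n t a x → (con 1 ⊕ n ⊕ con 1 ⊕ x ≡ᴺ a) ∷ (x ≡ᴺ con 3 ⊕ 4 ⊠ t) ∷ [] ⊢
          pos (d ⊕ con 2) ⊖ (pos d ⊖ pos (con 1 ⊕ n ⊕ con 1 ⊕ 4 ⊠ t ⊕ con 1)) ≡ᶻ pos a) eq x≡)
    onto : ∀ a → 1 ≤ a → a ≤ 5 * n → Attained a
    onto a 1≤a a≤5n with a ℕ.≤? n
    ... | yes a≤n = let t , t≤n₀ , eq = total-onto a 1≤a a≤n in t , 1F , t≤n₀ , ∣∣-pos a
      (linear (total t ∷ n₀ ∷ t ∷ a ∷ [])
        (λ d n t a → (d ≡ᴺ a) ∷ [] ⊢ (pos d ⊖ pos (con 1 ⊕ n ⊕ con 1 ⊕ 4 ⊠ t ⊕ con 1)) ⊖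
          neg (pos (con 1 ⊕ n ⊕ con 1 ⊕ 4 ⊠ t ⊕ con 1)) ≡ᶻ pos a) eq)
    ... | no a≰n = let x , eq = remainder (subst (_≤ a) (ℕₚ.+-comm 1 n) (ℕₚ.≰⇒> a≰n)) in
      quad a x a≤5n eq (mod4 x)

-- Rung triples for k = 5 and k = 9

record Pairs (n₀ : ℕ) (total : ℕ → ℕ) : Set where
  n = suc n₀
  field
    p y r          : ℕ → ℕ
    balance        : ∀ t → t ≤ n₀ → r t + p t ≡ total t + y t
    r-positive     : ∀ t → t ≤ n₀ → 1 ≤ r t
    total-positive : ∀ t → t ≤ n₀ → 1 ≤ total t
    -- Besides p ≠ total, this excludes p = total + 1, for which p - (z + 1) and total - z would
    -- coincide in `sums₉`.
    p-lower        : ∀ t → t ≤ n₀ → total t + 2 ≤ p t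
    p-upper        : ∀ t → t ≤ n₀ → p t ≤ 3 * n
    y-lower        : ∀ t → t ≤ n₀ → 1 ≤ y t
    y-upper        : ∀ t → t ≤ n₀ → y t ≤ 3 * n
    -- The bound p - y - (z + 1) ≥ -7n for a partial sum in `sums₉`, where z = 3n + 1 + 4t.
    y-near-p       : ∀ t → t ≤ n₀ → 4 * t + y t + 2 ≤ 4 * n + p t
    unequal        : ∀ t → t ≤ n₀ → p t < y t ⊎ y t < p t
    r-onto         : ∀ a → 1 ≤ a → a ≤ n → ∃ λ t → t ≤ n₀ × r t ≡ a
    pairs-onto     : ∀ a → n < a → a ≤ 3 * n → ∃ λ t → t ≤ n₀ × (p t ≡ a ⊎ y t ≡ a)

module Triple {n₀ : ℕ} {total : ℕ → ℕ} (𝓟 : Pairs n₀ total) where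

  open Pairs 𝓟

  private
    d π υ ν τ : NatExpr 5
    d = var 0F
    π = var 1F
    υ = var 2F
    ν = con 1 ⊕ var 3F
    τ = var 4F

    env : ℕ → Vec ℕ 5
    env t = total t ∷ p t ∷ y t ∷ n₀ ∷ t ∷ []

    -- The first inequality is `r-positive`, with r eliminated through `balance`.
    common : List (Formula 5)
    common = (π <ᴺ d ⊕ υ) ∷ (con 1 ≤ᴺ d) ∷ (d ⊕ con 2 ≤ᴺ π) ∷ (π ≤ᴺ 3 ⊠ ν) ∷ (con 1 ≤ᴺ υ) ∷ (υ ≤ᴺ 3 ⊠ ν) ∷
             (4 ⊠ τ ⊕ υ ⊕ con 2 ≤ᴺ 4 ⊠ ν ⊕ π) ∷ (τ ≤ᴺ var 3F) ∷ []

    true-common : ∀ t → t ≤ n₀ → All (Holds (env t)) common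
    true-common t h =
      linear (total t ∷ p t ∷ y t ∷ r t ∷ [])
        (λ d p y r → (r ⊕ p ≡ᴺ d ⊕ y) ∷ (con 1 ≤ᴺ r) ∷ [] ⊢ p <ᴺ d ⊕ y) (balance t h) (r-positive t h)
      ∷ total-positive t h ∷ p-lower t h ∷ p-upper t h ∷ y-lower t h ∷ y-upper t h ∷ y-near-p t h ∷ h ∷ []

    -- The condition p ≠ y is not convex, so the sums are checked once under p < y and once under y
    -- < p.
    injective : ∀ {l} (es : Vec (IntExpr 5) l) → T (pairwiseDiffer ((π <ᴺ υ) ∷ common) es) →
                T (pairwiseDiffer ((υ <ᴺ π) ∷ common) es) → ∀ t → t ≤ n₀ → ∀ i j →
                int (env t) (lookup es i) ≡ int (env t) (lookup es j) → i ≡ j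
    injective es less more t h with unequal t h
    ... | inj₁ p<y = lookup-injective _ (env t) (p<y ∷ true-common t h) es less
    ... | inj₂ y<p = lookup-injective _ (env t) (y<p ∷ true-common t h) es more

    sums₅ : Vec (IntExpr 5) 4
    sums₅ = pos d ∷ pos (con 0) ∷ pos π ∷ pos π ⊖ pos υ ∷ []

    z : NatExpr 5
    z = 3 ⊠ ν ⊕ con 1 ⊕ 4 ⊠ τ

    -- As for k = 7, with the edges π, −υ, r of sums₅ in place of d.
    sums₉ : Vec (IntExpr 5) 8
    sums₉ = pos d ∷ pos (con 0) ∷
            neg (pos (z ⊕ con 1)) ∷ pos π ⊖ pos (z ⊕ con 1) ∷
            (pos π ⊖ pos υ) ⊖ pos (z ⊕ con 1) ∷ pos d ⊖ pos (z ⊕ con 1) ∷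
            pos (d ⊕ con 2) ∷ pos d ⊖ pos z ∷ []

  bundles₅ : Bundles n₀ 2 total
  bundles₅ = record
    { partial           = partial
    ; partial-total     = λ t → refl
    ; partial-start     = λ t → refl
    ; partial-injective = injective sums₅ _ _
    ; partial-bounded   = λ t h → lookup-within common (env t) (true-common t h) (3 ⊠ ν) sums₅ _
    ; partial-onto      = onto
    }
    where
    partial : ℕ → Fin 4 → ℤ
    partial t j = int (env t) (lookup sums₅ j)
    Attained : ℕ → Set
    Attained a = ∃₂ λ t j → t ≤ n₀ × ∣ partial t (next (suc j)) ℤ.- partial t (suc j) ∣ ≡ a
    from-r : ∀ a → (∃ λ t → t ≤ n₀ × r t ≡ a) → Attained a
    from-r a (t , h , eq) = t , 2F , h , ∣∣-pos a
      (linear (total t ∷ p t ∷ y t ∷ r t ∷ a ∷ [])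
        (λ d p y r a → (r ⊕ p ≡ᴺ d ⊕ y) ∷ (r ≡ᴺ a) ∷ [] ⊢ pos d ⊖ (pos p ⊖ pos y) ≡ᶻ pos a) (balance t h) eq)
    from-pair : ∀ a → (∃ λ t → t ≤ n₀ × (p t ≡ a ⊎ y t ≡ a)) → Attained a
    from-pair a (t , h , inj₁ eq) = t , 0F , h , ∣∣-pos a (trans (ℤₚ.+-identityʳ _) (cong +_ eq))
    from-pair a (t , h , inj₂ eq) = t , 1F , h , ∣∣-neg a
      (linear (p t ∷ y t ∷ a ∷ []) (λ p y a → (y ≡ᴺ a) ∷ [] ⊢ (pos p ⊖ pos y) ⊖ pos p ≡ᶻ neg (pos a)) eq)
    onto : ∀ a → 1 ≤ a → a ≤ 3 * n → Attained a
    onto a 1≤a a≤3n with a ℕ.≤? n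
    ... | yes a≤n = from-r a (r-onto a 1≤a a≤n)
    ... | no  a≰n = from-pair a (pairs-onto a (ℕₚ.≰⇒> a≰n) a≤3n)

  -- Starting the quadruples at 3n + 1 puts them above all of r, p and y; they fill the range up to
  -- 7n.
  bundles₉ : Bundles n₀ 6 total
  bundles₉ = record
    { partial           = partial
    ; partial-total     = λ t → refl
    ; partial-start     = λ t → refl
    ; partial-injective = injective sums₉ _ _
    ; partial-bounded   = λ t h → lookup-within common (env t) (true-common t h) (7 ⊠ ν) sums₉ _
    ; partial-onto      = onto
    }
    where
    partial : ℕ → Fin 8 → ℤ
    partial t j = int (env t) (lookup sums₉ j)
    Attained : ℕ → Set
    Attained a = ∃₂ λ t j → t ≤ n₀ × ∣ partial t (next (suc j)) ℤ.- partial t (suc j) ∣ ≡ a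
    from-r : ∀ a → (∃ λ t → t ≤ n₀ × r t ≡ a) → Attained a
    from-r a (t , h , eq) = t , 3F , h , ∣∣-pos a
      (linear (total t ∷ p t ∷ y t ∷ n₀ ∷ t ∷ r t ∷ a ∷ [])
        (λ d p y n t r a → let z = 3 ⊠ (con 1 ⊕ n) ⊕ con 1 ⊕ 4 ⊠ t in
          (r ⊕ p ≡ᴺ d ⊕ y) ∷ (r ≡ᴺ a) ∷ [] ⊢
          (pos d ⊖ pos (z ⊕ con 1)) ⊖ ((pos p ⊖ pos y) ⊖ pos (z ⊕ con 1)) ≡ᶻ pos a) (balance t h) eq)
    from-pair : ∀ a → (∃ λ t → t ≤ n₀ × (p t ≡ a ⊎ y t ≡ a)) → Attained a
    from-pair a (t , h , inj₁ eq) = t , 1F , h , ∣∣-pos a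
      (linear (p t ∷ n₀ ∷ t ∷ a ∷ [])
        (λ p n t a → let z = 3 ⊠ (con 1 ⊕ n) ⊕ con 1 ⊕ 4 ⊠ t in (p ≡ᴺ a) ∷ [] ⊢
          (pos p ⊖ pos (z ⊕ con 1)) ⊖ neg (pos (z ⊕ con 1)) ≡ᶻ pos a) eq)
    from-pair a (t , h , inj₂ eq) = t , 2F , h , ∣∣-neg a
      (linear (p t ∷ y t ∷ n₀ ∷ t ∷ a ∷ [])
        (λ p y n t a → let z = 3 ⊠ (con 1 ⊕ n) ⊕ con 1 ⊕ 4 ⊠ t in (y ≡ᴺ a) ∷ [] ⊢
          ((pos p ⊖ pos y) ⊖ pos (z ⊕ con 1)) ⊖ (pos p ⊖ pos (z ⊕ con 1)) ≡ᶻ neg (pos a)) eq)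
    line : ∀ a x t q → a ≤ 7 * n → 3 * n + 1 + x ≡ a → x ≡ q + 4 * t → t ≤ n₀
    line a x t q a≤7n eq x≡ = linear (a ∷ n₀ ∷ x ∷ t ∷ q ∷ [])
      (λ a n x t q → (a ≤ᴺ 7 ⊠ (con 1 ⊕ n)) ∷ (3 ⊠ (con 1 ⊕ n) ⊕ con 1 ⊕ x ≡ᴺ a) ∷ (x ≡ᴺ q ⊕ 4 ⊠ t) ∷ [] ⊢ t ≤ᴺ n)
      a≤7n eq x≡
    quad : ∀ a x → a ≤ 7 * n → 3 * n + 1 + x ≡ a → Mod4 x → Attained a
    quad a x a≤7n eq (rem0 t x≡) = t , 6F , line a x t 0 a≤7n eq x≡ , ∣∣-pos a
      (linear (total t ∷ n₀ ∷ t ∷ a ∷ x ∷ [])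
        (λ d n t a x → (3 ⊠ (con 1 ⊕ n) ⊕ con 1 ⊕ x ≡ᴺ a) ∷ (x ≡ᴺ 4 ⊠ t) ∷ [] ⊢
          pos d ⊖ (pos d ⊖ pos (3 ⊠ (con 1 ⊕ n) ⊕ con 1 ⊕ 4 ⊠ t)) ≡ᶻ pos a) eq x≡)
    quad a x a≤7n eq (rem1 t x≡) = t , 0F , line a x t 1 a≤7n eq x≡ , ∣∣-neg a
      (linear (n₀ ∷ t ∷ a ∷ x ∷ [])
        (λ n t a x → (3 ⊠ (con 1 ⊕ n) ⊕ con 1 ⊕ x ≡ᴺ a) ∷ (x ≡ᴺ con 1 ⊕ 4 ⊠ t) ∷ [] ⊢
          neg (pos (3 ⊠ (con 1 ⊕ n) ⊕ con 1 ⊕ 4 ⊠ t ⊕ con 1)) ⊖ pos (con 0) ≡ᶻ neg (pos a)) eq x≡)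
    quad a x a≤7n eq (rem2 t x≡) = t , 5F , line a x t 2 a≤7n eq x≡ , ∣∣-neg a
      (linear (total t ∷ n₀ ∷ t ∷ a ∷ x ∷ [])
        (λ d n t a x → (3 ⊠ (con 1 ⊕ n) ⊕ con 1 ⊕ x ≡ᴺ a) ∷ (x ≡ᴺ con 2 ⊕ 4 ⊠ t) ∷ [] ⊢
          (pos d ⊖ pos (3 ⊠ (con 1 ⊕ n) ⊕ con 1 ⊕ 4 ⊠ t)) ⊖ pos (d ⊕ con 2) ≡ᶻ neg (pos a)) eq x≡)
    quad a x a≤7n eq (rem3 t x≡) = t , 4F , line a x t 3 a≤7n eq x≡ , ∣∣-pos a
      (linear (total t ∷ n₀ ∷ t ∷ a ∷ x ∷ [])
        (λ d n t a x → (3 ⊠ (con 1 ⊕ n) ⊕ con 1 ⊕ x ≡ᴺ a) ∷ (x ≡ᴺ con 3 ⊕ 4 ⊠ t) ∷ [] ⊢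
          pos (d ⊕ con 2) ⊖ (pos d ⊖ pos (3 ⊠ (con 1 ⊕ n) ⊕ con 1 ⊕ 4 ⊠ t ⊕ con 1)) ≡ᶻ pos a) eq x≡)
    onto : ∀ a → 1 ≤ a → a ≤ 7 * n → Attained a
    onto a 1≤a a≤7n with a ℕ.≤? n | a ℕ.≤? 3 * n
    ... | yes a≤n | _        = from-r a (r-onto a 1≤a a≤n)
    ... | no  a≰n | yes a≤3n = from-pair a (pairs-onto a (ℕₚ.≰⇒> a≰n) a≤3n)
    ... | no  _   | no  a≰3n = let x , eq = remainder (subst (_≤ a) (ℕₚ.+-comm 1 (3 * n)) (ℕₚ.≰⇒> a≰3n)) in
      quad a x a≤7n eq (mod4 x)

-- Rung totals for n = 4m + 1

module AlphaTotals (m n₀ : ℕ) (1≤m : 1 ≤ m) (n₀≡ : n₀ ≡ 4 * m) where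

  open Alpha m n₀ 1≤m n₀≡ using (total; total-mid; total-off)

  total-range : ∀ t → t ≤ n₀ → 1 ≤ total t × total t ≤ suc n₀
  total-range zero    _ =
    ℕₚ.≤-trans 1≤m (ℕₚ.m≤m+n m (1 * m)) ,
    linear (m ∷ n₀ ∷ []) (λ m n → (n ≡ᴺ 4 ⊠ m) ∷ [] ⊢ 2 ⊠ m ≤ᴺ con 1 ⊕ n) n₀≡
  total-range (suc t) t<n₀ with suc t ℕ.≟ 2 * m
  ... | yes eq = subst (λ d → 1 ≤ d × d ≤ suc n₀) (sym (total-mid t eq))
                   (ℕₚ.m≤n+m 1 (4 * m) , ℕₚ.≤-reflexive (trans (ℕₚ.+-comm (4 * m) 1) (cong suc (sym n₀≡))))
  ... | no neq = subst (λ d → 1 ≤ d × d ≤ suc n₀) (sym (total-off t neq)) (s≤s z≤n , ℕₚ.m≤n⇒m≤1+n t<n₀)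

  total-onto : ∀ a → 1 ≤ a → a ≤ suc n₀ → ∃ λ t → t ≤ n₀ × total t ≡ a
  total-onto (suc a) _ a<n with suc a ℕ.≟ 2 * m | suc a ℕ.≟ 4 * m + 1
  ... | yes eq | _      = 0 , z≤n , sym eq
  ... | no neq | no neq′ = suc a ,
    ℕₚ.≤-pred (ℕₚ.≤∧≢⇒< a<n (λ eq → neq′ (trans eq (trans (cong suc n₀≡) (ℕₚ.+-comm 1 (4 * m)))))) ,
    total-off a neq
  ... | no _   | yes eq′ with s , eq ← remainder (ℕₚ.≤-trans 1≤m (ℕₚ.m≤m+n m (1 * m))) = suc s ,
    linear (s ∷ m ∷ n₀ ∷ []) (λ s m n → (n ≡ᴺ 4 ⊠ m) ∷ (con 1 ⊕ s ≡ᴺ 2 ⊠ m) ∷ [] ⊢ con 1 ⊕ s ≤ᴺ n) n₀≡ eq ,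
    trans (total-mid s eq) (sym eq′)

-- Correcting pairs for n = 4m + 3

module BetaPairs (m n₀ : ℕ) (n₀≡ : n₀ ≡ 4 * m + 2) where

  open Beta m n₀ n₀≡ using (total)

  n : ℕ
  n = suc n₀

  -- The pairs {first e, 1 + first e} partition (n, 3n] ∖ {n + 1, n + 2m + 2}.
  first : ℕ → ℕ
  first e = if does (e ℕ.<? m) then n + 2 + 2 * e else n + 3 + 2 * e

  first-low : ∀ e → e < m → first e ≡ n + 2 + 2 * e
  first-low e e<m = cong (λ b → if b then n + 2 + 2 * e else n + 3 + 2 * e) (dec-true (e ℕ.<? m) e<m)

  first-high : ∀ e → m ≤ e → first e ≡ n + 3 + 2 * e
  first-high e m≤e = cong (λ b → if b then n + 2 + 2 * e else n + 3 + 2 * e)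
                          (dec-false (e ℕ.<? m) (ℕₚ.≤⇒≯ m≤e))

  first-range : ∀ e → suc e ≤ n₀ → n + 2 + 2 * e ≤ first e × 1 + first e ≤ 3 * n
  first-range e e<n₀ with e ℕ.<? m
  ... | yes e<m = ℕₚ.≤-reflexive (sym (first-low e e<m)) ,
    linear (m ∷ n₀ ∷ e ∷ first e ∷ [])
      (λ m n e f → (n ≡ᴺ 4 ⊠ m ⊕ con 2) ∷ (e <ᴺ m) ∷ (f ≡ᴺ con 1 ⊕ n ⊕ con 2 ⊕ 2 ⊠ e) ∷ [] ⊢
        con 1 ⊕ f ≤ᴺ 3 ⊠ (con 1 ⊕ n)) n₀≡ e<m (first-low e e<m)
  ... | no e≮m =
    linear (n₀ ∷ e ∷ first e ∷ [])
      (λ n e f → (f ≡ᴺ con 1 ⊕ n ⊕ con 3 ⊕ 2 ⊠ e) ∷ [] ⊢ con 1 ⊕ n ⊕ con 2 ⊕ 2 ⊠ e ≤ᴺ f) high ,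
    linear (m ∷ n₀ ∷ e ∷ first e ∷ [])
      (λ m n e f → (n ≡ᴺ 4 ⊠ m ⊕ con 2) ∷ (con 1 ⊕ e ≤ᴺ n) ∷ (f ≡ᴺ con 1 ⊕ n ⊕ con 3 ⊕ 2 ⊠ e) ∷ [] ⊢
        con 1 ⊕ f ≤ᴺ 3 ⊠ (con 1 ⊕ n)) n₀≡ e<n₀ high
    where high = first-high e (ℕₚ.≮⇒≥ e≮m)

  p y r : ℕ → ℕ
  p zero    = n + 1
  p (suc e) = [ (λ _ → first e) , (λ _ → 1 + first e) ]′ (parity e)
  y zero    = n + (2 * m + 2)
  y (suc e) = [ (λ _ → 1 + first e) , (λ _ → first e) ]′ (parity e)
  r zero    = n
  r (suc e) = [ (λ _ → 2 + e) , (λ _ → e) ]′ (parity e)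

  data Entry (e : ℕ) : Set where
    even : ∀ l → e ≡ 2 * l     → r (suc e) ≡ 2 + e → p (suc e) ≡ first e     → y (suc e) ≡ 1 + first e → Entry e
    odd  : ∀ l → e ≡ 1 + 2 * l → r (suc e) ≡ e     → p (suc e) ≡ 1 + first e → y (suc e) ≡ first e     → Entry e

  entry : ∀ e → Entry e
  entry e = by (parity e) refl
    where
    by : ∀ q → parity e ≡ q → Entry e
    by (inj₁ (l , e≡)) eq = even l e≡ (cong [ (λ _ → 2 + e) , (λ _ → e) ]′ eq)
      (cong [ (λ _ → first e) , (λ _ → 1 + first e) ]′ eq) (cong [ (λ _ → 1 + first e) , (λ _ → first e) ]′ eq)
    by (inj₂ (l , e≡)) eq = odd l e≡ (cong [ (λ _ → 2 + e) , (λ _ → e) ]′ eq)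
      (cong [ (λ _ → first e) , (λ _ → 1 + first e) ]′ eq) (cong [ (λ _ → 1 + first e) , (λ _ → first e) ]′ eq)

  balance : ∀ t → r t + p t ≡ total t + y t
  balance zero = linear (m ∷ n₀ ∷ [])
    (λ m n → (n ≡ᴺ 4 ⊠ m ⊕ con 2) ∷ [] ⊢
      (con 1 ⊕ n) ⊕ ((con 1 ⊕ n) ⊕ con 1) ≡ᴺ (2 ⊠ m ⊕ con 2) ⊕ ((con 1 ⊕ n) ⊕ (2 ⊠ m ⊕ con 2))) n₀≡
  balance (suc e) with entry e
  ... | even _ _ r≡ p≡ y≡ = linear (e ∷ r (suc e) ∷ p (suc e) ∷ y (suc e) ∷ first e ∷ [])
    (λ e r p y f → (r ≡ᴺ con 2 ⊕ e) ∷ (p ≡ᴺ f) ∷ (y ≡ᴺ con 1 ⊕ f) ∷ [] ⊢ r ⊕ p ≡ᴺ (con 1 ⊕ e) ⊕ y) r≡ p≡ y≡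
  ... | odd _ _ r≡ p≡ y≡ = linear (e ∷ r (suc e) ∷ p (suc e) ∷ y (suc e) ∷ first e ∷ [])
    (λ e r p y f → (r ≡ᴺ e) ∷ (p ≡ᴺ con 1 ⊕ f) ∷ (y ≡ᴺ f) ∷ [] ⊢ r ⊕ p ≡ᴺ (con 1 ⊕ e) ⊕ y) r≡ p≡ y≡

  r-positive : ∀ t → 1 ≤ r t
  r-positive zero    = s≤s z≤n
  r-positive (suc e) with entry e
  ... | even _ _  r≡ _ _ = subst (1 ≤_) (sym r≡) (s≤s z≤n)
  ... | odd  _ e≡ r≡ _ _ = subst (1 ≤_) (sym (trans r≡ e≡)) (s≤s z≤n)

  total-positive : ∀ t → 1 ≤ total t
  total-positive zero    = ℕₚ.≤-trans (s≤s z≤n) (ℕₚ.m≤n+m 2 (2 * m))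
  total-positive (suc t) = s≤s z≤n

  near : ∀ e → (first e ≤ p (suc e) × p (suc e) ≤ 1 + first e) × (first e ≤ y (suc e) × y (suc e) ≤ 1 + first e)
  near e with entry e
  ... | even _ _ _ p≡ y≡ = (ℕₚ.≤-reflexive (sym p≡) , ℕₚ.m≤n⇒m≤1+n (ℕₚ.≤-reflexive p≡)) ,
                           (ℕₚ.≤-trans (ℕₚ.n≤1+n _) (ℕₚ.≤-reflexive (sym y≡)) , ℕₚ.≤-reflexive y≡)
  ... | odd  _ _ _ p≡ y≡ = (ℕₚ.≤-trans (ℕₚ.n≤1+n _) (ℕₚ.≤-reflexive (sym p≡)) , ℕₚ.≤-reflexive p≡) ,
                           (ℕₚ.≤-reflexive (sym y≡) , ℕₚ.m≤n⇒m≤1+n (ℕₚ.≤-reflexive y≡))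

  p-lower : ∀ t → t ≤ n₀ → total t + 2 ≤ p t
  p-lower zero    _ = linear (m ∷ n₀ ∷ [])
    (λ m n → (n ≡ᴺ 4 ⊠ m ⊕ con 2) ∷ [] ⊢ (2 ⊠ m ⊕ con 2) ⊕ con 2 ≤ᴺ (con 1 ⊕ n) ⊕ con 1) n₀≡
  p-lower (suc e) e<n₀ = linear (n₀ ∷ e ∷ first e ∷ p (suc e) ∷ [])
    (λ n e f p → (con 1 ⊕ n ⊕ con 2 ⊕ 2 ⊠ e ≤ᴺ f) ∷ (f ≤ᴺ p) ∷ [] ⊢ (con 1 ⊕ e) ⊕ con 2 ≤ᴺ p)
    (proj₁ (first-range e e<n₀)) (proj₁ (proj₁ (near e)))

  p-upper : ∀ t → t ≤ n₀ → p t ≤ 3 * n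
  p-upper zero    _    = linear (m ∷ n₀ ∷ [])
    (λ m n → (n ≡ᴺ 4 ⊠ m ⊕ con 2) ∷ [] ⊢ (con 1 ⊕ n) ⊕ con 1 ≤ᴺ 3 ⊠ (con 1 ⊕ n)) n₀≡
  p-upper (suc e) e<n₀ = ℕₚ.≤-trans (proj₂ (proj₁ (near e))) (proj₂ (first-range e e<n₀))

  y-lower : ∀ t → t ≤ n₀ → 1 ≤ y t
  y-lower zero    _    = s≤s z≤n
  y-lower (suc e) e<n₀ = linear (n₀ ∷ e ∷ first e ∷ y (suc e) ∷ [])
    (λ n e f y → (con 1 ⊕ n ⊕ con 2 ⊕ 2 ⊠ e ≤ᴺ f) ∷ (f ≤ᴺ y) ∷ [] ⊢ con 1 ≤ᴺ y)
    (proj₁ (first-range e e<n₀)) (proj₁ (proj₂ (near e)))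

  y-upper : ∀ t → t ≤ n₀ → y t ≤ 3 * n
  y-upper zero    _    = linear (m ∷ n₀ ∷ [])
    (λ m n → (n ≡ᴺ 4 ⊠ m ⊕ con 2) ∷ [] ⊢ (con 1 ⊕ n) ⊕ (2 ⊠ m ⊕ con 2) ≤ᴺ 3 ⊠ (con 1 ⊕ n)) n₀≡
  y-upper (suc e) e<n₀ = ℕₚ.≤-trans (proj₂ (proj₂ (near e))) (proj₂ (first-range e e<n₀))

  y-near-p : ∀ t → t ≤ n₀ → 4 * t + y t + 2 ≤ 4 * n + p t
  y-near-p zero    _    = linear (m ∷ n₀ ∷ [])
    (λ m n → (n ≡ᴺ 4 ⊠ m ⊕ con 2) ∷ [] ⊢
      ((con 1 ⊕ n) ⊕ (2 ⊠ m ⊕ con 2)) ⊕ con 2 ≤ᴺ 4 ⊠ (con 1 ⊕ n) ⊕ ((con 1 ⊕ n) ⊕ con 1)) n₀≡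
  y-near-p (suc e) e<n₀ = linear (n₀ ∷ e ∷ first e ∷ p (suc e) ∷ y (suc e) ∷ [])
    (λ n e f p y → (con 1 ⊕ e ≤ᴺ n) ∷ (f ≤ᴺ p) ∷ (y ≤ᴺ con 1 ⊕ f) ∷ [] ⊢
      4 ⊠ (con 1 ⊕ e) ⊕ y ⊕ con 2 ≤ᴺ 4 ⊠ (con 1 ⊕ n) ⊕ p)
    e<n₀ (proj₁ (proj₁ (near e))) (proj₂ (proj₂ (near e)))

  unequal : ∀ t → p t < y t ⊎ y t < p t
  unequal zero    = inj₁ (linear (m ∷ n₀ ∷ [])
    (λ m n → [] ⊢ (con 1 ⊕ n) ⊕ con 1 <ᴺ (con 1 ⊕ n) ⊕ (2 ⊠ m ⊕ con 2)))
  unequal (suc e) with entry e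
  ... | even _ _ _ p≡ y≡ = inj₁ (subst₂ _<_ (sym p≡) (sym y≡) ℕₚ.≤-refl)
  ... | odd  _ _ _ p≡ y≡ = inj₂ (subst₂ _<_ (sym y≡) (sym p≡) ℕₚ.≤-refl)

  r-at-even : ∀ l → r (1 + 2 * l) ≡ 2 + 2 * l
  r-at-even l with entry (2 * l)
  ... | even _ _ r≡ _ _ = r≡
  ... | odd l′ eq _ _ _ = ⊥-elim (ℕₚ.even≢odd l l′ eq)

  r-at-odd : ∀ l → r (2 + 2 * l) ≡ 1 + 2 * l
  r-at-odd l with entry (1 + 2 * l)
  ... | even l′ eq _ _ _ = ⊥-elim (ℕₚ.even≢odd l′ l (sym eq))
  ... | odd _ _ r≡ _ _ = r≡

  r-onto : ∀ a → 1 ≤ a → a ≤ n → ∃ λ t → t ≤ n₀ × r t ≡ a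
  r-onto a 1≤a a≤n with a ℕ.≟ n | parity a
  ... | yes eq | _ = 0 , z≤n , sym eq
  ... | no neq | inj₁ (suc l , a≡) = 1 + 2 * l ,
    linear (a ∷ l ∷ n₀ ∷ [])
      (λ a l n → (a ≤ᴺ con 1 ⊕ n) ∷ (a ≡ᴺ 2 ⊠ (con 1 ⊕ l)) ∷ [] ⊢ con 1 ⊕ 2 ⊠ l ≤ᴺ n) a≤n a≡ ,
    trans (r-at-even l) (sym (trans a≡ (ℕₚ.*-suc 2 l)))
  ... | no neq | inj₁ (zero , a≡) = ⊥-elim (ℕₚ.<⇒≢ 1≤a (sym a≡))
  ... | no neq | inj₂ (l , a≡) = 2 + 2 * l ,
    linear (l ∷ m ∷ n₀ ∷ [])
      (λ l m n → (n ≡ᴺ 4 ⊠ m ⊕ con 2) ∷ (l ≤ᴺ 2 ⊠ m) ∷ [] ⊢ con 2 ⊕ 2 ⊠ l ≤ᴺ n) n₀≡ l≤2m ,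
    trans (r-at-odd l) (sym a≡)
    where
    l≤2m : l ≤ 2 * m
    l≤2m = linear (a ∷ l ∷ m ∷ n₀ ∷ [])
      (λ a l m n → (n ≡ᴺ 4 ⊠ m ⊕ con 2) ∷ (a <ᴺ con 1 ⊕ n) ∷ (a ≡ᴺ con 1 ⊕ 2 ⊠ l) ∷ [] ⊢ l ≤ᴺ 2 ⊠ m)
      n₀≡ (ℕₚ.≤∧≢⇒< a≤n neq) a≡

  Attained : ℕ → Set
  Attained a = ∃ λ t → t ≤ n₀ × (p t ≡ a ⊎ y t ≡ a)

  first-attained : ∀ a e → suc e ≤ n₀ → first e ≡ a → Attained a
  first-attained a e e<n₀ eq with entry e
  ... | even _ _ _ p≡ _ = suc e , e<n₀ , inj₁ (trans p≡ eq)
  ... | odd  _ _ _ _ y≡ = suc e , e<n₀ , inj₂ (trans y≡ eq)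

  second-attained : ∀ a e → suc e ≤ n₀ → 1 + first e ≡ a → Attained a
  second-attained a e e<n₀ eq with entry e
  ... | even _ _ _ _ y≡ = suc e , e<n₀ , inj₂ (trans y≡ eq)
  ... | odd  _ _ _ p≡ _ = suc e , e<n₀ , inj₁ (trans p≡ eq)

  attained : ∀ a x e c → suc e ≤ n₀ → first e ≡ n + c + 2 * e → n + c + x ≡ a →
             (x ≡ 2 * e ⊎ x ≡ 1 + 2 * e) → Attained a
  attained a x e c e<n₀ f≡ eq (inj₁ x≡) = first-attained a e e<n₀
    (linear (a ∷ x ∷ e ∷ c ∷ n ∷ first e ∷ [])
      (λ a x e c n f → (f ≡ᴺ n ⊕ c ⊕ 2 ⊠ e) ∷ (n ⊕ c ⊕ x ≡ᴺ a) ∷ (x ≡ᴺ 2 ⊠ e) ∷ [] ⊢ f ≡ᴺ a) f≡ eq x≡)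
  attained a x e c e<n₀ f≡ eq (inj₂ x≡) = second-attained a e e<n₀
    (linear (a ∷ x ∷ e ∷ c ∷ n ∷ first e ∷ [])
      (λ a x e c n f → (f ≡ᴺ n ⊕ c ⊕ 2 ⊠ e) ∷ (n ⊕ c ⊕ x ≡ᴺ a) ∷ (x ≡ᴺ con 1 ⊕ 2 ⊠ e) ∷ [] ⊢ con 1 ⊕ f ≡ᴺ a) f≡ eq x≡)

  halve : ∀ x → ∃ λ e → x ≡ 2 * e ⊎ x ≡ 1 + 2 * e
  halve x = [ (λ (e , eq) → e , inj₁ eq) , (λ (e , eq) → e , inj₂ eq) ]′ (parity x)

  half-bounds : ∀ {x} e → (x ≡ 2 * e ⊎ x ≡ 1 + 2 * e) → 2 * e ≤ x × x ≤ 1 + 2 * e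
  half-bounds e (inj₁ refl) = ℕₚ.≤-refl , ℕₚ.n≤1+n _
  half-bounds e (inj₂ refl) = ℕₚ.n≤1+n _ , ℕₚ.≤-refl

  low-attained : ∀ a x → a < n + (2 * m + 2) → n + 2 + x ≡ a → Attained a
  low-attained a x a< eq = by (halve x)
    where
    by : (∃ λ e → x ≡ 2 * e ⊎ x ≡ 1 + 2 * e) → Attained a
    by (e , x≡) = attained a x e 2 e<n₀ (first-low e e<m) eq x≡
      where
      e<m : e < m
      e<m = linear (a ∷ x ∷ e ∷ m ∷ n ∷ [])
        (λ a x e m n → (a <ᴺ n ⊕ (2 ⊠ m ⊕ con 2)) ∷ (n ⊕ con 2 ⊕ x ≡ᴺ a) ∷ (2 ⊠ e ≤ᴺ x) ∷ [] ⊢ e <ᴺ m)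
        a< eq (proj₁ (half-bounds e x≡))
      e<n₀ : suc e ≤ n₀
      e<n₀ = linear (e ∷ m ∷ n₀ ∷ []) (λ e m n → (n ≡ᴺ 4 ⊠ m ⊕ con 2) ∷ (e <ᴺ m) ∷ [] ⊢ con 1 ⊕ e ≤ᴺ n) n₀≡ e<m

  high-attained : ∀ a x → n + (2 * m + 2) < a → a ≤ 3 * n → n + 3 + x ≡ a → Attained a
  high-attained a x <a a≤3n eq = by (halve x)
    where
    by : (∃ λ e → x ≡ 2 * e ⊎ x ≡ 1 + 2 * e) → Attained a
    by (e , x≡) = attained a x e 3 e<n₀ (first-high e m≤e) eq x≡
      where
      m≤e : m ≤ e
      m≤e = linear (a ∷ x ∷ e ∷ m ∷ n ∷ [])
        (λ a x e m n → (n ⊕ (2 ⊠ m ⊕ con 2) <ᴺ a) ∷ (n ⊕ con 3 ⊕ x ≡ᴺ a) ∷ (x ≤ᴺ con 1 ⊕ 2 ⊠ e) ∷ [] ⊢ m ≤ᴺ e)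
        <a eq (proj₂ (half-bounds e x≡))
      e<n₀ : suc e ≤ n₀
      e<n₀ = linear (a ∷ x ∷ e ∷ m ∷ n₀ ∷ [])
        (λ a x e m n → (n ≡ᴺ 4 ⊠ m ⊕ con 2) ∷ (a ≤ᴺ 3 ⊠ (con 1 ⊕ n)) ∷ (con 1 ⊕ n ⊕ con 3 ⊕ x ≡ᴺ a) ∷
          (2 ⊠ e ≤ᴺ x) ∷ [] ⊢ con 1 ⊕ e ≤ᴺ n) n₀≡ a≤3n eq (proj₁ (half-bounds e x≡))

  pairs-onto : ∀ a → n < a → a ≤ 3 * n → Attained a
  pairs-onto a n<a a≤3n with a ℕ.≟ n + 1 | ℕₚ.<-cmp a (n + (2 * m + 2))
  ... | yes eq | _ = 0 , z≤n , inj₁ (sym eq)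
  ... | no _   | tri≈ _ eq _ = 0 , z≤n , inj₂ (sym eq)
  ... | no neq | tri< a< _ _ = let x , eq = remainder bound in low-attained a x a< eq
    where
    bound : n + 2 ≤ a
    bound = subst (_≤ a) (ℕₚ.+-comm 2 n) (ℕₚ.≤∧≢⇒< n<a (λ eq → neq (trans (sym eq) (ℕₚ.+-comm 1 n))))
  ... | no _   | tri> _ _ <a = let x , eq = remainder bound in high-attained a x <a a≤3n eq
    where
    bound : n + 3 ≤ a
    bound = linear (a ∷ m ∷ n ∷ []) (λ a m n → (n ⊕ (2 ⊠ m ⊕ con 2) <ᴺ a) ∷ [] ⊢ n ⊕ con 3 ≤ᴺ a) <a

  pairs : Pairs n₀ total
  pairs = record
    { p = p ; y = y ; r = r
    ; balance        = λ t _ → balance t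
    ; r-positive     = λ t _ → r-positive t
    ; total-positive = λ t _ → total-positive t
    ; p-lower        = p-lower
    ; p-upper        = p-upper
    ; y-lower        = y-lower
    ; y-upper        = y-upper
    ; y-near-p       = y-near-p
    ; unequal        = λ t _ → unequal t
    ; r-onto         = r-onto
    ; pairs-onto     = pairs-onto
    }

-- From ladders to biembeddings

Biembeddable : ℕ → ℕ → Set
Biembeddable M k =
  OrientableKBiembedding (completeGraph (2 * M + 1)) k × OrientableKBiembedding (cocktailParty (M + 1)) k

biembeddable : ∀ {M k} → CurrentGraph M (suc k) → Biembeddable M (suc k)
biembeddable {M} {k} 𝓒 =
  onComplete (2 * M + 1) refl {{ℕ.>-nonZero (ℕₚ.m≤n+m 1 (2 * M))}} ,
  onCocktail (M + 1) refl {{ℕ.>-nonZero (ℕₚ.≤-trans (ℕₚ.m≤n+m 1 M) (ℕₚ.m≤m+n (M + 1) (M + 1)))}}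
  where
  onComplete : ∀ N → N ≡ 2 * M + 1 → .{{_ : ℕ.NonZero N}} → OrientableKBiembedding (completeGraph N) (suc k)
  onComplete N eq = Biembedding.biembedding (completeGraph-circulant M N eq) 𝓒
  onCocktail : ∀ t → t ≡ M + 1 → .{{_ : ℕ.NonZero (t + t)}} → OrientableKBiembedding (cocktailParty t) (suc k)
  onCocktail t eq = Biembedding.biembedding (cocktailParty-circulant M t eq) 𝓒

-- Both n = 3 + 2d and k = 3 + 2c are odd. The first lets the walk on slot 1, two lines at a time,
-- visit every line; the second lets the odd slots of a line end in slot 0.
ladder-biembeddable : ∀ n₀ d c → n₀ ≡ 2 + 2 * d → Ladder n₀ (2 * c) → Biembeddable (suc n₀ * (3 + 2 * c)) (3 + 2 * c)
ladder-biembeddable _ d c refl L = biembeddable (LadderGraph.currentGraph L (OneFace.faceWalk-transitive d c))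

module AlphaBiembeddings (m n₀ : ℕ) (n₀≡ : n₀ ≡ 4 * suc m) where

  open Alpha (suc m) n₀ (s≤s z≤n) n₀≡ using (total; alphaRails)
  open AlphaTotals (suc m) n₀ (s≤s z≤n) n₀≡
  open Single n₀ total (λ t h → proj₁ (total-range t h)) (λ t h → proj₂ (total-range t h)) total-onto

  private
    even-n₀ : n₀ ≡ 2 + 2 * (1 + 2 * m)
    even-n₀ = linear (m ∷ n₀ ∷ [])
      (λ m n → (n ≡ᴺ 4 ⊠ (con 1 ⊕ m)) ∷ [] ⊢ n ≡ᴺ con 2 ⊕ 2 ⊠ (con 1 ⊕ 2 ⊠ m)) n₀≡

  biembeddable₃ : Biembeddable (suc n₀ * 3) 3
  biembeddable₃ = ladder-biembeddable n₀ (1 + 2 * m) 0 even-n₀ (ladder alphaRails bundles₃)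

  biembeddable₇ : Biembeddable (suc n₀ * 7) 7
  biembeddable₇ = ladder-biembeddable n₀ (1 + 2 * m) 2 even-n₀ (ladder alphaRails bundles₇)

module BetaBiembeddings (m n₀ : ℕ) (n₀≡ : n₀ ≡ 4 * m + 2) where

  open Beta m n₀ n₀≡ using (betaRails)
  open Triple (BetaPairs.pairs m n₀ n₀≡)

  private
    even-n₀ : n₀ ≡ 2 + 2 * (2 * m)
    even-n₀ = linear (m ∷ n₀ ∷ []) (λ m n → (n ≡ᴺ 4 ⊠ m ⊕ con 2) ∷ [] ⊢ n ≡ᴺ con 2 ⊕ 2 ⊠ (2 ⊠ m)) n₀≡

  biembeddable₅ : Biembeddable (suc n₀ * 5) 5
  biembeddable₅ = ladder-biembeddable n₀ (2 * m) 1 even-n₀ (ladder betaRails bundles₅)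

  biembeddable₉ : Biembeddable (suc n₀ * 9) 9
  biembeddable₉ = ladder-biembeddable n₀ (2 * m) 3 even-n₀ (ladder betaRails bundles₉)

product-residue : ∀ q t k → ((q + 4 * t) * k) % 4 ≡ (q * k) % 4
product-residue q t k = trans (cong (_% 4) (expand q t k)) ([m+kn]%n≡m%n (q * k) (t * k) 4)
  where
  expand : ∀ q t k → (q + 4 * t) * k ≡ q * k + (t * k) * 4
  expand = ℕSolver.solve-∀

theorem1p11 : (k n : ℕ) →
    (k ≡ 3 ⊎ k ≡ 5 ⊎ k ≡ 7 ⊎ k ≡ 9) →
    k < n →
    (n * k) % 4 ≡ 3 →
    OrientableKBiembedding (completeGraph (2 * (n * k) + 1)) k
    × OrientableKBiembedding (cocktailParty (n * k + 1)) k
theorem1p11 k n k∈ k<n nk≡3 = by-residue k∈ (mod4 n)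
  where
  -- Modulo 4 the product depends only on the remainder q of n, so every impossible combination of q
  -- and k reduces to a false equation of numerals.
  residue-at : ∀ q t → n ≡ q + 4 * t → (q * k) % 4 ≡ 3
  residue-at q t refl = trans (sym (product-residue q t k)) nk≡3

  one-mod-4 : ∀ t → k < n → n ≡ 1 + 4 * t → k ≡ 3 ⊎ k ≡ 7 → Biembeddable (n * k) k
  -- Here n = 1, which k < n rules out; the two zigzags require m ≥ 1.
  one-mod-4 zero    (s≤s ()) refl (inj₁ refl)
  one-mod-4 zero    (s≤s ()) refl (inj₂ refl)
  one-mod-4 (suc m) _ refl (inj₁ refl) = AlphaBiembeddings.biembeddable₃ m (4 * suc m) refl
  one-mod-4 (suc m) _ refl (inj₂ refl) = AlphaBiembeddings.biembeddable₇ m (4 * suc m) refl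

  three-mod-4 : ∀ t → n ≡ 3 + 4 * t → k ≡ 5 ⊎ k ≡ 9 → Biembeddable (n * k) k
  three-mod-4 m refl (inj₁ refl) = BetaBiembeddings.biembeddable₅ m (2 + 4 * m) (ℕₚ.+-comm 2 (4 * m))
  three-mod-4 m refl (inj₂ refl) = BetaBiembeddings.biembeddable₉ m (2 + 4 * m) (ℕₚ.+-comm 2 (4 * m))

  by-residue : k ≡ 3 ⊎ k ≡ 5 ⊎ k ≡ 7 ⊎ k ≡ 9 → Mod4 n → Biembeddable (n * k) k
  by-residue _ (rem0 t eq) with () ← residue-at 0 t eq
  by-residue (inj₁ k≡)               (rem1 t eq) = one-mod-4 t k<n eq (inj₁ k≡)
  by-residue (inj₂ (inj₁ refl))      (rem1 t eq) with () ← residue-at 1 t eq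
  by-residue (inj₂ (inj₂ (inj₁ k≡))) (rem1 t eq) = one-mod-4 t k<n eq (inj₂ k≡)
  by-residue (inj₂ (inj₂ (inj₂ refl))) (rem1 t eq) with () ← residue-at 1 t eq
  by-residue (inj₁ refl)             (rem2 t eq) with () ← residue-at 2 t eq
  by-residue (inj₂ (inj₁ refl))      (rem2 t eq) with () ← residue-at 2 t eq
  by-residue (inj₂ (inj₂ (inj₁ refl))) (rem2 t eq) with () ← residue-at 2 t eq
  by-residue (inj₂ (inj₂ (inj₂ refl))) (rem2 t eq) with () ← residue-at 2 t eq
  by-residue (inj₁ refl)             (rem3 t eq) with () ← residue-at 3 t eq
  by-residue (inj₂ (inj₁ k≡))        (rem3 t eq) = three-mod-4 t eq (inj₁ k≡)
  by-residue (inj₂ (inj₂ (inj₁ refl))) (rem3 t eq) with () ← residue-at 3 t eq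
  by-residue (inj₂ (inj₂ (inj₂ k≡))) (rem3 t eq) = three-mod-4 t eq (inj₂ k≡)
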